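{- Let $a \in \mathbf{F}_q$ be nonzero and let $n\ge 1$. Let $f(x) \in \mathbf{F}_q[x]$ be a nontrivial $a$-self reciprocal monic polynomial of degree $2n$ that is a product of $r$ pairwise distinct monic irreducible polynomials over $\mathbf{F}_q$. Then $r \equiv 0 \pmod 2$ if and only if $$(-1)^n a^{n(n-2)} f(\sqrt{a})\, f(-\sqrt{a})$$ is a square in $\mathbf{F}_q$, where $\sqrt{a}$ is a square root of $a$ in an extension of $\mathbf{F}_q$.
   Context: Let $q=p^e$ be an odd prime power and $\mathbf{F}_q$ the finite field with $q$ elements. For a nonzero $a\in\mathbf{F}_q$ and a monic polynomial $f(x)=\sum_{i=0}^N b_i x^i \in \mathbf{F}_q[x]$ of degree $N$ with $f(0)\neq 0$, the $a$-reciprocal of $f$ is $\hat{f}_a(x) := \frac{x^N}{f(0)} f\left(\frac{a}{x}\right) = \frac{1}{b_0}\sum_{i=0}^N b_i a^i x^{N-i}$. A monic polynomial $f(x)$ (with $f(0)\ne 0$) is $a$-self reciprocal if $\hat{f}_a(x)=f(x)$. An $a$-self reciprocal monic polynomial of even degree $N=2m$ is called nontrivial if its constant term is $b_0=a^m$. The product $f(\sqrt{a})f(-\sqrt{a})$ always lies in $\mathbf{F}_q$. The exponent $n(n-2)$ may be negative (when $n=1$), in which case the power is taken in the multiplicative group of $\mathbf{F}_q$. -}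

module Defs where

open import Algebra.Apartness.Bundles using (HeytingCommutativeRing; HeytingField)
open import Algebra.Bundles using (CommutativeRing)
open import Algebra.Bundles.Raw using (RawRing; RawSemiring)
import Algebra.Apartness.Properties.HeytingCommutativeRing as HeytingProperties
import Algebra.Definitions.RawSemiring as SemiringDefinitions
open import Data.Fin.Base using (Fin)
open import Data.Integer.Base using (ℤ; +_; -[1+_])
open import Data.List.Base using (List; []; _∷_; map; applyDownFrom)
open import Data.Nat.Base as ℕ using (ℕ; zero; suc)
open import Data.Product.Base using (∃; _×_; proj₁; proj₂)
open import Function.Bundles using (Inverse)
open import Level using (_⊔_)
import Relation.Binary.PropositionalEquality as ≡

-- A polynomial is its list of coefficients, constant term first.  Trailing
-- zeros are allowed, so equality is coefficientwise after padding with zeros.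

module Polynomial {c ℓ} (R : RawRing c ℓ) where
  open RawRing R

  Poly : Set c
  Poly = List Carrier

  coeff : Poly → ℕ → Carrier
  coeff []      _       = 0#
  coeff (b ∷ f) zero    = b
  coeff (b ∷ f) (suc i) = coeff f i

  infix  4 _≈ₚ_
  infixl 6 _+ₚ_
  infixl 7 _*ₚ_

  _≈ₚ_ : Poly → Poly → Set ℓ
  f ≈ₚ g = ∀ i → coeff f i ≈ coeff g i

  _+ₚ_ : Poly → Poly → Poly
  []      +ₚ g       = g
  (b ∷ f) +ₚ []      = b ∷ f
  (b ∷ f) +ₚ (d ∷ g) = b + d ∷ f +ₚ g

  _*ₚ_ : Poly → Poly → Poly
  []      *ₚ g = []
  (b ∷ f) *ₚ g = map (b *_) g +ₚ (0# ∷ f *ₚ g)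

  polyRawSemiring : RawSemiring c ℓ
  polyRawSemiring = record
    { Carrier = Poly
    ; _≈_     = _≈ₚ_
    ; _+_     = _+ₚ_
    ; _*_     = _*ₚ_
    ; 0#      = []
    ; 1#      = 1# ∷ []
    }

  open RawSemiring polyRawSemiring public
    using () renaming (_≉_ to _≉ₚ_)
  open SemiringDefinitions polyRawSemiring public
    using (Irreducible; product)

  eval : Poly → Carrier → Carrier
  eval []      x = 0#
  eval (b ∷ f) x = b + x * eval f x

  MonicOfDegree : ℕ → Poly → Set ℓ
  MonicOfDegree N f = coeff f N ≈ 1# × (∀ i → N ℕ.< i → coeff f i ≈ 0#)

  Monic : Poly → Set ℓ
  Monic f = ∃ λ N → MonicOfDegree N f

-- In a Heyting field `x # 0#` says that x is invertible; over a field with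
-- decidable equality, in particular a finite one, it is equivalent to ¬ x ≈ 0#.

module Field {c ℓ₁ ℓ₂} (K : HeytingField c ℓ₁ ℓ₂) where
  open HeytingField K
  open HeytingProperties heytingCommutativeRing using (x-0≈x)

  commutativeRing : CommutativeRing c ℓ₁
  commutativeRing = HeytingCommutativeRing.commutativeRing heytingCommutativeRing

  open CommutativeRing commutativeRing public using (rawRing)
  open SemiringDefinitions (RawRing.rawSemiring rawRing) public using (_^_)
  open Polynomial rawRing public

  inverse : ∀ x → x # 0# → Carrier
  inverse x x#0 = proj₁ (#⇒invertible x#0)

  inverse-* : ∀ x (x#0 : x # 0#) → inverse x x#0 * x ≈ 1#
  inverse-* x x#0 =
    trans (*-congˡ (sym (x-0≈x x))) (proj₁ (proj₂ (#⇒invertible x#0)))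

  zpow : ∀ x → x # 0# → ℤ → Carrier
  zpow x x#0 (+ k)    = x ^ k
  zpow x x#0 -[1+ k ] = inverse x x#0 ^ suc k

  IsSquare : Carrier → Set _
  IsSquare x = ∃ λ y → y * y ≈ x

  HasOrder : ℕ → Set _
  HasOrder q = Inverse setoid (≡.setoid (Fin q))

  -- The list has the entry  bᵢ aⁱ / b₀  at position  N - i,  where bᵢ is
  -- the i-th coefficient of f; this is the polynomial  (xᴺ / f(0)) f(a/x)
  -- when f has degree N.
  reciprocal : Carrier → ℕ → (f : Poly) → coeff f 0 # 0# → Poly
  reciprocal a N f b₀#0 =
    applyDownFrom (λ i → inverse (coeff f 0) b₀#0 * (coeff f i * a ^ i)) (suc N)

  record SelfReciprocal (a : Carrier) (N : ℕ) (f : Poly) : Set (ℓ₁ ⊔ ℓ₂) where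
    field
      monic        : MonicOfDegree N f
      b₀#0         : coeff f 0 # 0#
      reciprocal≈f : reciprocal a N f b₀#0 ≈ₚ f

  record NontrivialSelfReciprocal (a : Carrier) (m : ℕ) (f : Poly) : Set (ℓ₁ ⊔ ℓ₂) where
    field
      selfReciprocal : SelfReciprocal a (2 ℕ.* m) f
      b₀≈aᵐ          : coeff f 0 ≈ a ^ m

-- Write q = 2t + 1 and N(f) = f(√a) f(-√a); N is multiplicative and has values
-- in F_q.  Since a^(n(n-2)) and aⁿ differ by a square, Euler's criterion reduces
-- the claim to ((-a)ⁿ N(f))ᵗ = (-1)ʳ, which is proved by induction on r.
--
-- Let h be the first irreducible factor, of degree d, and α its root in the
-- field K = F_q[x]/(h) with q^d elements; the roots of h are the α^(q^i), i < d.
-- As f is self-reciprocal, a/α is a root of f, hence of one of the factors g.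
-- If g ≠ h, then g is the a-reciprocal of h and (-a)^d N(h g) is a nonzero
-- square.  If g = h, then either α² = a, and α would be a multiple root of f, or
-- d = 2m, a/α = α^(q^m) and (-a)^m N(h) = Δ² for
-- Δ = (-a)^m ∏_{i<m} (α - a/α)^(q^i).  As Δ^q = -Δ, the t-th power of Δ² is -1.
-- In both cases the cofactor of h g, or of h, is again nontrivial self-reciprocal.
module Submission where

open import Defs
open import Algebra.Apartness.Bundles using (HeytingField)
import Algebra.Apartness.Properties.HeytingCommutativeRing as HeytingProperties
open import Algebra.Bundles using (CommutativeMonoid; CommutativeRing)
open import Algebra.Definitions.RawMagma using (_,_)
open import Algebra.Morphism.Structures using (IsRingHomomorphism; IsRingMonomorphism)
import Algebra.Properties.CommutativeSemigroup as CommutativeSemigroupProperties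
import Algebra.Properties.CommutativeSemiring.Exp as Exp
import Algebra.Properties.Monoid.Mult.TCOptimised as TCOptimised
import Algebra.Solver.Ring as RingSolver
open import Algebra.Solver.Ring.AlmostCommutativeRing using (_-Raw-AlmostCommutative⟶_; fromCommutativeRing)
open import Algebra.Structures using (IsAbelianGroup)
open import Data.Empty using (⊥-elim)
open import Data.Fin.Base as Fin using (Fin; finToFun; fromℕ; funToFin; inject₁; punchIn; suc; toℕ; zero)
open import Data.Fin.Permutation using (Permutation′; permutation)
import Data.Fin.Properties as Finₚ
open import Data.Integer.Base as ℤ using (+_; -[1+_]; ℤ)
open import Data.Integer.Properties as ℤₚ using (+◃n≡+n)
open import Data.List.Base using ([]; _∷_; applyDownFrom; map; tabulate)
open import Data.Maybe.Base as Maybe using (Maybe)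
open import Data.Nat.Base as ℕ using (suc; s≤s; zero; z≤n; ℕ)
open import Data.Nat.DivMod using (m/n*n≡m)
open import Data.Nat.Divisibility as Divisibility using (>⇒∤; _∣_; divides; ∣-refl; ∣m⇒∣m*n)
open import Data.Nat.Primality as Primality using (Prime; euclidsLemma; prime⇒nonTrivial; prime⇒nonZero)
import Data.Nat.Properties as ℕₚ
open import Data.Product.Base using (_,_; _×_; proj₁; proj₂; ∃; ∃₂)
import Data.Sign.Base as Sign
open import Data.Sum.Base using ([_,_]′; _⊎_; fromInj₁; fromInj₂; inj₁; inj₂)
open import Function.Base using (_∘_)
open import Function.Bundles as Bundles using (Inverse; _⇔_; mk⇔)
open import Level using (_⊔_)
open import Relation.Binary.Bundles using (Setoid)
open import Relation.Binary.Definitions using (tri<; tri>; tri≈)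
open import Relation.Binary.PropositionalEquality.Core as ≡ using (_≡_; _≢_)
import Relation.Binary.PropositionalEquality.Properties as ≡ₚ
import Relation.Binary.Reasoning.Setoid as SetoidReasoning
open import Relation.Binary.Structures using (IsEquivalence)
import Relation.Nullary.Decidable as Dec
open import Relation.Nullary.Decidable.Core using (Dec; dec⇒maybe; no; yes)
open import Relation.Nullary.Negation.Core using (¬_)

-- No square root of a is adjoined for the main argument: N(f) is the norm form of F[√a], computed
-- in F from the even and odd coefficients of f, and is matched with the values at √a in the given
-- extension only at the end. The factor (-a)^n comes from N(x) = -a: modulo x² - a the reversal of
-- f of degree N is x^N f, so reversing multiplies N(f) by (-a)^N. A single root α of one factor
-- suffices, since a/α already lies in F[x]/(h); no splitting field of f is built. The other factors
-- are controlled by the rule that a polynomial over F vanishing at α is a multiple of h. The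
-- obstacle is a fixed point α² = a of x ↦ a/x. There h(0) = -α^N, while f(0) = a^n = α^(2n); the
-- mismatch of sign forces the cofactor of h to vanish at α, against distinctness. This is where
-- nontriviality enters, and why the induction has to carry it to every cofactor. The quadratic
-- character is kept as a t-th power, which is multiplicative and meaningful in F even where the
-- square root Δ lies only in K.

-- Normalising ring identities with integer coefficients.

module IntegerCoefficients {c ℓ} (R : CommutativeRing c ℓ) where

  open CommutativeRing R hiding (zero)
  open import Algebra.Properties.Ring ring using (-0#≈0#; -‿involutive; -‿distribˡ-*; -‿distribʳ-*; -‿+-comm)
  open import Algebra.Properties.Semiring.Mult semiring using (×1-homo-*; ×-homo-+) renaming (_×_ to _·_)
  open TCOptimised +-monoid using (×ᵤ≈×) renaming (_×_ to _·′_)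
  open SetoidReasoning setoid

  ·≈·′ : ∀ n → n · 1# ≈ n ·′ 1#
  ·≈·′ n = ×ᵤ≈× n 1#

  -- The optimised multiple makes the images of 0 and 1 reduce to `0#` and `1#` themselves, so that
  -- `con (+ 0)` and `con (+ 1)` match goals by computation.
  ⟦_⟧ : ℤ → Carrier
  ⟦ + n ⟧      = n ·′ 1#
  ⟦ -[1+ n ] ⟧ = - (suc n ·′ 1#)

  ⟦⊖⟧ : ∀ m n → ⟦ m ℤ.⊖ n ⟧ ≈ m · 1# - n · 1#
  ⟦⊖⟧ m zero = begin
    ⟦ m ℤ.⊖ 0 ⟧     ≡⟨ ≡.cong ⟦_⟧ (ℤₚ.⊖-≥ {m} ℕ.z≤n) ⟩
    m ·′ 1#          ≈⟨ ·≈·′ m ⟨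
    m · 1#           ≈⟨ +-identityʳ _ ⟨
    m · 1# + 0#      ≈⟨ +-congˡ -0#≈0# ⟨
    m · 1# - 0#      ∎
  ⟦⊖⟧ zero (suc n) = trans (-‿cong (sym (·≈·′ (suc n)))) (sym (+-identityˡ _))
  ⟦⊖⟧ (suc m) (suc n) = begin
    ⟦ suc m ℤ.⊖ suc n ⟧                 ≡⟨ ≡.cong ⟦_⟧ (ℤₚ.[1+m]⊖[1+n]≡m⊖n m n) ⟩
    ⟦ m ℤ.⊖ n ⟧                         ≈⟨ ⟦⊖⟧ m n ⟩
    m · 1# - n · 1#                     ≈⟨ +-congʳ (+-identityʳ _) ⟨
    m · 1# + 0# - n · 1#                ≈⟨ +-congʳ (+-congˡ (-‿inverseʳ 1#)) ⟨
    m · 1# + (1# - 1#) - n · 1#         ≈⟨ +-congʳ (+-assoc _ _ _) ⟨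
    m · 1# + 1# - 1# - n · 1#           ≈⟨ +-assoc _ _ _ ⟩
    m · 1# + 1# + (- 1# - n · 1#)       ≈⟨ +-cong (+-comm _ _) (-‿+-comm _ _) ⟩
    suc m · 1# - suc n · 1#             ∎

  ⟦-⟧ : ∀ i → ⟦ ℤ.- i ⟧ ≈ - ⟦ i ⟧
  ⟦-⟧ (+ zero)   = sym -0#≈0#
  ⟦-⟧ (+ suc n)  = refl
  ⟦-⟧ -[1+ n ]   = sym (-‿involutive _)

  ⟦+⟧ : ∀ i j → ⟦ i ℤ.+ j ⟧ ≈ ⟦ i ⟧ + ⟦ j ⟧
  ⟦+⟧ (+ m)    (+ n)    = begin
    (m ℕ.+ n) ·′ 1#     ≈⟨ ·≈·′ (m ℕ.+ n) ⟨
    (m ℕ.+ n) · 1#      ≈⟨ ×-homo-+ 1# m n ⟩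
    m · 1# + n · 1#     ≈⟨ +-cong (·≈·′ m) (·≈·′ n) ⟩
    m ·′ 1# + n ·′ 1#   ∎
  ⟦+⟧ (+ m)    -[1+ n ] = trans (⟦⊖⟧ m (suc n)) (+-cong (·≈·′ m) (-‿cong (·≈·′ (suc n))))
  ⟦+⟧ -[1+ m ] (+ n)    = trans (⟦⊖⟧ n (suc m)) (trans (+-cong (·≈·′ n) (-‿cong (·≈·′ (suc m)))) (+-comm _ _))
  ⟦+⟧ -[1+ m ] -[1+ n ] = begin
    - (suc (suc (m ℕ.+ n)) ·′ 1#)          ≈⟨ -‿cong (·≈·′ (suc (suc (m ℕ.+ n)))) ⟨
    - (1# + (1# + (m ℕ.+ n) · 1#))         ≈⟨ -‿cong (+-congˡ (+-congˡ (×-homo-+ 1# m n))) ⟩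
    - (1# + (1# + (m · 1# + n · 1#)))      ≈⟨ -‿cong (+-congˡ (trans (sym (+-assoc _ _ _)) (trans (+-congʳ (+-comm _ _)) (+-assoc _ _ _)))) ⟩
    - (1# + (m · 1# + suc n · 1#))         ≈⟨ -‿cong (+-assoc _ _ _) ⟨
    - (suc m · 1# + suc n · 1#)            ≈⟨ -‿+-comm _ _ ⟨
    - (suc m · 1#) - suc n · 1#            ≈⟨ +-cong (-‿cong (·≈·′ (suc m))) (-‿cong (·≈·′ (suc n))) ⟩
    - (suc m ·′ 1#) - suc n ·′ 1#          ∎

  ⟦+◃⟧ : ∀ n → ⟦ Sign.+ ℤ.◃ n ⟧ ≈ n · 1#
  ⟦+◃⟧ n = trans (reflexive (≡.cong ⟦_⟧ (ℤₚ.+◃n≡+n n))) (sym (·≈·′ n))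

  ⟦-◃⟧ : ∀ n → ⟦ Sign.- ℤ.◃ n ⟧ ≈ - (n · 1#)
  ⟦-◃⟧ n = trans (reflexive (≡.cong ⟦_⟧ (ℤₚ.-◃n≡-n n))) (trans (⟦-⟧ (+ n)) (-‿cong (sym (·≈·′ n))))

  ·′-homo-* : ∀ m n → (m ℕ.* n) · 1# ≈ (m ·′ 1#) * (n ·′ 1#)
  ·′-homo-* m n = trans (×1-homo-* m n) (*-cong (·≈·′ m) (·≈·′ n))

  ⟦*⟧ : ∀ i j → ⟦ i ℤ.* j ⟧ ≈ ⟦ i ⟧ * ⟦ j ⟧
  ⟦*⟧ (+ m)    (+ n)    = trans (⟦+◃⟧ (m ℕ.* n)) (·′-homo-* m n)
  ⟦*⟧ (+ m)    -[1+ n ] = trans (⟦-◃⟧ (m ℕ.* suc n)) (trans (-‿cong (·′-homo-* m (suc n))) (-‿distribʳ-* _ _))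
  ⟦*⟧ -[1+ m ] (+ n)    = trans (⟦-◃⟧ (suc m ℕ.* n)) (trans (-‿cong (·′-homo-* (suc m) n)) (-‿distribˡ-* _ _))
  ⟦*⟧ -[1+ m ] -[1+ n ] = begin
    ⟦ Sign.+ ℤ.◃ (suc m ℕ.* suc n) ⟧         ≈⟨ ⟦+◃⟧ (suc m ℕ.* suc n) ⟩
    (suc m ℕ.* suc n) · 1#                   ≈⟨ ·′-homo-* (suc m) (suc n) ⟩
    (suc m ·′ 1#) * (suc n ·′ 1#)            ≈⟨ -‿involutive _ ⟨
    - - ((suc m ·′ 1#) * (suc n ·′ 1#))      ≈⟨ -‿cong (-‿distribʳ-* _ _) ⟩
    - ((suc m ·′ 1#) * - (suc n ·′ 1#))      ≈⟨ -‿distribˡ-* _ _ ⟩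
    - (suc m ·′ 1#) * - (suc n ·′ 1#)        ∎

  homomorphism : ℤ.+-*-rawRing -Raw-AlmostCommutative⟶ fromCommutativeRing R
  homomorphism = record
    { ⟦_⟧ = ⟦_⟧ ; +-homo = ⟦+⟧ ; *-homo = ⟦*⟧ ; -‿homo = ⟦-⟧ ; 0-homo = refl ; 1-homo = refl }

  ⟦⟧-weaklyDecidable : ∀ i j → Maybe (⟦ i ⟧ ≈ ⟦ j ⟧)
  ⟦⟧-weaklyDecidable i j = Maybe.map (λ i≡j → reflexive (≡.cong ⟦_⟧ i≡j)) (dec⇒maybe (i ℤₚ.≟ j))

  -- With coefficients in ℤ rather than in R the solver can cancel x - x.
  open RingSolver ℤ.+-*-rawRing (fromCommutativeRing R) homomorphism ⟦⟧-weaklyDecidable public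
    using (solve; _:=_; con; _:+_; _:*_; _:-_; :-_)

-- The ring of polynomials over a commutative ring.

module PolynomialRing {c ℓ} (R : CommutativeRing c ℓ) where

  open CommutativeRing R hiding (zero)
  open import Algebra.Properties.Ring ring using (-0#≈0#)
  open Polynomial rawRing public

  infix 4 _≋_
  infix 8 -ₚ_

  -- A record, so that Agda can infer the two polynomials from an equation.
  record _≋_ (f g : Poly) : Set ℓ where
    constructor mk
    field at : ∀ i → coeff f i ≈ coeff g i
  open _≋_ public

  -ₚ_ : Poly → Poly
  -ₚ_ = map (-_)

  scale : Carrier → Poly → Poly
  scale b = map (b *_)

  shift : Poly → Poly
  shift = 0# ∷_

  coeff-+ : ∀ f g i → coeff (f +ₚ g) i ≈ coeff f i + coeff g i
  coeff-+ []      g       i       = sym (+-identityˡ _)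
  coeff-+ (b ∷ f) []      i       = sym (+-identityʳ _)
  coeff-+ (b ∷ f) (d ∷ g) zero    = refl
  coeff-+ (b ∷ f) (d ∷ g) (suc i) = coeff-+ f g i

  coeff-neg : ∀ f i → coeff (-ₚ f) i ≈ - coeff f i
  coeff-neg []      i       = sym -0#≈0#
  coeff-neg (b ∷ f) zero    = refl
  coeff-neg (b ∷ f) (suc i) = coeff-neg f i

  coeff-scale : ∀ b f i → coeff (scale b f) i ≈ b * coeff f i
  coeff-scale b []      i       = sym (zeroʳ b)
  coeff-scale b (d ∷ f) zero    = refl
  coeff-scale b (d ∷ f) (suc i) = coeff-scale b f i

  ≋-isEquivalence : IsEquivalence _≋_
  ≋-isEquivalence = record
    { refl  = mk λ i → refl
    ; sym   = λ p → mk λ i → sym (at p i)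
    ; trans = λ p q → mk λ i → trans (at p i) (at q i)
    }

  ≋-setoid : Setoid c ℓ
  ≋-setoid = record { isEquivalence = ≋-isEquivalence }

  open IsEquivalence ≋-isEquivalence public using () renaming (refl to ≋-refl; sym to ≋-sym; trans to ≋-trans)

  ∷-cong : ∀ {b d f g} → b ≈ d → f ≋ g → b ∷ f ≋ d ∷ g
  ∷-cong b≈d f≋g = mk λ { zero → b≈d ; (suc i) → at f≋g i }

  shift-[] : ∀ {b f} → b ≈ 0# → f ≋ [] → b ∷ f ≋ []
  shift-[] b≈0 f≋0 = mk λ { zero → b≈0 ; (suc i) → at f≋0 i }

  head-≋ : ∀ {b d f g} → b ∷ f ≋ d ∷ g → b ≈ d
  head-≋ p = at p 0

  tail-≋ : ∀ {b d f g} → b ∷ f ≋ d ∷ g → f ≋ g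
  tail-≋ p = mk λ i → at p (suc i)

  tail-[] : ∀ {b f} → b ∷ f ≋ [] → f ≋ []
  tail-[] p = mk λ i → at p (suc i)

  +ₚ-cong : ∀ {f f′ g g′} → f ≋ f′ → g ≋ g′ → f +ₚ g ≋ f′ +ₚ g′
  +ₚ-cong {f} {f′} {g} {g′} p q = mk λ i →
    trans (coeff-+ f g i) (trans (+-cong (at p i) (at q i)) (sym (coeff-+ f′ g′ i)))

  -ₚ-cong : ∀ {f g} → f ≋ g → -ₚ f ≋ -ₚ g
  -ₚ-cong {f} {g} p = mk λ i → trans (coeff-neg f i) (trans (-‿cong (at p i)) (sym (coeff-neg g i)))

  scale-cong : ∀ {b d f g} → b ≈ d → f ≋ g → scale b f ≋ scale d g
  scale-cong {b} {d} {f} {g} b≈d p = mk λ i →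
    trans (coeff-scale b f i) (trans (*-cong b≈d (at p i)) (sym (coeff-scale d g i)))

  +ₚ-comm : ∀ f g → f +ₚ g ≋ g +ₚ f
  +ₚ-comm []      []      = ≋-refl
  +ₚ-comm []      (d ∷ g) = ≋-refl
  +ₚ-comm (b ∷ f) []      = ≋-refl
  +ₚ-comm (b ∷ f) (d ∷ g) = ∷-cong (+-comm b d) (+ₚ-comm f g)

  +ₚ-assoc : ∀ f g h → (f +ₚ g) +ₚ h ≋ f +ₚ (g +ₚ h)
  +ₚ-assoc []      g       h       = ≋-refl
  +ₚ-assoc (b ∷ f) []      h       = ≋-refl
  +ₚ-assoc (b ∷ f) (d ∷ g) []      = ≋-refl
  +ₚ-assoc (b ∷ f) (d ∷ g) (e ∷ h) = ∷-cong (+-assoc b d e) (+ₚ-assoc f g h)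

  +ₚ-identityʳ : ∀ f → f +ₚ [] ≋ f
  +ₚ-identityʳ []      = ≋-refl
  +ₚ-identityʳ (b ∷ f) = ≋-refl

  -ₚ-inverseʳ : ∀ f → f +ₚ -ₚ f ≋ []
  -ₚ-inverseʳ []      = ≋-refl
  -ₚ-inverseʳ (b ∷ f) = shift-[] (-‿inverseʳ b) (-ₚ-inverseʳ f)

  +ₚ-isAbelianGroup : IsAbelianGroup _≋_ _+ₚ_ [] -ₚ_
  +ₚ-isAbelianGroup = record
    { isGroup = record
      { isMonoid = record
        { isSemigroup = record
          { isMagma = record { isEquivalence = ≋-isEquivalence ; ∙-cong = +ₚ-cong }
          ; assoc = +ₚ-assoc
          }
        ; identity = (λ f → ≋-refl) , +ₚ-identityʳ
        }
      ; inverse = (λ f → ≋-trans (+ₚ-comm (-ₚ f) f) (-ₚ-inverseʳ f)) , -ₚ-inverseʳ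
      ; ⁻¹-cong = -ₚ-cong
      }
    ; comm = +ₚ-comm
    }

  +ₚ-commutativeMonoid : CommutativeMonoid c ℓ
  +ₚ-commutativeMonoid = record
    { isCommutativeMonoid = record { isMonoid = IsAbelianGroup.isMonoid +ₚ-isAbelianGroup ; comm = +ₚ-comm } }

  open CommutativeSemigroupProperties (CommutativeMonoid.commutativeSemigroup +ₚ-commutativeMonoid)
    using (interchange; x∙yz≈y∙xz)
  open SetoidReasoning ≋-setoid

  scale-+ : ∀ b f g → scale b (f +ₚ g) ≋ scale b f +ₚ scale b g
  scale-+ b []      g       = ≋-refl
  scale-+ b (d ∷ f) []      = ≋-refl
  scale-+ b (d ∷ f) (e ∷ g) = ∷-cong (distribˡ b d e) (scale-+ b f g)

  scale-distribʳ : ∀ b d f → scale (b + d) f ≋ scale b f +ₚ scale d f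
  scale-distribʳ b d []      = ≋-refl
  scale-distribʳ b d (e ∷ f) = ∷-cong (distribʳ e b d) (scale-distribʳ b d f)

  scale-scale : ∀ b d f → scale b (scale d f) ≋ scale (b * d) f
  scale-scale b d []      = ≋-refl
  scale-scale b d (e ∷ f) = ∷-cong (sym (*-assoc b d e)) (scale-scale b d f)

  scale-1# : ∀ f → scale 1# f ≋ f
  scale-1# []      = ≋-refl
  scale-1# (b ∷ f) = ∷-cong (*-identityˡ b) (scale-1# f)

  scale-0# : ∀ f → scale 0# f ≋ []
  scale-0# []      = ≋-refl
  scale-0# (b ∷ f) = shift-[] (zeroˡ b) (scale-0# f)

  shift-+ : ∀ f g → shift (f +ₚ g) ≋ shift f +ₚ shift g
  shift-+ f g = ∷-cong (sym (+-identityˡ 0#)) ≋-refl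

  *ₚ-zeroʳ : ∀ f → f *ₚ [] ≋ []
  *ₚ-zeroʳ []      = ≋-refl
  *ₚ-zeroʳ (b ∷ f) = shift-[] refl (*ₚ-zeroʳ f)

  *ₚ-congʳ : ∀ f {g h} → g ≋ h → f *ₚ g ≋ f *ₚ h
  *ₚ-congʳ []      p = ≋-refl
  *ₚ-congʳ (b ∷ f) p = +ₚ-cong (scale-cong refl p) (∷-cong refl (*ₚ-congʳ f p))

  -- A list of zeros of any length represents 0, so congruence in the left factor has to compare
  -- lists of different lengths.
  []-*ₚ : ∀ {f} h → f ≋ [] → f *ₚ h ≋ []
  []-*ₚ {[]}    h p = ≋-refl
  []-*ₚ {b ∷ f} h p = begin
    scale b h +ₚ shift (f *ₚ h)  ≈⟨ +ₚ-cong (scale-cong (at p 0) ≋-refl) (∷-cong refl ([]-*ₚ h (tail-[] p))) ⟩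
    scale 0# h +ₚ shift []       ≈⟨ +ₚ-cong (scale-0# h) (shift-[] refl ≋-refl) ⟩
    []                           ∎

  *ₚ-congˡ : ∀ {f g} h → f ≋ g → f *ₚ h ≋ g *ₚ h
  *ₚ-congˡ {[]}    {g}     h p = ≋-sym ([]-*ₚ h (≋-sym p))
  *ₚ-congˡ {b ∷ f} {[]}    h p = []-*ₚ h p
  *ₚ-congˡ {b ∷ f} {d ∷ g} h p = +ₚ-cong (scale-cong (head-≋ p) (≋-refl {h})) (∷-cong refl (*ₚ-congˡ h (tail-≋ p)))

  *ₚ-cong : ∀ {f f′ g g′} → f ≋ f′ → g ≋ g′ → f *ₚ g ≋ f′ *ₚ g′
  *ₚ-cong {f} {f′} {g} {g′} p q = ≋-trans (*ₚ-congʳ f q) (*ₚ-congˡ g′ p)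

  *ₚ-distribʳ : ∀ h f g → (f +ₚ g) *ₚ h ≋ f *ₚ h +ₚ g *ₚ h
  *ₚ-distribʳ h []      g       = ≋-refl
  *ₚ-distribʳ h (b ∷ f) []      = ≋-sym (+ₚ-identityʳ _)
  *ₚ-distribʳ h (b ∷ f) (d ∷ g) = begin
    scale (b + d) h +ₚ shift ((f +ₚ g) *ₚ h)
      ≈⟨ +ₚ-cong (scale-distribʳ b d h) (≋-trans (∷-cong refl (*ₚ-distribʳ h f g)) (shift-+ (f *ₚ h) (g *ₚ h))) ⟩
    (scale b h +ₚ scale d h) +ₚ (shift (f *ₚ h) +ₚ shift (g *ₚ h))
      ≈⟨ interchange (scale b h) (scale d h) (shift (f *ₚ h)) (shift (g *ₚ h)) ⟩
    (scale b h +ₚ shift (f *ₚ h)) +ₚ (scale d h +ₚ shift (g *ₚ h)) ∎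

  scale-*ₚ : ∀ b f g → scale b f *ₚ g ≋ scale b (f *ₚ g)
  scale-*ₚ b []      g = ≋-refl
  scale-*ₚ b (d ∷ f) g = begin
    scale (b * d) g +ₚ shift (scale b f *ₚ g)            ≈⟨ +ₚ-cong (≋-sym (scale-scale b d g)) (∷-cong (sym (zeroʳ b)) (scale-*ₚ b f g)) ⟩
    scale b (scale d g) +ₚ scale b (shift (f *ₚ g))      ≈⟨ scale-+ b (scale d g) (shift (f *ₚ g)) ⟨
    scale b (scale d g +ₚ shift (f *ₚ g))                ∎

  shift-*ₚ : ∀ f g → shift f *ₚ g ≋ shift (f *ₚ g)
  shift-*ₚ f g = +ₚ-cong (scale-0# g) ≋-refl

  -- `_*ₚ_` recurses on its left factor; with the mirrored recursion on the right one, commutativity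
  -- becomes an induction.
  *ₚ-∷ : ∀ f d g → f *ₚ (d ∷ g) ≋ scale d f +ₚ shift (f *ₚ g)
  *ₚ-∷ []      d g = mk λ { zero → refl ; (suc i) → refl }
  *ₚ-∷ (b ∷ f) d g = ∷-cong (+-congʳ (*-comm b d)) (begin
    scale b g +ₚ f *ₚ (d ∷ g)                 ≈⟨ +ₚ-cong ≋-refl (*ₚ-∷ f d g) ⟩
    scale b g +ₚ (scale d f +ₚ shift (f *ₚ g))  ≈⟨ x∙yz≈y∙xz (scale b g) (scale d f) (shift (f *ₚ g)) ⟩
    scale d f +ₚ (scale b g +ₚ shift (f *ₚ g))  ∎)

  *ₚ-comm : ∀ f g → f *ₚ g ≋ g *ₚ f
  *ₚ-comm []      g = ≋-sym (*ₚ-zeroʳ g)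
  *ₚ-comm (b ∷ f) g = begin
    scale b g +ₚ shift (f *ₚ g)  ≈⟨ +ₚ-cong ≋-refl (∷-cong refl (*ₚ-comm f g)) ⟩
    scale b g +ₚ shift (g *ₚ f)  ≈⟨ *ₚ-∷ g b f ⟨
    g *ₚ (b ∷ f)                 ∎

  *ₚ-assoc : ∀ f g h → (f *ₚ g) *ₚ h ≋ f *ₚ (g *ₚ h)
  *ₚ-assoc []      g h = ≋-refl
  *ₚ-assoc (b ∷ f) g h = begin
    (scale b g +ₚ shift (f *ₚ g)) *ₚ h               ≈⟨ *ₚ-distribʳ h (scale b g) _ ⟩
    scale b g *ₚ h +ₚ shift (f *ₚ g) *ₚ h            ≈⟨ +ₚ-cong (scale-*ₚ b g h) (shift-*ₚ (f *ₚ g) h) ⟩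
    scale b (g *ₚ h) +ₚ shift ((f *ₚ g) *ₚ h)        ≈⟨ +ₚ-cong ≋-refl (∷-cong refl (*ₚ-assoc f g h)) ⟩
    scale b (g *ₚ h) +ₚ shift (f *ₚ (g *ₚ h))        ∎

  const : Carrier → Poly
  const b = b ∷ []

  const-*ₚ : ∀ b f → const b *ₚ f ≋ scale b f
  const-*ₚ b f = ≋-trans (+ₚ-cong ≋-refl (shift-[] refl ≋-refl)) (+ₚ-identityʳ _)

  *ₚ-identityˡ : ∀ f → const 1# *ₚ f ≋ f
  *ₚ-identityˡ f = ≋-trans (const-*ₚ 1# f) (scale-1# f)

  polynomialRing : CommutativeRing c ℓ
  polynomialRing = record
    { Carrier = Poly ; _≈_ = _≋_ ; _+_ = _+ₚ_ ; _*_ = _*ₚ_ ; -_ = -ₚ_ ; 0# = [] ; 1# = const 1#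
    ; isCommutativeRing = record
      { isRing = record
        { +-isAbelianGroup = +ₚ-isAbelianGroup
        ; *-cong = *ₚ-cong
        ; *-assoc = *ₚ-assoc
        ; *-identity = *ₚ-identityˡ , λ f → ≋-trans (*ₚ-comm f _) (*ₚ-identityˡ f)
        ; distrib = (λ f g h → ≋-trans (*ₚ-comm f _) (≋-trans (*ₚ-distribʳ f g h) (+ₚ-cong (*ₚ-comm g f) (*ₚ-comm h f)))) , *ₚ-distribʳ
        }
      ; *-comm = *ₚ-comm
      }
    }

  X : Poly
  X = 0# ∷ 1# ∷ []

  X-*ₚ : ∀ f → X *ₚ f ≋ shift f
  X-*ₚ f = ≋-trans (shift-*ₚ (const 1#) f) (∷-cong refl (*ₚ-identityˡ f))

-- Evaluation of polynomials.

module Evaluation {c ℓ} (R : CommutativeRing c ℓ) where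

  open CommutativeRing R hiding (zero)
  open PolynomialRing R
  open IntegerCoefficients R using (solve; _:=_; con; _:+_; _:*_; _:-_; :-_)
  open import Algebra.Properties.Semiring.Exp semiring using (_^_)
  open import Algebra.Properties.CommutativeMonoid.Sum *-commutativeMonoid using () renaming (sum to ∏)
  open import Relation.Binary.Reasoning.Setoid setoid

  eval-[] : ∀ f x → f ≋ [] → eval f x ≈ 0#
  eval-[] []      x p = refl
  eval-[] (b ∷ f) x p = begin
    b + x * eval f x  ≈⟨ +-cong (at p 0) (*-congˡ (eval-[] f x (tail-[] p))) ⟩
    0# + x * 0#       ≈⟨ solve 1 (λ x → con (+ 0) :+ x :* con (+ 0) := con (+ 0)) refl x ⟩
    0#                ∎

  eval-cong : ∀ f g x → f ≋ g → eval f x ≈ eval g x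
  eval-cong []      g       x p = sym (eval-[] g x (≋-sym p))
  eval-cong (b ∷ f) []      x p = eval-[] (b ∷ f) x p
  eval-cong (b ∷ f) (d ∷ g) x p = +-cong (head-≋ p) (*-congˡ (eval-cong f g x (tail-≋ p)))

  eval-congʳ : ∀ f {x y} → x ≈ y → eval f x ≈ eval f y
  eval-congʳ []      p = refl
  eval-congʳ (b ∷ f) p = +-congˡ (*-cong p (eval-congʳ f p))

  eval-+ : ∀ f g x → eval (f +ₚ g) x ≈ eval f x + eval g x
  eval-+ []      g       x = sym (+-identityˡ _)
  eval-+ (b ∷ f) []      x = sym (+-identityʳ _)
  eval-+ (b ∷ f) (d ∷ g) x = begin
    b + d + x * eval (f +ₚ g) x             ≈⟨ +-congˡ (*-congˡ (eval-+ f g x)) ⟩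
    b + d + x * (eval f x + eval g x)
      ≈⟨ solve 5 (λ b d x u v → b :+ d :+ x :* (u :+ v) := (b :+ x :* u) :+ (d :+ x :* v)) refl b d x _ _ ⟩
    (b + x * eval f x) + (d + x * eval g x) ∎

  eval-scale : ∀ b f x → eval (scale b f) x ≈ b * eval f x
  eval-scale b []      x = sym (zeroʳ b)
  eval-scale b (d ∷ f) x = begin
    b * d + x * eval (scale b f) x  ≈⟨ +-congˡ (*-congˡ (eval-scale b f x)) ⟩
    b * d + x * (b * eval f x)      ≈⟨ solve 4 (λ b d x u → b :* d :+ x :* (b :* u) := b :* (d :+ x :* u)) refl b d x _ ⟩
    b * (d + x * eval f x)          ∎

  eval-* : ∀ f g x → eval (f *ₚ g) x ≈ eval f x * eval g x
  eval-* []      g x = sym (zeroˡ _)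
  eval-* (b ∷ f) g x = begin
    eval (scale b g +ₚ shift (f *ₚ g)) x           ≈⟨ eval-+ (scale b g) (shift (f *ₚ g)) x ⟩
    eval (scale b g) x + (0# + x * eval (f *ₚ g) x) ≈⟨ +-cong (eval-scale b g x) (+-congˡ (*-congˡ (eval-* f g x))) ⟩
    b * eval g x + (0# + x * (eval f x * eval g x))
      ≈⟨ solve 4 (λ b x u v → b :* v :+ (con (+ 0) :+ x :* (u :* v)) := (b :+ x :* u) :* v) refl b x _ _ ⟩
    (b + x * eval f x) * eval g x                  ∎

  X-_ : Carrier → Poly
  X- u = - u ∷ 1# ∷ []

  eval-X- : ∀ u x → eval (X- u) x ≈ x - u
  eval-X- u x = solve 2 (λ u x → :- u :+ x :* (con (+ 1) :+ x :* con (+ 0)) := x :- u) refl u x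

  eval-product : ∀ k (g : Fin k → Poly) x → eval (product g) x ≈ ∏ (λ i → eval (g i) x)
  eval-product zero    g x = solve 1 (λ x → con (+ 1) :+ x :* con (+ 0) := con (+ 1)) refl x
  eval-product (suc k) g x = trans (eval-* (g zero) _ x) (*-congˡ (eval-product k _ x))

  monomial : ℕ → Poly
  monomial zero    = const 1#
  monomial (suc n) = shift (monomial n)

  eval-monomial : ∀ n x → eval (monomial n) x ≈ x ^ n
  eval-monomial zero    x = solve 1 (λ x → con (+ 1) :+ x :* con (+ 0) := con (+ 1)) refl x
  eval-monomial (suc n) x = trans (+-identityˡ _) (*-congˡ (eval-monomial n x))

-- Degrees, division by monic polynomials, and roots.

module Degree {c ℓ} (R : CommutativeRing c ℓ) where

  open CommutativeRing R hiding (zero)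
  open PolynomialRing R
  open Evaluation R
  open IntegerCoefficients R using (solve; _:=_; con; _:+_; _:*_; _:-_; :-_)
  open import Algebra.Properties.Ring ring using (-0#≈0#) renaming (x∙y⁻¹≈ε⇒x≈y to x-y≈0⇒x≈y)
  import Algebra.Properties.Ring (CommutativeRing.ring polynomialRing) as PolynomialRingProperties
  open IntegerCoefficients polynomialRing using () renaming (solve to solveₚ; _:=_ to _:=ₚ_; _:*_ to _:*ₚ_; _:-_ to _:-ₚ_; _:+_ to _:+ₚ_)
  open import Algebra.Properties.Semiring.Exp semiring using (_^_)
  open import Relation.Binary.Reasoning.Setoid setoid

  Below : ℕ → Poly → Set ℓ
  Below D f = ∀ i → D ℕ.≤ i → coeff f i ≈ 0#

  -- Degree at most D with the coefficient of xᴰ equal to b; b may be zero.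
  Leading : ℕ → Carrier → Poly → Set ℓ
  Leading D b f = coeff f D ≈ b × Below (suc D) f

  Below-cong : ∀ {D f g} → f ≋ g → Below D f → Below D g
  Below-cong p B i D≤i = trans (sym (at p i)) (B i D≤i)

  Below-mono : ∀ {D E f} → D ℕ.≤ E → Below D f → Below E f
  Below-mono D≤E B i E≤i = B i (ℕₚ.≤-trans D≤E E≤i)

  Below-0 : ∀ {f} → Below 0 f → f ≋ []
  Below-0 B = mk λ i → B i z≤n

  Below-+ : ∀ {D} f g → Below D f → Below D g → Below D (f +ₚ g)
  Below-+ f g B C i D≤i = trans (coeff-+ f g i) (trans (+-cong (B i D≤i) (C i D≤i)) (+-identityˡ 0#))

  Below-neg : ∀ {D} f → Below D f → Below D (-ₚ f)
  Below-neg f B i D≤i = trans (coeff-neg f i) (trans (-‿cong (B i D≤i)) -0#≈0#)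

  Leading-cong : ∀ {D b f g} → f ≋ g → Leading D b f → Leading D b g
  Leading-cong {D} p (l , B) = trans (sym (at p D)) l , Below-cong p B

  Leading-congˡ : ∀ {D b d} f → b ≈ d → Leading D b f → Leading D d f
  Leading-congˡ f p (l , B) = trans l p , B

  Leading-scale : ∀ {D b} d f → Leading D b f → Leading D (d * b) (scale d f)
  Leading-scale {D} d f (l , B) = trans (coeff-scale d f D) (*-congˡ l) ,
    λ i D<i → trans (coeff-scale d f i) (trans (*-congˡ (B i D<i)) (zeroʳ d))

  Leading-1# : MonicOfDegree 0 (const 1#)
  Leading-1# = refl , λ { (suc i) _ → refl }

  Leading-0⇒const : ∀ {b} f → Leading 0 b f → f ≋ const b
  Leading-0⇒const f (l , B) = mk λ { zero → l ; (suc i) → B (suc i) (s≤s z≤n) }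

  Leading-X- : ∀ u → MonicOfDegree 1 (X- u)
  Leading-X- u = refl , λ { (suc zero) (s≤s ()) ; (suc (suc i)) _ → refl }

  Leading-monomial : ∀ n → MonicOfDegree n (monomial n)
  Leading-monomial zero    = Leading-1#
  Leading-monomial (suc n) = proj₁ (Leading-monomial n) , λ { (suc i) (s≤s n<i) → proj₂ (Leading-monomial n) i n<i }

  -- Its roots in a field are the elements fixed by x ↦ xᴰ.
  fixedPolynomial : ℕ → Poly
  fixedPolynomial D = monomial D +ₚ -ₚ X

  eval-fixedPolynomial : ∀ D x → eval (fixedPolynomial D) x ≈ x ^ D - x
  eval-fixedPolynomial D x = trans (eval-+ (monomial D) (-ₚ X) x) (+-cong (eval-monomial D x)
    (solve 1 (λ x → :- con (+ 0) :+ x :* (:- con (+ 1) :+ x :* con (+ 0)) := :- x) refl x))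

  Leading-fixedPolynomial : ∀ D → 1 ℕ.< D → MonicOfDegree D (fixedPolynomial D)
  Leading-fixedPolynomial D 1<D =
    trans (coeff-fixed D 1<D) (proj₁ (Leading-monomial D)) ,
    λ i D<i → trans (coeff-fixed i (ℕₚ.<-trans 1<D D<i)) (proj₂ (Leading-monomial D) i D<i)
    where
    coeff-fixed : ∀ i → 1 ℕ.< i → coeff (fixedPolynomial D) i ≈ coeff (monomial D) i
    coeff-fixed (suc (suc i)) _ = trans (coeff-+ (monomial D) (-ₚ X) (suc (suc i))) (+-identityʳ _)
    coeff-fixed (suc zero) (s≤s ())

  coeff-∷-* : ∀ b f h i → coeff ((b ∷ f) *ₚ h) (suc i) ≈ b * coeff h (suc i) + coeff (f *ₚ h) i
  coeff-∷-* b f h i = trans (coeff-+ (scale b h) (shift (f *ₚ h)) (suc i)) (+-congʳ (coeff-scale b h (suc i)))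

  -- Beyond position D the head b contributes nothing, as h has no coefficients there. The degree
  -- counts below peel the left factor in this way.
  coeff-∷-*-above : ∀ {D} b f h → Below (suc D) h → ∀ i → D ℕ.≤ i → coeff ((b ∷ f) *ₚ h) (suc i) ≈ coeff (f *ₚ h) i
  coeff-∷-*-above b f h B i D≤i = begin
    coeff ((b ∷ f) *ₚ h) (suc i)                  ≈⟨ coeff-∷-* b f h i ⟩
    b * coeff h (suc i) + coeff (f *ₚ h) i        ≈⟨ +-congʳ (trans (*-congˡ (B (suc i) (s≤s D≤i))) (zeroʳ b)) ⟩
    0# + coeff (f *ₚ h) i                         ≈⟨ +-identityˡ _ ⟩
    coeff (f *ₚ h) i                              ∎

  coeff-*-0 : ∀ f g → coeff (f *ₚ g) 0 ≈ coeff f 0 * coeff g 0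
  coeff-*-0 []      g = sym (zeroˡ _)
  coeff-*-0 (b ∷ f) g = begin
    coeff (scale b g +ₚ shift (f *ₚ g)) 0  ≈⟨ coeff-+ (scale b g) (shift (f *ₚ g)) 0 ⟩
    coeff (scale b g) 0 + 0#               ≈⟨ +-identityʳ _ ⟩
    coeff (scale b g) 0                    ≈⟨ coeff-scale b g 0 ⟩
    b * coeff g 0                          ∎

  const-*-coeff : ∀ b f h i → f ≋ [] → coeff ((b ∷ f) *ₚ h) i ≈ b * coeff h i
  const-*-coeff b f h i p = trans (at (≋-trans (*ₚ-congˡ h (∷-cong refl p)) (const-*ₚ b h)) i) (coeff-scale b h i)

  Leading-* : ∀ {D E b d} f g → Leading D b f → Leading E d g → Leading (D ℕ.+ E) (b * d) (f *ₚ g)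
  -- The empty list is no exception: it forces b to be 0, and a leading coefficient may vanish.
  Leading-* {D} {E} {b} {d} [] g (l , B) L = trans (sym (zeroˡ d)) (*-congʳ l) , λ i _ → refl
  Leading-* {zero} {E} (b ∷ f) g (l , B) (m , C) =
    trans (p E) (*-cong l m) , λ i E<i → trans (p i) (trans (*-congˡ (C i E<i)) (zeroʳ b))
    where
    p : ∀ i → coeff ((b ∷ f) *ₚ g) i ≈ b * coeff g i
    p i = const-*-coeff b f g i (mk λ j → B (suc j) (s≤s z≤n))
  Leading-* {suc D} {E} (b ∷ f) g (l , B) (m , C) = let (n , A) = ih in
    trans (coeff-∷-*-above b f g C (D ℕ.+ E) (ℕₚ.m≤n+m E D)) n ,
    λ { (suc i) (s≤s D+E<i) → trans (coeff-∷-*-above b f g C i (ℕₚ.≤-trans (ℕₚ.m≤n+m E (suc D)) D+E<i)) (A i D+E<i) }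
    where
    ih = Leading-* {D} {E} f g (l , λ i D<i → B (suc i) (s≤s D<i)) (m , C)

  Monic-* : ∀ {D E} f g → MonicOfDegree D f → MonicOfDegree E g → MonicOfDegree (D ℕ.+ E) (f *ₚ g)
  Monic-* f g p q = Leading-congˡ (f *ₚ g) (*-identityˡ 1#) (Leading-* f g p q)

  Monic-product : ∀ k (g : Fin k → Poly) → (∀ i → Monic (g i)) → Monic (product g)
  Monic-product zero    g m = 0 , Leading-1#
  Monic-product (suc k) g m = let (D , p) = m zero ; (E , q) = Monic-product k (λ i → g (suc i)) (λ i → m (suc i)) in
    D ℕ.+ E , Monic-* (g zero) _ p q

  -- The top coefficient of u is multiplied by the leading 1 of h, so over any commutative ring a
  -- nonzero multiple cannot drop below degree N. The recursion clears the tail of u before its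
  -- head.
  monic-multiple-Below : ∀ {N} u h → MonicOfDegree N h → Below N (u *ₚ h) → u ≋ []
  monic-multiple-Below {N} []      h m B = ≋-refl
  monic-multiple-Below {N} (b ∷ u) h m@(l , C) B = shift-[] b≈0 u≋[]
    where
    u≋[] : u ≋ []
    u≋[] = monic-multiple-Below u h m λ i N≤i →
      trans (sym (coeff-∷-*-above b u h C i N≤i)) (B (suc i) (ℕₚ.m≤n⇒m≤1+n N≤i))
    b≈0 : b ≈ 0#
    b≈0 = begin
      b                          ≈⟨ *-identityʳ b ⟨
      b * 1#                     ≈⟨ *-congˡ l ⟨
      b * coeff h N              ≈⟨ const-*-coeff b u h N u≋[] ⟨
      coeff ((b ∷ u) *ₚ h) N     ≈⟨ B N ℕₚ.≤-refl ⟩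
      0#                         ∎

  monic-cancel : ∀ {N} h u v → MonicOfDegree N h → h *ₚ u ≋ h *ₚ v → u ≋ v
  monic-cancel {N} h u v m p = PolynomialRingProperties.x∙y⁻¹≈ε⇒x≈y u v (monic-multiple-Below (u +ₚ -ₚ v) h m (Below-cong {N} {[]} (≋-sym q) (λ i _ → refl)))
    where
    q : (u +ₚ -ₚ v) *ₚ h ≋ []
    q = ≋-trans (solveₚ 3 (λ u v h → (u :-ₚ v) :*ₚ h :=ₚ h :*ₚ u :-ₚ h :*ₚ v) ≋-refl u v h)
       (≋-trans (+ₚ-cong p ≋-refl) (-ₚ-inverseʳ (h *ₚ v)))

  -- Horner's scheme: if p = q k + r, then b + x p = (x q) k + (b + x r), and b + x r has degree at
  -- most D, so subtracting one constant multiple of k finishes.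
  divide : ∀ {D} k → MonicOfDegree D k → ∀ p → ∃₂ λ q r → p ≋ q *ₚ k +ₚ r × Below D r
  divide {D} k m []      = [] , [] , ≋-refl , λ i _ → refl
  divide {D} k m@(l , C) (b ∷ p) with divide k m p
  ... | q , r , p≋ , B = d ∷ q , (b ∷ r) +ₚ -ₚ scale d k , eq , bound
    where
    d = coeff (b ∷ r) D
    eq : b ∷ p ≋ (scale d k +ₚ shift (q *ₚ k)) +ₚ ((b ∷ r) +ₚ -ₚ scale d k)
    eq = ≋-trans (∷-cong (sym (+-identityˡ b)) p≋)
      (solveₚ 3 (λ u v w → u :+ₚ w :=ₚ (v :+ₚ u) :+ₚ (w :-ₚ v)) ≋-refl (shift (q *ₚ k)) (scale d k) (b ∷ r))
    coeff-r : ∀ i → coeff ((b ∷ r) +ₚ -ₚ scale d k) i ≈ coeff (b ∷ r) i - d * coeff k i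
    coeff-r i = trans (coeff-+ (b ∷ r) (-ₚ scale d k) i) (+-congˡ (trans (coeff-neg (scale d k) i) (-‿cong (coeff-scale d k i))))
    above : ∀ i → D ℕ.< i → coeff (b ∷ r) i ≈ 0#
    above (suc i) (s≤s D≤i) = B i D≤i
    bound : Below D ((b ∷ r) +ₚ -ₚ scale d k)
    bound i D≤i with ℕₚ.m≤n⇒m<n∨m≡n D≤i
    ... | inj₁ D<i = trans (coeff-r i) (trans (+-cong (above i D<i) (-‿cong (*-congˡ (C i D<i)))) (solve 1 (λ d → con (+ 0) :- d :* con (+ 0) := con (+ 0)) refl d))
    ... | inj₂ ≡.refl = trans (coeff-r D) (trans (+-congˡ (-‿cong (trans (*-congˡ l) (*-identityʳ d)))) (-‿inverseʳ d))

  remainder≋[] : ∀ p ρ q r → eval p ρ ≈ 0# → p ≋ q *ₚ (X- ρ) +ₚ r → Below 1 r → r ≋ []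
  remainder≋[] p ρ q r pρ≈0 p≋ B = ≋-trans r≋ (shift-[] r₀≈0 ≋-refl)
    where
    r≋ : r ≋ const (coeff r 0)
    r≋ = Leading-0⇒const r (refl , B)
    r₀≈0 : coeff r 0 ≈ 0#
    r₀≈0 = begin
      coeff r 0                                  ≈⟨ solve 3 (λ ρ r q → r := q :* (ρ :- ρ) :+ (r :+ ρ :* con (+ 0))) refl ρ (coeff r 0) (eval q ρ) ⟩
      eval q ρ * (ρ - ρ) + (coeff r 0 + ρ * 0#)  ≈⟨ +-cong (*-congˡ (eval-X- ρ ρ)) (eval-cong r (const (coeff r 0)) ρ r≋) ⟨
      eval q ρ * eval (X- ρ) ρ + eval r ρ        ≈⟨ +-congʳ (eval-* q (X- ρ) ρ) ⟨
      eval (q *ₚ (X- ρ)) ρ + eval r ρ            ≈⟨ eval-+ (q *ₚ (X- ρ)) r ρ ⟨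
      eval (q *ₚ (X- ρ) +ₚ r) ρ                  ≈⟨ eval-cong p _ ρ p≋ ⟨
      eval p ρ                                   ≈⟨ pρ≈0 ⟩
      0#                                         ∎

  abstract
    factor : ∀ p ρ → eval p ρ ≈ 0# → ∃ λ q → p ≋ q *ₚ (X- ρ)
    factor p ρ pρ≈0 = let (q , r , p≋ , B) = divide (X- ρ) (Leading-X- ρ) p in
      q , ≋-trans p≋ (≋-trans (+ₚ-cong (≋-refl {q *ₚ (X- ρ)}) (remainder≋[] p ρ q r pρ≈0 p≋ B)) (+ₚ-identityʳ (q *ₚ (X- ρ))))

  module Nontrivial (1≉0 : ¬ (1# ≈ 0#)) where

    -- The list u may carry trailing zeros, so its degree is found from those of h and u h: for M <
    -- N the product would vanish, for M = N the tail of u is zero, and for M > N the head of u is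
    -- dropped.
    monic-quotient : ∀ {N M} u h → MonicOfDegree N h → MonicOfDegree M (u *ₚ h) → ∃ λ E → E ℕ.+ N ≡ M × MonicOfDegree E u
    monic-quotient {N} {M} []      h m (l , B) = ⊥-elim (1≉0 (sym l))
    monic-quotient {N} {M} (b ∷ u) h m@(k , C) (l , B) with ℕₚ.<-cmp M N
    ... | tri< M<N _ _ = ⊥-elim (1≉0 (trans (sym l) (at ([]-*ₚ {b ∷ u} h (monic-multiple-Below (b ∷ u) h m (Below-mono {f = (b ∷ u) *ₚ h} M<N B))) M)))
    ... | tri≈ _ ≡.refl _ = 0 , ≡.refl , b≈1 , λ { (suc i) _ → at u≋[] i }
      where
      u≋[] : u ≋ []
      u≋[] = monic-multiple-Below u h m λ i N≤i → trans (sym (coeff-∷-*-above b u h C i N≤i)) (B (suc i) (s≤s N≤i))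
      b≈1 : b ≈ 1#
      b≈1 = begin
        b                          ≈⟨ *-identityʳ b ⟨
        b * 1#                     ≈⟨ *-congˡ k ⟨
        b * coeff h N              ≈⟨ const-*-coeff b u h N u≋[] ⟨
        coeff ((b ∷ u) *ₚ h) N     ≈⟨ l ⟩
        1#                         ∎
    monic-quotient {N} {suc M} (b ∷ u) h m@(k , C) (l , B) | tri> _ _ (s≤s N≤M)
      with monic-quotient {N} {M} u h m
             ( trans (sym (coeff-∷-*-above b u h C M N≤M)) l
             , λ i M<i → trans (sym (coeff-∷-*-above b u h C i (ℕₚ.≤-trans N≤M (ℕₚ.<⇒≤ M<i)))) (B (suc i) (s≤s M<i)))
    ... | E , eq , (p , A) = suc E , ≡.cong suc eq , p , λ { (suc i) (s≤s E<i) → A i E<i }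

    degree-unique : ∀ {N M f} → MonicOfDegree N f → MonicOfDegree M f → N ≡ M
    degree-unique {N} {M} (l , B) (k , C) with ℕₚ.<-cmp N M
    ... | tri< N<M _ _ = ⊥-elim (1≉0 (trans (sym k) (B M N<M)))
    ... | tri≈ _ eq _  = eq
    ... | tri> _ _ M<N = ⊥-elim (1≉0 (trans (sym l) (C N M<N)))

    -- The cofactor is monic as well, and two degrees with sum 0 are both 0. This translates the
    -- units in the definition of irreducibility into degrees.
    Monic-unit : ∀ {N} h u → MonicOfDegree N h → u *ₚ h ≋ const 1# → N ≡ 0
    Monic-unit {N} h u m p with monic-quotient u h m (Leading-cong {0} (≋-sym p) Leading-1#)
    ... | zero  , eq , _ = eq

    module Domain (integral : ∀ x y → x * y ≈ 0# → x ≈ 0# ⊎ y ≈ 0#) where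

      module _ {D} p (m : MonicOfDegree D p) ρ (root : eval p ρ ≈ 0#) where

        linearQuotient : Poly
        linearQuotient = proj₁ (factor p ρ root)

        linearQuotient-* : p ≋ linearQuotient *ₚ (X- ρ)
        linearQuotient-* = proj₂ (factor p ρ root)

        linearQuotient-Monic : ∃ λ E → E ℕ.+ 1 ≡ D × MonicOfDegree E linearQuotient
        linearQuotient-Monic = monic-quotient linearQuotient (X- ρ) (Leading-X- ρ) (Leading-cong linearQuotient-* m)

        linearQuotient-root : ∀ σ → ¬ (σ ≈ ρ) → eval p σ ≈ 0# → eval linearQuotient σ ≈ 0#
        linearQuotient-root σ σ≉ρ pσ≈0 = fromInj₁ (λ eq → ⊥-elim (σ≉ρ (x-y≈0⇒x≈y σ ρ (trans (sym (eval-X- ρ σ)) eq))))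
          (integral (eval linearQuotient σ) (eval (X- ρ) σ) (begin
            eval linearQuotient σ * eval (X- ρ) σ  ≈⟨ eval-* linearQuotient (X- ρ) σ ⟨
            eval (linearQuotient *ₚ (X- ρ)) σ      ≈⟨ eval-cong p (linearQuotient *ₚ (X- ρ)) σ linearQuotient-* ⟨
            eval p σ                               ≈⟨ pσ≈0 ⟩
            0#                                     ∎))

      -- Integrality passes the roots other than the one divided out on to the linear quotient, so
      -- distinct roots can be removed one by one.
      roots-factor : ∀ k {D} p (ρ : Fin k → Carrier) → MonicOfDegree D p → (∀ i j → i ≢ j → ¬ (ρ i ≈ ρ j)) →
        (∀ i → eval p (ρ i) ≈ 0#) → ∃₂ λ E q → E ℕ.+ k ≡ D × MonicOfDegree E q × p ≋ q *ₚ product (λ i → X- (ρ i))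
      roots-factor zero {D} p ρ m inj root = D , p , ℕₚ.+-identityʳ D , m , ≋-sym (≋-trans (*ₚ-comm p (const 1#)) (*ₚ-identityˡ p))
      roots-factor (suc k) {D} p ρ m inj root =
        let (D′ , D′+1≡D , m′) = linearQuotient-Monic p m (ρ zero) (root zero)
            (E , q , E+k≡D′ , mq , p′≋) = roots-factor k p′ (λ i → ρ (suc i)) m′ (λ i j i≢j → inj (suc i) (suc j) (λ e → i≢j (Finₚ.suc-injective e)))
                               (λ i → linearQuotient-root p m (ρ zero) (root zero) (ρ (suc i)) (inj (suc i) zero (λ ())) (root (suc i)))
        in E , q , ≡.trans (ℕₚ.+-suc E k) (≡.trans (≡.cong suc E+k≡D′) (≡.trans (ℕₚ.+-comm 1 D′) D′+1≡D)) , mq ,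
           ≋-trans (linearQuotient-* p m (ρ zero) (root zero))
             (≋-trans (*ₚ-congˡ (X- ρ zero) p′≋) (≋-trans (*ₚ-assoc q Π (X- ρ zero)) (*ₚ-congʳ q (*ₚ-comm Π (X- ρ zero)))))
        where
        p′ = linearQuotient p m (ρ zero) (root zero)
        Π = product (λ i → X- (ρ (suc i)))

      roots-split : ∀ k p (ρ : Fin k → Carrier) → MonicOfDegree k p → (∀ i j → i ≢ j → ¬ (ρ i ≈ ρ j)) →
        (∀ i → eval p (ρ i) ≈ 0#) → p ≋ product (λ i → X- (ρ i))
      roots-split k p ρ m inj root with roots-factor k p ρ m inj root
      ... | zero  , q , eq , mq , p≋ = ≋-trans p≋ (≋-trans (*ₚ-congˡ (product (λ i → X- (ρ i))) (Leading-0⇒const q mq)) (*ₚ-identityˡ _))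
      ... | suc E , q , eq , mq , p≋ = ⊥-elim (ℕₚ.m≢1+n+m k (≡.sym eq))

      roots-≤-degree : ∀ k {D} p (ρ : Fin k → Carrier) → MonicOfDegree D p → (∀ i j → i ≢ j → ¬ (ρ i ≈ ρ j)) →
        (∀ i → eval p (ρ i) ≈ 0#) → k ℕ.≤ D
      roots-≤-degree k p ρ m inj root with roots-factor k p ρ m inj root
      ... | E , q , eq , _ = ≡.subst (k ℕ.≤_) eq (ℕₚ.m≤n+m k E)

-- The norm form of R[√a].

module SquareRootNorm {c ℓ} (R : CommutativeRing c ℓ) (a : CommutativeRing.Carrier R) where

  open CommutativeRing R hiding (zero)
  open PolynomialRing R
  open Evaluation R
  open Degree R using (fixedPolynomial)
  open IntegerCoefficients R using (solve; _:=_; con; _:+_; _:*_; _:-_; :-_)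
  open import Algebra.Properties.Semiring.Exp semiring using (_^_)
  open import Algebra.Properties.CommutativeMonoid.Sum *-commutativeMonoid using () renaming (sum to ∏)
  open import Relation.Binary.Reasoning.Setoid setoid

  -- f = even f + √a · odd f  in R[√a].
  even odd : Poly → Carrier
  even []      = 0#
  even (b ∷ f) = b + a * odd f
  odd []      = 0#
  odd (b ∷ f) = even f

  -- The norm from R[√a] to R, that is f(√a) f(-√a), written without √a so that it makes sense
  -- whether or not a has a square root in R.
  norm : Poly → Carrier
  norm f = even f * even f - a * (odd f * odd f)

  even-[] : ∀ f → f ≋ [] → even f ≈ 0#
  odd-[] : ∀ f → f ≋ [] → odd f ≈ 0#
  even-[] []      p = refl
  even-[] (b ∷ f) p = trans (+-cong (at p 0) (trans (*-congˡ (odd-[] f (tail-[] p))) (zeroʳ a))) (+-identityˡ 0#)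
  odd-[] []      p = refl
  odd-[] (b ∷ f) p = even-[] f (tail-[] p)

  even-cong : ∀ f g → f ≋ g → even f ≈ even g
  odd-cong : ∀ f g → f ≋ g → odd f ≈ odd g
  even-cong []      g       p = sym (even-[] g (≋-sym p))
  even-cong (b ∷ f) []      p = even-[] (b ∷ f) p
  even-cong (b ∷ f) (d ∷ g) p = +-cong (head-≋ p) (*-congˡ (odd-cong f g (tail-≋ p)))
  odd-cong []      g       p = sym (odd-[] g (≋-sym p))
  odd-cong (b ∷ f) []      p = odd-[] (b ∷ f) p
  odd-cong (b ∷ f) (d ∷ g) p = even-cong f g (tail-≋ p)

  even-+ : ∀ f g → even (f +ₚ g) ≈ even f + even g
  odd-+ : ∀ f g → odd (f +ₚ g) ≈ odd f + odd g
  even-+ []      g       = sym (+-identityˡ _)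
  even-+ (b ∷ f) []      = sym (+-identityʳ _)
  even-+ (b ∷ f) (d ∷ g) = trans (+-congˡ (*-congˡ (odd-+ f g)))
    (solve 5 (λ a b d u v → b :+ d :+ a :* (u :+ v) := (b :+ a :* u) :+ (d :+ a :* v)) refl a b d _ _)
  odd-+ []      g       = sym (+-identityˡ _)
  odd-+ (b ∷ f) []      = sym (+-identityʳ _)
  odd-+ (b ∷ f) (d ∷ g) = even-+ f g

  even-scale : ∀ b f → even (scale b f) ≈ b * even f
  odd-scale : ∀ b f → odd (scale b f) ≈ b * odd f
  even-scale b []      = sym (zeroʳ b)
  even-scale b (d ∷ f) = trans (+-congˡ (*-congˡ (odd-scale b f)))
    (solve 4 (λ a b d u → b :* d :+ a :* (b :* u) := b :* (d :+ a :* u)) refl a b d _)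
  odd-scale b []      = sym (zeroʳ b)
  odd-scale b (d ∷ f) = even-scale b f

  even-* : ∀ f g → even (f *ₚ g) ≈ even f * even g + a * (odd f * odd g)
  odd-* : ∀ f g → odd (f *ₚ g) ≈ even f * odd g + odd f * even g
  even-* []      g = solve 3 (λ a u v → con (+ 0) := con (+ 0) :* u :+ a :* (con (+ 0) :* v)) refl a _ _
  even-* (b ∷ f) g = begin
    even (scale b g +ₚ shift (f *ₚ g))                 ≈⟨ even-+ (scale b g) _ ⟩
    even (scale b g) + (0# + a * odd (f *ₚ g))         ≈⟨ +-cong (even-scale b g) (+-congˡ (*-congˡ (odd-* f g))) ⟩
    b * even g + (0# + a * (even f * odd g + odd f * even g))
      ≈⟨ solve 6 (λ a b u v u′ v′ → b :* u′ :+ (con (+ 0) :+ a :* (u :* v′ :+ v :* u′)) := (b :+ a :* v) :* u′ :+ a :* (u :* v′))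
           refl a b (even f) (odd f) (even g) (odd g) ⟩
    (b + a * odd f) * even g + a * (even f * odd g)    ∎
  odd-* []      g = solve 2 (λ u v → con (+ 0) := con (+ 0) :* v :+ con (+ 0) :* u) refl _ _
  odd-* (b ∷ f) g = begin
    odd (scale b g +ₚ shift (f *ₚ g))                  ≈⟨ odd-+ (scale b g) _ ⟩
    odd (scale b g) + even (f *ₚ g)                    ≈⟨ +-cong (odd-scale b g) (even-* f g) ⟩
    b * odd g + (even f * even g + a * (odd f * odd g))
      ≈⟨ solve 6 (λ a b u v u′ v′ → b :* v′ :+ (u :* u′ :+ a :* (v :* v′)) := (b :+ a :* v) :* v′ :+ u :* u′)
           refl a b (even f) (odd f) (even g) (odd g) ⟩
    (b + a * odd f) * odd g + even f * even g          ∎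

  norm-≈ : ∀ f g → even f ≈ even g → odd f ≈ odd g → norm f ≈ norm g
  norm-≈ f g p q = +-cong (*-cong p p) (-‿cong (*-congˡ (*-cong q q)))

  norm-cong : ∀ f g → f ≋ g → norm f ≈ norm g
  norm-cong f g p = norm-≈ f g (even-cong f g p) (odd-cong f g p)

  -- Brahmagupta's identity for the form u² - a v².
  norm-* : ∀ f g → norm (f *ₚ g) ≈ norm f * norm g
  norm-* f g = begin
    norm (f *ₚ g) ≈⟨ +-cong (*-cong (even-* f g) (even-* f g)) (-‿cong (*-congˡ (*-cong (odd-* f g) (odd-* f g)))) ⟩
    _ ≈⟨ solve 5 (λ a u v u′ v′ → (u :* u′ :+ a :* (v :* v′)) :* (u :* u′ :+ a :* (v :* v′)) :- a :* ((u :* v′ :+ v :* u′) :* (u :* v′ :+ v :* u′))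
                     := (u :* u :- a :* (v :* v)) :* (u′ :* u′ :- a :* (v′ :* v′))) refl a (even f) (odd f) (even g) (odd g) ⟩
    norm f * norm g ∎

  norm-scale : ∀ b f → norm (scale b f) ≈ b * b * norm f
  norm-scale b f = trans (+-cong (*-cong (even-scale b f) (even-scale b f)) (-‿cong (*-congˡ (*-cong (odd-scale b f) (odd-scale b f)))))
    (solve 4 (λ a b u v → b :* u :* (b :* u) :- a :* (b :* v :* (b :* v)) := b :* b :* (u :* u :- a :* (v :* v))) refl a b _ _)

  -- The norm of x is -a; this is the origin of the powers of -a.
  norm-shift : ∀ f → norm (shift f) ≈ - a * norm f
  norm-shift f = solve 3 (λ a u v → (con (+ 0) :+ a :* v) :* (con (+ 0) :+ a :* v) :- a :* (u :* u) := :- a :* (u :* u :- a :* (v :* v))) refl a (even f) (odd f)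

  norm-monomial-* : ∀ n f → norm (monomial n *ₚ f) ≈ (- a) ^ n * norm f
  norm-monomial-* zero    f = trans (norm-cong _ f (*ₚ-identityˡ f)) (sym (*-identityˡ _))
  norm-monomial-* (suc n) f = begin
    norm (monomial (suc n) *ₚ f)       ≈⟨ norm-cong _ (shift (monomial n *ₚ f)) (shift-*ₚ (monomial n) f) ⟩
    norm (shift (monomial n *ₚ f))     ≈⟨ norm-shift (monomial n *ₚ f) ⟩
    - a * norm (monomial n *ₚ f)       ≈⟨ *-congˡ (norm-monomial-* n f) ⟩
    - a * ((- a) ^ n * norm f)         ≈⟨ *-assoc _ _ _ ⟨
    (- a) ^ suc n * norm f             ∎

  norm-X- : ∀ u → norm (X- u) ≈ u * u - a
  norm-X- u = solve 2 (λ a u → (:- u :+ a :* con (+ 0)) :* (:- u :+ a :* con (+ 0)) :- a :* ((con (+ 1) :+ a :* con (+ 0)) :* (con (+ 1) :+ a :* con (+ 0)))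
    := u :* u :- a) refl a u

  norm-1 : norm (const 1#) ≈ 1#
  norm-1 = solve 1 (λ a → (con (+ 1) :+ a :* con (+ 0)) :* (con (+ 1) :+ a :* con (+ 0)) :- a :* (con (+ 0) :* con (+ 0)) := con (+ 1)) refl a

  norm-product : ∀ k (g : Fin k → Poly) → norm (product g) ≈ ∏ (λ i → norm (g i))
  norm-product zero    g = norm-1
  norm-product (suc k) g = trans (norm-* (g zero) _) (*-congˡ (norm-product k _))

  eval-√ : ∀ f s → s * s ≈ a → eval f s ≈ even f + s * odd f
  eval-√ []      s p = solve 1 (λ s → con (+ 0) := con (+ 0) :+ s :* con (+ 0)) refl s
  eval-√ (b ∷ f) s p = begin
    b + s * eval f s                   ≈⟨ +-congˡ (*-congˡ (eval-√ f s p)) ⟩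
    b + s * (even f + s * odd f)       ≈⟨ solve 4 (λ b s u v → b :+ s :* (u :+ s :* v) := b :+ s :* s :* v :+ s :* u) refl b s _ _ ⟩
    b + s * s * odd f + s * even f     ≈⟨ +-congʳ (+-congˡ (*-congʳ p)) ⟩
    b + a * odd f + s * even f         ∎

  -- The bridge from the norm form to the values in the theorem; there s lives in the given
  -- extension.
  norm-eval : ∀ f s → s * s ≈ a → eval f s * eval f (- s) ≈ norm f
  norm-eval f s p = begin
    eval f s * eval f (- s)                                  ≈⟨ *-cong (eval-√ f s p) (eval-√ f (- s) (trans (solve 1 (λ s → :- s :* :- s := s :* s) refl s) p)) ⟩
    (even f + s * odd f) * (even f + - s * odd f)            ≈⟨ solve 3 (λ s u v → (u :+ s :* v) :* (u :+ :- s :* v) := u :* u :- s :* s :* (v :* v)) refl s _ _ ⟩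
    even f * even f - s * s * (odd f * odd f)                ≈⟨ +-congˡ (-‿cong (*-congʳ p)) ⟩
    norm f                                                   ∎

  even-monomial-odd : ∀ t → even (monomial (suc (2 ℕ.* t))) ≈ 0#
  odd-monomial-odd : ∀ t → odd (monomial (suc (2 ℕ.* t))) ≈ a ^ t
  even-monomial-odd zero    = solve 1 (λ a → con (+ 0) :+ a :* con (+ 0) := con (+ 0)) refl a
  even-monomial-odd (suc t) rewrite ℕₚ.+-suc t (t ℕ.+ 0) = trans (+-identityˡ _) (trans (*-congˡ (even-monomial-odd t)) (zeroʳ a))
  odd-monomial-odd zero    = trans (+-congˡ (zeroʳ a)) (+-identityʳ 1#)
  odd-monomial-odd (suc t) rewrite ℕₚ.+-suc t (t ℕ.+ 0) = trans (+-identityˡ _) (*-congˡ (odd-monomial-odd t))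

  -- X^(2t+1) - X is an odd polynomial: its even part is zero, and its odd part is a^t - 1.
  norm-fixedPolynomial : ∀ t → a ^ t ≈ 1# → norm (fixedPolynomial (suc (2 ℕ.* t))) ≈ 0#
  norm-fixedPolynomial t aᵗ≈1 = begin
    even f * even f - a * (odd f * odd f)  ≈⟨ +-cong (*-cong even-f even-f) (-‿cong (*-congˡ (*-cong odd-f odd-f))) ⟩
    0# * 0# - a * (0# * 0#)                ≈⟨ solve 1 (λ a → con (+ 0) :* con (+ 0) :- a :* (con (+ 0) :* con (+ 0)) := con (+ 0)) refl a ⟩
    0#                                     ∎
    where
    f = fixedPolynomial (suc (2 ℕ.* t))
    even-f : even f ≈ 0#
    even-f = trans (even-+ (monomial (suc (2 ℕ.* t))) (-ₚ X)) (trans (+-congʳ (even-monomial-odd t))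
      (solve 1 (λ a → con (+ 0) :+ (:- con (+ 0) :+ a :* con (+ 0)) := con (+ 0)) refl a))
    odd-f : odd f ≈ 0#
    odd-f = trans (odd-+ (monomial (suc (2 ℕ.* t))) (-ₚ X)) (trans (+-congʳ (trans (odd-monomial-odd t) aᵗ≈1))
      (solve 1 (λ a → con (+ 1) :+ (:- con (+ 1) :+ a :* con (+ 0)) := con (+ 0)) refl a))

-- Reversal of polynomials along x ↦ a/x.

module Reciprocal {c ℓ} (R : CommutativeRing c ℓ) (a : CommutativeRing.Carrier R) where

  open CommutativeRing R hiding (zero)
  open PolynomialRing R
  open Evaluation R
  open Degree R
  open SquareRootNorm R a
  open IntegerCoefficients R using (solve; _:=_; con; _:+_; _:*_)
  open IntegerCoefficients polynomialRing using () renaming (solve to solveₚ; _:=_ to _:=ₚ_; _:*_ to _:*ₚ_; _:+_ to _:+ₚ_)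
  open import Algebra.Properties.Semiring.Exp semiring using (_^_)
  open import Relation.Binary.Reasoning.Setoid setoid
  module ≋-Reasoning where
    open import Relation.Binary.Reasoning.Setoid ≋-setoid public

  tail : Poly → Poly
  tail []      = []
  tail (b ∷ f) = f

  coeff-tail : ∀ f i → coeff (tail f) i ≈ coeff f (suc i)
  coeff-tail []      i = refl
  coeff-tail (b ∷ f) i = refl

  head-tail : ∀ f → f ≋ coeff f 0 ∷ tail f
  head-tail []      = ≋-sym (shift-[] refl ≋-refl)
  head-tail (b ∷ f) = ≋-refl

  ∷-const-X : ∀ b f → b ∷ f ≋ const b +ₚ X *ₚ f
  ∷-const-X b f = ≋-trans (∷-cong (sym (+-identityʳ b)) ≋-refl) (+ₚ-cong {const b} ≋-refl (≋-sym (X-*ₚ f)))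

  tail-cong : ∀ {f g} → f ≋ g → tail f ≋ tail g
  tail-cong {f} {g} p = mk λ i → trans (coeff-tail f i) (trans (at p (suc i)) (sym (coeff-tail g i)))

  tail-+ : ∀ f g → tail (f +ₚ g) ≋ tail f +ₚ tail g
  tail-+ []      g       = ≋-refl
  tail-+ (b ∷ f) []      = ≋-sym (+ₚ-identityʳ f)
  tail-+ (b ∷ f) (d ∷ g) = ≋-refl

  tail-const-* : ∀ b f → tail (const b *ₚ f) ≋ const b *ₚ tail f
  tail-const-* b []      = ≋-sym (*ₚ-zeroʳ (const b))
  tail-const-* b (d ∷ f) = ≋-trans (tail-cong {const b *ₚ (d ∷ f)} (const-*ₚ b (d ∷ f))) (≋-sym (const-*ₚ b f))

  tail-Below : ∀ {N} f → Below (suc N) f → Below N (tail f)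
  tail-Below f B i N≤i = trans (coeff-tail f i) (B (suc i) (s≤s N≤i))

  const-* : ∀ b d → const (b * d) ≋ const b *ₚ const d
  const-* b d = ≋-sym (const-*ₚ b (const d))

  const-0 : const 0# ≋ []
  const-0 = shift-[] refl ≋-refl

  const-cong : ∀ {b d} → b ≈ d → const b ≋ const d
  const-cong p = ∷-cong p ≋-refl

  -- ∑ bᵢ aⁱ xᴺ⁻ⁱ for f = ∑ bᵢ xⁱ of degree at most N.
  reverse : ℕ → Poly → Poly
  reverse zero    f = const (coeff f 0)
  reverse (suc N) f = const (coeff f 0) *ₚ monomial (suc N) +ₚ const a *ₚ reverse N (tail f)

  reverse-cong : ∀ N {f g} → f ≋ g → reverse N f ≋ reverse N g
  reverse-cong zero    p = const-cong (at p 0)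
  reverse-cong (suc N) {f} {g} p = +ₚ-cong (*ₚ-congˡ (monomial (suc N)) (const-cong (at p 0))) (*ₚ-congʳ (const a) (reverse-cong N (tail-cong p)))

  reverse-+ : ∀ N f g → reverse N (f +ₚ g) ≋ reverse N f +ₚ reverse N g
  reverse-+ zero    f g = const-cong (coeff-+ f g 0)
  reverse-+ (suc N) f g = ≋-trans
    (+ₚ-cong (*ₚ-congˡ {const (coeff (f +ₚ g) 0)} {const (coeff f 0) +ₚ const (coeff g 0)} (monomial (suc N)) (const-cong (coeff-+ f g 0)))
      (*ₚ-congʳ (const a) (≋-trans (reverse-cong N (tail-+ f g)) (reverse-+ N (tail f) (tail g)))))
    (solveₚ 6 (λ b d m a u v → (b :+ₚ d) :*ₚ m :+ₚ a :*ₚ (u :+ₚ v) :=ₚ (b :*ₚ m :+ₚ a :*ₚ u) :+ₚ (d :*ₚ m :+ₚ a :*ₚ v)) ≋-refl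
      (const (coeff f 0)) (const (coeff g 0)) (monomial (suc N)) (const a) (reverse N (tail f)) (reverse N (tail g)))

  coeff-const-* : ∀ b f i → coeff (const b *ₚ f) i ≈ b * coeff f i
  coeff-const-* b f i = trans (at (const-*ₚ b f) i) (coeff-scale b f i)

  reverse-const-* : ∀ N b f → reverse N (const b *ₚ f) ≋ const b *ₚ reverse N f
  reverse-const-* zero    b f = ≋-trans (const-cong (coeff-const-* b f 0)) (const-* b (coeff f 0))
  reverse-const-* (suc N) b f = ≋-trans
    (+ₚ-cong (*ₚ-congˡ (monomial (suc N)) (≋-trans (const-cong (coeff-const-* b f 0)) (const-* b (coeff f 0))))
      (*ₚ-congʳ (const a) (≋-trans (reverse-cong N (tail-const-* b f)) (reverse-const-* N b (tail f)))))
    (solveₚ 5 (λ b d m a u → (b :*ₚ d) :*ₚ m :+ₚ a :*ₚ (b :*ₚ u) :=ₚ b :*ₚ (d :*ₚ m :+ₚ a :*ₚ u)) ≋-refl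
      (const b) (const (coeff f 0)) (monomial (suc N)) (const a) (reverse N (tail f)))

  reverse-[] : ∀ N → reverse N [] ≋ []
  reverse-[] zero    = const-0
  reverse-[] (suc N) = ≋-trans (+ₚ-cong ([]-*ₚ (monomial (suc N)) const-0) (≋-trans (*ₚ-congʳ (const a) (reverse-[] N)) (*ₚ-zeroʳ (const a)))) ≋-refl

  reverse-constant : ∀ N f → Below 1 f → reverse N f ≋ const (coeff f 0) *ₚ monomial N
  reverse-constant zero    f B = ≋-trans (const-cong (sym (*-identityʳ _))) (const-* (coeff f 0) 1#)
  reverse-constant (suc N) f B = ≋-trans
    (+ₚ-cong (≋-refl {const (coeff f 0) *ₚ monomial (suc N)})
      (≋-trans (*ₚ-congʳ (const a) (≋-trans (reverse-cong N (Below-0 (tail-Below f B))) (reverse-[] N))) (*ₚ-zeroʳ (const a))))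
    (+ₚ-identityʳ _)

  monomial-suc : ∀ n → monomial (suc n) ≋ X *ₚ monomial n
  monomial-suc n = ≋-sym (X-*ₚ (monomial n))

  monomial-+ : ∀ m n → monomial (m ℕ.+ n) ≋ monomial m *ₚ monomial n
  monomial-+ zero    n = ≋-sym (*ₚ-identityˡ (monomial n))
  monomial-+ (suc m) n = ≋-trans (∷-cong refl (monomial-+ m n)) (≋-sym (shift-*ₚ (monomial m) (monomial n)))

  -- N is only a bound for the degree, and x^N f(a/x) depends on it through x^N. Used to bring the
  -- two summands of a product to the same formal degree.
  reverse-raise : ∀ k N f → Below (suc N) f → reverse (k ℕ.+ N) f ≋ monomial k *ₚ reverse N f
  reverse-raise k zero    f B rewrite ℕₚ.+-identityʳ k = ≋-trans (reverse-constant k f B) (*ₚ-comm (const (coeff f 0)) (monomial k))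
  reverse-raise k (suc N) f B rewrite ℕₚ.+-suc k N = ≋-trans
    (+ₚ-cong (*ₚ-congʳ (const (coeff f 0)) (≋-trans (monomial-suc (k ℕ.+ N)) (*ₚ-congʳ X (monomial-+ k N))))
      (*ₚ-congʳ (const a) (reverse-raise k N (tail f) (tail-Below f B))))
    (≋-trans (solveₚ 6 (λ b x m n a u → b :*ₚ (x :*ₚ (m :*ₚ n)) :+ₚ a :*ₚ (m :*ₚ u) :=ₚ m :*ₚ (b :*ₚ (x :*ₚ n) :+ₚ a :*ₚ u)) ≋-refl
      (const (coeff f 0)) X (monomial k) (monomial N) (const a) (reverse N (tail f)))
      (*ₚ-congʳ (monomial k) (+ₚ-cong (*ₚ-congʳ (const (coeff f 0)) (≋-sym (monomial-suc N))) (≋-refl {const a *ₚ reverse N (tail f)}))))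

  reverse-* : ∀ N M f g → Below (suc N) f → Below (suc M) g → reverse (N ℕ.+ M) (f *ₚ g) ≋ reverse N f *ₚ reverse M g
  reverse-* zero M f g B C = ≋-trans (reverse-cong M (*ₚ-congˡ g (Leading-0⇒const f (refl , B)))) (reverse-const-* M (coeff f 0) g)
  reverse-* (suc N) M f g B C = ≋R.begin
    reverse (suc N ℕ.+ M) (f *ₚ g)
      ≋R.≈⟨ reverse-cong (suc N ℕ.+ M) (≋-trans (*ₚ-congˡ g (head-tail f)) (+ₚ-cong (≋-sym (const-*ₚ b g)) ≋-refl)) ⟩
    reverse (suc N ℕ.+ M) (const b *ₚ g +ₚ shift (f′ *ₚ g))
      ≋R.≈⟨ reverse-+ (suc N ℕ.+ M) (const b *ₚ g) (shift (f′ *ₚ g)) ⟩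
    reverse (suc N ℕ.+ M) (const b *ₚ g) +ₚ (const 0# *ₚ monomial (suc N ℕ.+ M) +ₚ const a *ₚ reverse (N ℕ.+ M) (f′ *ₚ g))
      ≋R.≈⟨ +ₚ-cong (≋-trans (reverse-const-* (suc N ℕ.+ M) b g) (*ₚ-congʳ (const b) (reverse-raise (suc N) M g C)))
             (+ₚ-cong ([]-*ₚ (monomial (suc N ℕ.+ M)) const-0) (*ₚ-congʳ (const a) (reverse-* N M f′ g (tail-Below f B) C))) ⟩
    const b *ₚ (monomial (suc N) *ₚ reverse M g) +ₚ const a *ₚ (reverse N f′ *ₚ reverse M g)
      ≋R.≈⟨ solveₚ 5 (λ b m v a u → b :*ₚ (m :*ₚ v) :+ₚ a :*ₚ (u :*ₚ v) :=ₚ (b :*ₚ m :+ₚ a :*ₚ u) :*ₚ v) ≋-refl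
             (const b) (monomial (suc N)) (reverse M g) (const a) (reverse N f′) ⟩
    reverse (suc N) f *ₚ reverse M g ≋R.∎
    where
    module ≋R = ≋-Reasoning
    b = coeff f 0
    f′ = tail f

  Leading-const-* : ∀ {D b} d f → Leading D b f → Leading D (d * b) (const d *ₚ f)
  Leading-const-* {D} {b} d f L = Leading-cong (≋-sym (const-*ₚ d f)) (Leading-scale d f L)

  Leading-+-Below : ∀ {D b} f g → Leading D b f → Below D g → Leading D b (f +ₚ g)
  Leading-+-Below {D} f g (l , B) C = trans (coeff-+ f g D) (trans (+-cong l (C D ℕₚ.≤-refl)) (+-identityʳ _)) ,
    Below-+ f g B (Below-mono {f = g} (ℕₚ.n≤1+n D) C)

  -- The reversal has degree exactly N only when the constant term of f is nonzero.
  Leading-reverse : ∀ N f → Leading N (coeff f 0) (reverse N f)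
  Leading-reverse zero    f = refl , λ { (suc i) _ → refl }
  Leading-reverse (suc N) f = Leading-+-Below (const (coeff f 0) *ₚ monomial (suc N)) (const a *ₚ reverse N (tail f))
    (Leading-congˡ (const (coeff f 0) *ₚ monomial (suc N)) (*-identityʳ _) (Leading-const-* (coeff f 0) (monomial (suc N)) (Leading-monomial (suc N))))
    (proj₂ (Leading-const-* a (reverse N (tail f)) (Leading-reverse N (tail f))))

  coeff-reverse-0 : ∀ N f → coeff (reverse N f) 0 ≈ coeff f N * a ^ N
  coeff-reverse-0 zero    f = sym (*-identityʳ _)
  coeff-reverse-0 (suc N) f = begin
    coeff (const (coeff f 0) *ₚ monomial (suc N) +ₚ const a *ₚ reverse N (tail f)) 0
      ≈⟨ coeff-+ (const (coeff f 0) *ₚ monomial (suc N)) (const a *ₚ reverse N (tail f)) 0 ⟩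
    coeff (const (coeff f 0) *ₚ monomial (suc N)) 0 + coeff (const a *ₚ reverse N (tail f)) 0
      ≈⟨ +-cong (coeff-const-* (coeff f 0) (monomial (suc N)) 0) (coeff-const-* a (reverse N (tail f)) 0) ⟩
    coeff f 0 * 0# + a * coeff (reverse N (tail f)) 0
      ≈⟨ +-congˡ (*-congˡ (trans (coeff-reverse-0 N (tail f)) (*-congʳ (coeff-tail f N)))) ⟩
    coeff f 0 * 0# + a * (coeff f (suc N) * a ^ N)
      ≈⟨ solve 4 (λ b a d e → b :* con (+ 0) :+ a :* (d :* e) := d :* (a :* e)) refl _ a _ _ ⟩
    coeff f (suc N) * a ^ suc N ∎

  reverse-monomial : ∀ N → reverse N (monomial N) ≋ const (a ^ N)
  reverse-monomial zero    = ≋-refl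
  reverse-monomial (suc N) = ≋-trans
    (+ₚ-cong ([]-*ₚ (monomial (suc N)) const-0) (*ₚ-congʳ (const a) (reverse-monomial N))) (≋-sym (const-* a (a ^ N)))

  -- x ↦ a/x is an involution, and x^N (a/x)^N leaves the factor a^N.
  reverse-involutive : ∀ N f → Below (suc N) f → reverse N (reverse N f) ≋ const (a ^ N) *ₚ f
  reverse-involutive zero    f B = ≋-sym (≋-trans (*ₚ-identityˡ f) (Leading-0⇒const f (refl , B)))
  reverse-involutive (suc N) f B = ≋R.begin
    reverse (suc N) (const b *ₚ monomial (suc N) +ₚ const a *ₚ reverse N f′)
      ≋R.≈⟨ reverse-+ (suc N) (const b *ₚ monomial (suc N)) (const a *ₚ reverse N f′) ⟩
    reverse (suc N) (const b *ₚ monomial (suc N)) +ₚ reverse (suc N) (const a *ₚ reverse N f′)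
      ≋R.≈⟨ +ₚ-cong (≋-trans (reverse-const-* (suc N) b (monomial (suc N))) (*ₚ-congʳ (const b) (≋-trans (reverse-monomial (suc N)) (const-* a (a ^ N)))))
             (≋-trans (reverse-const-* (suc N) a (reverse N f′)) (*ₚ-congʳ (const a)
               (≋-trans (reverse-raise 1 N (reverse N f′) (proj₂ (Leading-reverse N f′))) (*ₚ-congʳ X (reverse-involutive N f′ (tail-Below f B)))))) ⟩
    const b *ₚ (const a *ₚ const (a ^ N)) +ₚ const a *ₚ (X *ₚ (const (a ^ N) *ₚ f′))
      ≋R.≈⟨ solveₚ 5 (λ b a e x f → b :*ₚ (a :*ₚ e) :+ₚ a :*ₚ (x :*ₚ (e :*ₚ f)) :=ₚ (a :*ₚ e) :*ₚ (b :+ₚ x :*ₚ f)) ≋-refl (const b) (const a) (const (a ^ N)) X f′ ⟩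
    (const a *ₚ const (a ^ N)) *ₚ (const b +ₚ X *ₚ f′)
      ≋R.≈⟨ *ₚ-cong (const-* a (a ^ N)) (≋-trans (head-tail f) (∷-const-X b f′)) ⟨
    const (a ^ suc N) *ₚ f ≋R.∎
    where
    module ≋R = ≋-Reasoning
    b = coeff f 0
    f′ = tail f

  eval-const-* : ∀ b f x → eval (const b *ₚ f) x ≈ b * eval f x
  eval-const-* b f x = trans (eval-cong (const b *ₚ f) (scale b f) x (const-*ₚ b f)) (eval-scale b f x)

  -- y stands for a/x; the hypothesis on x y replaces the division.
  eval-reverse : ∀ N f x y → x * y ≈ a → Below (suc N) f → eval (reverse N f) x ≈ x ^ N * eval f y
  eval-reverse zero    f x y xy≈a B = begin
    coeff f 0 + x * 0#          ≈⟨ solve 3 (λ b x y → b :+ x :* con (+ 0) := con (+ 1) :* (b :+ y :* con (+ 0))) refl _ x y ⟩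
    1# * (coeff f 0 + y * 0#)   ≈⟨ *-congˡ (eval-cong f (const (coeff f 0)) y (Leading-0⇒const f (refl , B))) ⟨
    1# * eval f y               ∎
  eval-reverse (suc N) f x y xy≈a B = begin
    eval (const b *ₚ monomial (suc N) +ₚ const a *ₚ reverse N f′) x
      ≈⟨ eval-+ (const b *ₚ monomial (suc N)) (const a *ₚ reverse N f′) x ⟩
    eval (const b *ₚ monomial (suc N)) x + eval (const a *ₚ reverse N f′) x
      ≈⟨ +-cong (trans (eval-const-* b (monomial (suc N)) x) (*-congˡ (eval-monomial (suc N) x)))
                (trans (eval-const-* a (reverse N f′) x) (*-cong (sym xy≈a) (eval-reverse N f′ x y xy≈a (tail-Below f B)))) ⟩
    b * x ^ suc N + x * y * (x ^ N * eval f′ y)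
      ≈⟨ solve 5 (λ b x y e u → b :* (x :* e) :+ x :* y :* (e :* u) := x :* e :* (b :+ y :* u)) refl b x y (x ^ N) (eval f′ y) ⟩
    x ^ suc N * (b + y * eval f′ y)
      ≈⟨ *-congˡ (eval-cong f (b ∷ f′) y (head-tail f)) ⟨
    x ^ suc N * eval f y ∎
    where
    b = coeff f 0
    f′ = tail f

  even-const-* : ∀ b f → even (const b *ₚ f) ≈ b * even f
  even-const-* b f = trans (even-cong (const b *ₚ f) (scale b f) (const-*ₚ b f)) (even-scale b f)

  odd-const-* : ∀ b f → odd (const b *ₚ f) ≈ b * odd f
  odd-const-* b f = trans (odd-cong (const b *ₚ f) (scale b f) (const-*ₚ b f)) (odd-scale b f)

  -- The two shifts display a factor x², which the even and odd parts turn into a.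
  monomial-*-step : ∀ N f → monomial (suc N) *ₚ f ≋ const (coeff f 0) *ₚ monomial (suc N) +ₚ shift (shift (monomial N *ₚ tail f))
  monomial-*-step N f = ≋R.begin
    monomial (suc N) *ₚ f                                     ≋R.≈⟨ *ₚ-cong {monomial (suc N)} (monomial-suc N) (≋-trans (head-tail f) (∷-const-X b (tail f))) ⟩
    X *ₚ monomial N *ₚ (const b +ₚ X *ₚ tail f)               ≋R.≈⟨ solveₚ 4 (λ x m b f → x :*ₚ m :*ₚ (b :+ₚ x :*ₚ f) :=ₚ b :*ₚ (x :*ₚ m) :+ₚ x :*ₚ (x :*ₚ (m :*ₚ f))) ≋-refl X (monomial N) (const b) (tail f) ⟩
    const b *ₚ (X *ₚ monomial N) +ₚ X *ₚ (X *ₚ (monomial N *ₚ tail f))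
      ≋R.≈⟨ +ₚ-cong (*ₚ-congʳ (const b) (≋-sym (monomial-suc N))) (≋-trans (X-*ₚ (X *ₚ (monomial N *ₚ tail f))) (∷-cong refl (X-*ₚ (monomial N *ₚ tail f)))) ⟩
    const b *ₚ monomial (suc N) +ₚ shift (shift (monomial N *ₚ tail f)) ≋R.∎
    where
    module ≋R = ≋-Reasoning
    b = coeff f 0

  -- Modulo x² - a the reversal of f is xᴺ f.
  even-reverse : ∀ N f → Below (suc N) f → even (reverse N f) ≈ even (monomial N *ₚ f)
  even-reverse zero    f B = even-cong (const (coeff f 0)) (const 1# *ₚ f) (≋-sym (≋-trans (*ₚ-identityˡ f) (Leading-0⇒const f (refl , B))))
  even-reverse (suc N) f B = begin
    even (const b *ₚ monomial (suc N) +ₚ const a *ₚ reverse N f′)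
      ≈⟨ even-+ (const b *ₚ monomial (suc N)) (const a *ₚ reverse N f′) ⟩
    even (const b *ₚ monomial (suc N)) + even (const a *ₚ reverse N f′)
      ≈⟨ +-congˡ (trans (even-const-* a (reverse N f′)) (*-congˡ (trans (even-reverse N f′ (tail-Below f B)) (sym (+-identityˡ _))))) ⟩
    even (const b *ₚ monomial (suc N)) + a * (0# + even (monomial N *ₚ f′))
      ≈⟨ +-congˡ (trans (*-congˡ (+-identityˡ _)) (sym (+-identityˡ _))) ⟩
    even (const b *ₚ monomial (suc N)) + even (shift (shift (monomial N *ₚ f′)))
      ≈⟨ even-+ (const b *ₚ monomial (suc N)) (shift (shift (monomial N *ₚ f′))) ⟨
    even (const b *ₚ monomial (suc N) +ₚ shift (shift (monomial N *ₚ f′)))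
      ≈⟨ even-cong (monomial (suc N) *ₚ f) (const b *ₚ monomial (suc N) +ₚ shift (shift (monomial N *ₚ f′))) (monomial-*-step N f) ⟨
    even (monomial (suc N) *ₚ f) ∎
    where
    b = coeff f 0
    f′ = tail f

  odd-reverse : ∀ N f → Below (suc N) f → odd (reverse N f) ≈ odd (monomial N *ₚ f)
  odd-reverse zero    f B = odd-cong (const (coeff f 0)) (const 1# *ₚ f) (≋-sym (≋-trans (*ₚ-identityˡ f) (Leading-0⇒const f (refl , B))))
  odd-reverse (suc N) f B = begin
    odd (const b *ₚ monomial (suc N) +ₚ const a *ₚ reverse N f′)
      ≈⟨ odd-+ (const b *ₚ monomial (suc N)) (const a *ₚ reverse N f′) ⟩
    odd (const b *ₚ monomial (suc N)) + odd (const a *ₚ reverse N f′)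
      ≈⟨ +-congˡ (trans (odd-const-* a (reverse N f′)) (*-congˡ (odd-reverse N f′ (tail-Below f B)))) ⟩
    odd (const b *ₚ monomial (suc N)) + a * odd (monomial N *ₚ f′)
      ≈⟨ +-congˡ (+-identityˡ _) ⟨
    odd (const b *ₚ monomial (suc N)) + odd (shift (shift (monomial N *ₚ f′)))
      ≈⟨ odd-+ (const b *ₚ monomial (suc N)) (shift (shift (monomial N *ₚ f′))) ⟨
    odd (const b *ₚ monomial (suc N) +ₚ shift (shift (monomial N *ₚ f′)))
      ≈⟨ odd-cong (monomial (suc N) *ₚ f) (const b *ₚ monomial (suc N) +ₚ shift (shift (monomial N *ₚ f′))) (monomial-*-step N f) ⟨
    odd (monomial (suc N) *ₚ f) ∎
    where
    b = coeff f 0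
    f′ = tail f

  norm-reverse : ∀ N f → Below (suc N) f → norm (reverse N f) ≈ (- a) ^ N * norm f
  norm-reverse N f B = trans (norm-≈ (reverse N f) (monomial N *ₚ f) (even-reverse N f B) (odd-reverse N f B)) (norm-monomial-* N f)

  applyDownFrom-cong : ∀ {g h : ℕ → Carrier} → (∀ i → g i ≈ h i) → ∀ N → applyDownFrom g N ≋ applyDownFrom h N
  applyDownFrom-cong p zero    = ≋-refl
  applyDownFrom-cong p (suc N) = ∷-cong (p N) (applyDownFrom-cong p N)

  -- `applyDownFrom` puts its largest index at the head, whereas `reverse` splits off the constant
  -- term, which belongs to the far end of the list.
  applyDownFrom-top : ∀ (g : ℕ → Carrier) N → applyDownFrom g (suc (suc N)) ≋ applyDownFrom (g ∘ suc) (suc N) +ₚ scale (g 0) (monomial (suc N))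
  applyDownFrom-top g zero    = ∷-cong (sym (trans (+-congˡ (zeroʳ _)) (+-identityʳ _))) (∷-cong (sym (*-identityʳ _)) ≋-refl)
  applyDownFrom-top g (suc N) = ∷-cong (sym (trans (+-congˡ (zeroʳ _)) (+-identityʳ _))) (applyDownFrom-top g N)

  -- With b = 1/f(0) the left side is the a-reciprocal of the definition.
  applyDownFrom-reverse : ∀ N b f → applyDownFrom (λ i → b * (coeff f i * a ^ i)) (suc N) ≋ const b *ₚ reverse N f
  applyDownFrom-reverse zero    b f = ≋-trans (const-cong (*-congˡ (*-identityʳ _))) (const-* b (coeff f 0))
  applyDownFrom-reverse (suc N) b f = ≋R.begin
    applyDownFrom g (suc (suc N))
      ≋R.≈⟨ applyDownFrom-top g N ⟩
    applyDownFrom (g ∘ suc) (suc N) +ₚ scale (g 0) (monomial (suc N))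
      ≋R.≈⟨ +ₚ-cong (≋-trans (applyDownFrom-cong step (suc N)) (≋-trans (applyDownFrom-reverse N (b * a) (tail f)) (*ₚ-congˡ (reverse N (tail f)) (const-* b a))))
             (≋-trans (≋-sym (const-*ₚ (g 0) (monomial (suc N)))) (*ₚ-congˡ (monomial (suc N)) (≋-trans (const-cong (*-congˡ (*-identityʳ _))) (const-* b (coeff f 0))))) ⟩
    const b *ₚ const a *ₚ reverse N (tail f) +ₚ const b *ₚ const (coeff f 0) *ₚ monomial (suc N)
      ≋R.≈⟨ solveₚ 5 (λ b a u d m → b :*ₚ a :*ₚ u :+ₚ b :*ₚ d :*ₚ m :=ₚ b :*ₚ (d :*ₚ m :+ₚ a :*ₚ u)) ≋-refl (const b) (const a) (reverse N (tail f)) (const (coeff f 0)) (monomial (suc N)) ⟩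
    const b *ₚ reverse (suc N) f ≋R.∎
    where
    module ≋R = ≋-Reasoning
    g : ℕ → Carrier
    g i = b * (coeff f i * a ^ i)
    step : ∀ i → g (suc i) ≈ b * a * (coeff (tail f) i * a ^ i)
    step i = trans (solve 4 (λ b d a e → b :* (d :* (a :* e)) := b :* a :* (d :* e)) refl b (coeff f (suc i)) a (a ^ i)) (*-congˡ (*-congʳ (sym (coeff-tail f i))))

-- Residue rings modulo a principal ideal.

module QuotientRing {c ℓ} (R : CommutativeRing c ℓ) (h : CommutativeRing.Carrier R) where

  open CommutativeRing R
  open IntegerCoefficients R using (solve; _:=_; con; _:+_; _:*_; _:-_; :-_)

  infix 4 _≡ₕ_
  infix 3 _by_
  -- The quotient keeps the carrier and coarsens the equality. The cofactor is stored, so an element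
  -- that vanishes in the quotient comes with its quotient by h.
  record _≡ₕ_ (x y : Carrier) : Set (c ⊔ ℓ) where
    constructor _by_
    field
      multiple : Carrier
      congruent : x ≈ y + multiple * h
  open _≡ₕ_ public

  ≈⇒≡ₕ : ∀ {x y} → x ≈ y → x ≡ₕ y
  ≈⇒≡ₕ {x} {y} p = 0# by trans p (solve 2 (λ y h → y := y :+ con (+ 0) :* h) refl y h)

  ≡ₕ0 : ∀ u → u * h ≡ₕ 0#
  ≡ₕ0 u = u by sym (+-identityˡ _)

  ≡ₕ-sym : ∀ {x y} → x ≡ₕ y → y ≡ₕ x
  ≡ₕ-sym {x} {y} (u by p) = (- u) by trans (solve 3 (λ y u h → y := y :+ u :* h :+ :- u :* h) refl y u h) (+-congʳ (sym p))

  ≡ₕ-trans : ∀ {x y z} → x ≡ₕ y → y ≡ₕ z → x ≡ₕ z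
  ≡ₕ-trans {x} {y} {z} (u by p) (v by q) = u + v by trans p (trans (+-congʳ q) (solve 4 (λ z u v h → z :+ v :* h :+ u :* h := z :+ (u :+ v) :* h) refl z u v h))

  ≡ₕ-+ : ∀ {x y x′ y′} → x ≡ₕ y → x′ ≡ₕ y′ → x + x′ ≡ₕ y + y′
  ≡ₕ-+ {x} {y} {x′} {y′} (u by p) (v by q) = u + v by trans (+-cong p q)
    (solve 5 (λ y y′ u v h → (y :+ u :* h) :+ (y′ :+ v :* h) := (y :+ y′) :+ (u :+ v) :* h) refl y y′ u v h)

  ≡ₕ-* : ∀ {x y x′ y′} → x ≡ₕ y → x′ ≡ₕ y′ → x * x′ ≡ₕ y * y′
  ≡ₕ-* {x} {y} {x′} {y′} (u by p) (v by q) = y * v + u * y′ + u * v * h by trans (*-cong p q)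
    (solve 5 (λ y y′ u v h → (y :+ u :* h) :* (y′ :+ v :* h) := y :* y′ :+ (y :* v :+ u :* y′ :+ u :* v :* h) :* h) refl y y′ u v h)

  ≡ₕ-neg : ∀ {x y} → x ≡ₕ y → - x ≡ₕ - y
  ≡ₕ-neg {x} {y} (u by p) = (- u) by trans (-‿cong p) (solve 3 (λ y u h → :- (y :+ u :* h) := :- y :+ :- u :* h) refl y u h)

  quotientRing : CommutativeRing c (c ⊔ ℓ)
  quotientRing = record
    { Carrier = Carrier ; _≈_ = _≡ₕ_ ; _+_ = _+_ ; _*_ = _*_ ; -_ = -_ ; 0# = 0# ; 1# = 1#
    ; isCommutativeRing = record
      { isRing = record
        { +-isAbelianGroup = record
          { isGroup = record
            { isMonoid = record
              { isSemigroup = record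
                { isMagma = record
                  { isEquivalence = record { refl = ≈⇒≡ₕ refl ; sym = ≡ₕ-sym ; trans = ≡ₕ-trans }
                  ; ∙-cong = ≡ₕ-+
                  }
                ; assoc = λ x y z → ≈⇒≡ₕ (+-assoc x y z)
                }
              ; identity = (λ x → ≈⇒≡ₕ (+-identityˡ x)) , (λ x → ≈⇒≡ₕ (+-identityʳ x))
              }
            ; inverse = (λ x → ≈⇒≡ₕ (-‿inverseˡ x)) , (λ x → ≈⇒≡ₕ (-‿inverseʳ x))
            ; ⁻¹-cong = ≡ₕ-neg
            }
          ; comm = λ x y → ≈⇒≡ₕ (+-comm x y)
          }
        ; *-cong = ≡ₕ-*
        ; *-assoc = λ x y z → ≈⇒≡ₕ (*-assoc x y z)
        ; *-identity = (λ x → ≈⇒≡ₕ (*-identityˡ x)) , (λ x → ≈⇒≡ₕ (*-identityʳ x))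
        ; distrib = (λ x y z → ≈⇒≡ₕ (distribˡ x y z)) , (λ x y z → ≈⇒≡ₕ (distribʳ x y z))
        }
      ; *-comm = λ x y → ≈⇒≡ₕ (*-comm x y)
      }
    }

-- Finite fields: Fermat's little theorem and Euler's criterion.

module FiniteField {c ℓ} (K : CommutativeRing c ℓ) where

  open CommutativeRing K hiding (zero)
  open IntegerCoefficients K using (solve; _:=_; con; _:+_; _:*_; _:-_; :-_)
  open import Algebra.Properties.Ring ring using () renaming (x∙y⁻¹≈ε⇒x≈y to x-y≈0⇒x≈y)
  open import Algebra.Properties.CommutativeSemiring.Exp commutativeSemiring
  open import Algebra.Properties.CommutativeMonoid.Sum *-commutativeMonoid using ()
    renaming (sum to ∏; sum-permute to ∏-permute; ∑-distrib-+ to ∏-distrib-*; sum-replicate to ∏-replicate; sum-cong-≋ to ∏-cong; sum-remove to ∏-remove)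
  open import Algebra.Properties.CommutativeMonoid.Sum +-commutativeMonoid using (sum; sum-permute; ∑-distrib-+; sum-replicate; sum-cong-≋)
  open import Algebra.Properties.Semiring.Mult semiring using () renaming (_×_ to _·_)
  open import Relation.Binary.Reasoning.Setoid setoid

  decide-≈ : ∀ {q} → Inverse setoid (≡ₚ.setoid (Fin q)) → ∀ x y → Dec (x ≈ y)
  decide-≈ enumeration x y = Dec.map′ (λ eq → trans (sym (strictlyInverseʳ x)) (trans (reflexive (≡.cong from eq)) (strictlyInverseʳ y))) to-cong (to x Finₚ.≟ to y)
    where open Inverse enumeration

  -- `0-or-unit` states the existence of inverses as a decision, from which integrality follows
  -- constructively.
  record IsFiniteField (q : ℕ) : Set (c ⊔ ℓ) where
    field
      1≉0         : ¬ (1# ≈ 0#)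
      enumeration : Inverse setoid (≡ₚ.setoid (Fin q))
      0-or-unit   : ∀ x → x ≈ 0# ⊎ ∃ λ y → y * x ≈ 1#

    open Inverse enumeration using (to; from; to-cong; strictlyInverseˡ; strictlyInverseʳ) public

    infix 4 _≟_
    _≟_ : ∀ x y → Dec (x ≈ y)
    _≟_ = decide-≈ enumeration

    from-injective : ∀ i j → i ≢ j → ¬ (from i ≈ from j)
    from-injective i j i≢j p = i≢j (≡.trans (≡.sym (strictlyInverseˡ i)) (≡.trans (to-cong p) (strictlyInverseˡ j)))

    inverseʳ : ∀ x → ¬ (x ≈ 0#) → ∃ λ y → y * x ≈ 1#
    inverseʳ x x≉0 with 0-or-unit x
    ... | inj₁ x≈0 = ⊥-elim (x≉0 x≈0)
    ... | inj₂ u   = u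

    integral : ∀ x y → x * y ≈ 0# → x ≈ 0# ⊎ y ≈ 0#
    integral x y xy≈0 with 0-or-unit x
    ... | inj₁ x≈0 = inj₁ x≈0
    ... | inj₂ (z , zx≈1) = inj₂ (begin
      y            ≈⟨ *-identityˡ y ⟨
      1# * y       ≈⟨ *-congʳ zx≈1 ⟨
      z * x * y    ≈⟨ *-assoc z x y ⟩
      z * (x * y)  ≈⟨ *-congˡ xy≈0 ⟩
      z * 0#       ≈⟨ zeroʳ z ⟩
      0#           ∎)

    *-cancelˡ : ∀ x y z → ¬ (x ≈ 0#) → x * y ≈ x * z → y ≈ z
    *-cancelˡ x y z x≉0 p = x-y≈0⇒x≈y y z (fromInj₂ (λ q → ⊥-elim (x≉0 q)) (integral x (y - z) (begin
      x * (y - z)    ≈⟨ solve 3 (λ x y z → x :* (y :- z) := x :* y :- x :* z) refl x y z ⟩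
      x * y - x * z  ≈⟨ +-congʳ p ⟩
      x * z - x * z  ≈⟨ -‿inverseʳ (x * z) ⟩
      0#             ∎)))

    *-≉0 : ∀ {x y} → ¬ (x ≈ 0#) → ¬ (y ≈ 0#) → ¬ (x * y ≈ 0#)
    *-≉0 {x} {y} x≉0 y≉0 p with integral x y p
    ... | inj₁ q = x≉0 q
    ... | inj₂ q = y≉0 q

    ^-≉0 : ∀ {x} n → ¬ (x ≈ 0#) → ¬ (x ^ n ≈ 0#)
    ^-≉0 zero    x≉0 = 1≉0
    ^-≉0 (suc n) x≉0 = *-≉0 x≉0 (^-≉0 n x≉0)

    ∏-≈0 : ∀ {k} (f : Fin k → Carrier) → ∏ f ≈ 0# → ∃ λ i → f i ≈ 0#
    ∏-≈0 {zero}  f p = ⊥-elim (1≉0 p)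
    ∏-≈0 {suc k} f p with integral (f zero) _ p
    ... | inj₁ q = zero , q
    ... | inj₂ q = let (i , r) = ∏-≈0 (λ i → f (suc i)) q in suc i , r

    ∏-≉0 : ∀ {k} (f : Fin k → Carrier) → (∀ i → ¬ (f i ≈ 0#)) → ¬ (∏ f ≈ 0#)
    ∏-≉0 f f≉0 p = let (i , r) = ∏-≈0 f p in f≉0 i r

    module _ (σ σ⁻¹ : Carrier → Carrier) (σ-cong : ∀ {x y} → x ≈ y → σ x ≈ σ y) (σ⁻¹-cong : ∀ {x y} → x ≈ y → σ⁻¹ x ≈ σ⁻¹ y)
             (σσ⁻¹ : ∀ x → σ (σ⁻¹ x) ≈ x) (σ⁻¹σ : ∀ x → σ⁻¹ (σ x) ≈ x) where

      reindexing : Permutation′ q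
      reindexing = permutation (λ i → to (σ (from i))) (λ i → to (σ⁻¹ (from i)))
        (λ i → ≡.trans (to-cong (trans (σ-cong (strictlyInverseʳ _)) (σσ⁻¹ (from i)))) (strictlyInverseˡ i))
        (λ i → ≡.trans (to-cong (trans (σ⁻¹-cong (strictlyInverseʳ _)) (σ⁻¹σ (from i)))) (strictlyInverseˡ i))

      sum-reindex : ∀ (f : Carrier → Carrier) → (∀ {x y} → x ≈ y → f x ≈ f y) → sum (λ i → f (from i)) ≈ sum (λ i → f (σ (from i)))
      sum-reindex f f-cong = trans (sum-permute _ reindexing) (sum-cong-≋ λ i → f-cong (strictlyInverseʳ (σ (from i))))

      ∏-reindex : ∀ (f : Carrier → Carrier) → (∀ {x y} → x ≈ y → f x ≈ f y) → ∏ (λ i → f (from i)) ≈ ∏ (λ i → f (σ (from i)))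
      ∏-reindex f f-cong = trans (∏-permute _ reindexing) (∏-cong λ i → f-cong (strictlyInverseʳ (σ (from i))))

    -- Translation by 1 permutes the field, so the sum S of all elements equals S + q · 1.
    order·1≈0 : q · 1# ≈ 0#
    order·1≈0 = begin
      q · 1#                                      ≈⟨ solve 2 (λ u s → u := s :+ u :- s) refl (q · 1#) S ⟩
      S + q · 1# - S                              ≈⟨ +-congʳ (+-congˡ (sum-replicate q)) ⟨
      S + sum {q} (λ _ → 1#) - S                  ≈⟨ +-congʳ (∑-distrib-+ from (λ _ → 1#)) ⟨
      sum (λ i → from i + 1#) - S                 ≈⟨ +-congʳ (sum-reindex (_+ 1#) (_- 1#) +-congʳ +-congʳ
                                                       (λ x → solve 1 (λ x → x :- con (+ 1) :+ con (+ 1) := x) refl x)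
                                                       (λ x → solve 1 (λ x → x :+ con (+ 1) :- con (+ 1) := x) refl x) (λ x → x) (λ p → p)) ⟨
      S - S                                       ≈⟨ -‿inverseʳ S ⟩
      0#                                          ∎
      where S = sum from

    -- 0# is replaced by 1#, so that the product over all x does not vanish.
    private
      or-1 : ∀ {x} → Dec (x ≈ 0#) → Carrier → Carrier
      or-1 (yes _) y = 1#
      or-1 (no  _) y = y

      nonzero : Carrier → Carrier
      nonzero x = or-1 (x ≟ 0#) x

      or-1-cong : ∀ {x y u v} (d : Dec (x ≈ 0#)) (e : Dec (y ≈ 0#)) → x ≈ y → u ≈ v → or-1 d u ≈ or-1 e v
      or-1-cong (yes p) (yes r) q s = refl
      or-1-cong (yes p) (no  r) q s = ⊥-elim (r (trans (sym q) p))
      or-1-cong (no  p) (yes r) q s = ⊥-elim (p (trans q r))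
      or-1-cong (no  p) (no  r) q s = s

      or-1-≉0 : ∀ {x} (d : Dec (x ≈ 0#)) → ¬ (or-1 d x ≈ 0#)
      or-1-≉0 (yes p) = 1≉0
      or-1-≉0 (no  p) = p

      or-1-* : ∀ {x y} (d : Dec (x * y ≈ 0#)) (e : Dec (y ≈ 0#)) → ¬ (x ≈ 0#) → or-1 d (x * y) ≈ or-1 e x * or-1 e y
      or-1-* (yes p) (yes r) x≉0 = sym (*-identityˡ 1#)
      or-1-* (yes p) (no  r) x≉0 = ⊥-elim (*-≉0 x≉0 r p)
      or-1-* {x} (no  p) (yes r) x≉0 = ⊥-elim (p (trans (*-congˡ r) (zeroʳ x)))
      or-1-* (no  p) (no  r) x≉0 = refl

      -- The complement of `or-1`: the two multiply to y, which separates the factors of x^q at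
      -- nonzero elements from the single factor at 0.
      1-or : ∀ {x} → Dec (x ≈ 0#) → Carrier → Carrier
      1-or (yes _) y = y
      1-or (no  _) y = 1#

      1-or-yes : ∀ {x y} (d : Dec (x ≈ 0#)) → x ≈ 0# → 1-or d y ≈ y
      1-or-yes (yes p) q = refl
      1-or-yes (no  p) q = ⊥-elim (p q)

      1-or-no : ∀ {x y} (d : Dec (x ≈ 0#)) → ¬ (x ≈ 0#) → 1-or d y ≈ 1#
      1-or-no (yes p) q = ⊥-elim (q p)
      1-or-no (no  p) q = refl

      or-1-1-or : ∀ {x y} (d : Dec (x ≈ 0#)) → y ≈ or-1 d y * 1-or d y
      or-1-1-or (yes p) = sym (*-identityˡ _)
      or-1-1-or (no  p) = sym (*-identityʳ _)

      ∏-1 : ∀ {k} (f : Fin k → Carrier) → (∀ i → f i ≈ 1#) → ∏ f ≈ 1#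
      ∏-1 {zero}  f p = refl
      ∏-1 {suc k} f p = trans (*-cong (p zero) (∏-1 (λ i → f (suc i)) (λ i → p (suc i)))) (*-identityˡ 1#)

      -- Exactly one of the factors differs from 1#.
      ∏-1-or : ∀ {k} (g : Fin k → Carrier) → (∀ i j → i ≢ j → ¬ (g i ≈ g j)) → ∀ i₀ → g i₀ ≈ 0# → ∀ x → ∏ (λ i → 1-or (g i ≟ 0#) x) ≈ x
      ∏-1-or {suc k} g inj i₀ p x = begin
        ∏ (λ i → 1-or (g i ≟ 0#) x)                                               ≈⟨ ∏-remove {k} {i₀} (λ i → 1-or (g i ≟ 0#) x) ⟩
        1-or (g i₀ ≟ 0#) x * ∏ (λ i → 1-or (g (Fin.punchIn i₀ i) ≟ 0#) x)         ≈⟨ *-cong (1-or-yes (g i₀ ≟ 0#) p)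
                                                                                       (∏-1 (λ i → 1-or (g (Fin.punchIn i₀ i) ≟ 0#) x) λ i → 1-or-no (g (Fin.punchIn i₀ i) ≟ 0#)
                                                                                         λ r → inj _ i₀ (Finₚ.punchInᵢ≢i i₀ i) (trans r (sym p))) ⟩
        x * 1#                                                                    ≈⟨ *-identityʳ x ⟩
        x                                                                         ∎

    -- Multiplication by x permutes the nonzero elements.
    fermat-nonzero : ∀ x → ¬ (x ≈ 0#) → x ^ q ≈ x
    fermat-nonzero x x≉0 = begin
      x ^ q                                                        ≈⟨ ∏-replicate q ⟨
      ∏ {q} (λ _ → x)                                              ≈⟨ ∏-cong (λ i → or-1-1-or {from i} {x} (from i ≟ 0#)) ⟩
      ∏ (λ i → or-1 (from i ≟ 0#) x * 1-or (from i ≟ 0#) x)        ≈⟨ ∏-distrib-* (λ i → or-1 (from i ≟ 0#) x) (λ i → 1-or (from i ≟ 0#) x) ⟩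
      A * ∏ (λ i → 1-or (from i ≟ 0#) x)                           ≈⟨ *-cong A≈1 (∏-1-or from from-injective (to 0#) (strictlyInverseʳ 0#) x) ⟩
      1# * x                                                       ≈⟨ *-identityˡ x ⟩
      x                                                            ∎
      where
      x⁻¹ = proj₁ (inverseʳ x x≉0)
      x⁻¹x≈1 = proj₂ (inverseʳ x x≉0)
      -- `A` is x^(q-1), as the factor at the zero element is replaced by 1; `B` is the product of
      -- all nonzero elements and gets cancelled.
      A = ∏ (λ i → or-1 (from i ≟ 0#) x)
      B = ∏ (λ i → nonzero (from i))
      BA≈B : B * A ≈ B * 1#
      BA≈B = begin
        B * A                                                        ≈⟨ *-comm B A ⟩
        A * B                                                        ≈⟨ ∏-distrib-* (λ i → or-1 (from i ≟ 0#) x) (λ i → nonzero (from i)) ⟨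
        ∏ (λ i → or-1 (from i ≟ 0#) x * nonzero (from i))            ≈⟨ ∏-cong (λ i → or-1-* (x * from i ≟ 0#) (from i ≟ 0#) x≉0) ⟨
        ∏ (λ i → nonzero (x * from i))                               ≈⟨ ∏-reindex (x *_) (x⁻¹ *_) *-congˡ *-congˡ
                                                                          (λ y → trans (trans (sym (*-assoc x x⁻¹ y)) (*-congʳ (trans (*-comm x x⁻¹) x⁻¹x≈1))) (*-identityˡ y))
                                                                          (λ y → trans (trans (sym (*-assoc x⁻¹ x y)) (*-congʳ x⁻¹x≈1)) (*-identityˡ y))
                                                                          nonzero (λ {y} {z} y≈z → or-1-cong (y ≟ 0#) (z ≟ 0#) y≈z y≈z) ⟨
        B                                                            ≈⟨ *-identityʳ B ⟨
        B * 1#                                                       ∎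
      A≈1 : A ≈ 1#
      A≈1 = *-cancelˡ B A 1# (∏-≉0 (λ i → nonzero (from i)) (λ i → or-1-≉0 (from i ≟ 0#))) BA≈B

    -- The zero element has an index, so q is positive; this gives 0^q = 0 below.
    order-nonzero : ∃ λ k → q ≡ suc k
    order-nonzero = suc-pred (to 0#)
      where
      suc-pred : ∀ {k} → Fin k → ∃ λ j → k ≡ suc j
      suc-pred {suc k} i = k , ≡.refl

    fermat : ∀ x → x ^ q ≈ x
    fermat x with x ≟ 0# | order-nonzero
    ... | no  x≉0 | _ = fermat-nonzero x x≉0
    ... | yes x≈0 | k , ≡.refl = trans (*-congʳ x≈0) (trans (zeroˡ _) (sym x≈0))

    module _ (1<q : 1 ℕ.< q) where

      private module P = PolynomialRing K

      -- By Fermat all q elements are roots of X^q - X, as many as its degree.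
      fixedPolynomial-split : Degree.fixedPolynomial K q P.≋ P.product (λ i → Evaluation.X-_ K (from i))
      fixedPolynomial-split = Degree.Nontrivial.Domain.roots-split K 1≉0 integral q (Degree.fixedPolynomial K q) from
        (Degree.Leading-fixedPolynomial K q 1<q) from-injective
        (λ i → trans (Degree.eval-fixedPolynomial K q (from i)) (trans (+-congʳ (fermat (from i))) (-‿inverseʳ (from i))))

      -- Over the field extended by √x, the norm of ∏ (X - u) is ∏ (u² - x), and
      -- that of X^q - X vanishes.
      euler-criterion : ∀ t → q ≡ suc (2 ℕ.* t) → ∀ x → x ^ t ≈ 1# → ∃ λ u → u * u ≈ x
      euler-criterion t ≡.refl x xᵗ≈1 = let (i , p) = ∏-≈0 (λ i → N.norm (Evaluation.X-_ K (from i))) vanishing in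
        from i , x-y≈0⇒x≈y (from i * from i) x (trans (sym (N.norm-X- (from i))) p)
        where
        module N = SquareRootNorm K x
        vanishing : ∏ (λ i → N.norm (Evaluation.X-_ K (from i))) ≈ 0#
        vanishing = trans (sym (N.norm-product q (λ i → Evaluation.X-_ K (from i))))
          (trans (sym (N.norm-cong (Degree.fixedPolynomial K q) (P.product (λ i → Evaluation.X-_ K (from i))) fixedPolynomial-split)) (N.norm-fixedPolynomial t xᵗ≈1))

-- Additivity of the p-th power map in characteristic p.

module Frobenius {c ℓ} (K : CommutativeRing c ℓ) (p : ℕ) (p-prime : Prime p) where

  open import Data.Nat.Base using (_!)
  open import Data.Nat.Combinatorics using (_C_; nCn≡1; nCk≡n!/k![n-k]!; k![n∸k]!∣n!)

  open CommutativeRing K hiding (zero)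
  open import Algebra.Properties.Ring ring using ()
  open import Algebra.Properties.CommutativeSemiring.Exp commutativeSemiring
  open import Algebra.Properties.CommutativeSemiring.Binomial commutativeSemiring using (binomialTerm; theorem)
  open import Algebra.Properties.Semiring.Sum semiring using (sum; sum-init-last; sum-cong-≋; sum-replicate-zero)
  open import Algebra.Properties.Semiring.Mult semiring using (×-homo-1; ×1-homo-*; ×-congʳ; ×-assoc-*) renaming (_×_ to _·_)
  open import Relation.Binary.Reasoning.Setoid setoid

  private instance
    p≢0 = prime⇒nonZero p-prime

  p∤k! : ∀ k → k ℕ.< p → ¬ (p ∣ k !)
  p∤k! zero    k<p p∣1 = >⇒∤ (ℕ.nonTrivial⇒n>1 p {{prime⇒nonTrivial p-prime}}) p∣1
  p∤k! (suc k) k<p p∣  with euclidsLemma (suc k) (k !) p-prime p∣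
  ... | inj₁ q = >⇒∤ k<p q
  ... | inj₂ q = p∤k! k (ℕₚ.<-trans (ℕₚ.n<1+n k) k<p) q

  -- p divides p! = C(p,k) k! (p-k)! but neither of the two factorials, whose factors are all below
  -- p.
  p∣pCk : ∀ k → 0 ℕ.< k → k ℕ.< p → p ∣ p C k
  p∣pCk k 0<k k<p with euclidsLemma (p C k) (k ! ℕ.* (p ℕ.∸ k) !) p-prime p∣product
    where
    k≤p = ℕₚ.<⇒≤ k<p
    product≡p! : (p C k) ℕ.* (k ! ℕ.* (p ℕ.∸ k) !) ≡ p !
    product≡p! = ≡.trans (≡.cong (ℕ._* (k ! ℕ.* (p ℕ.∸ k) !)) (nCk≡n!/k![n-k]! k≤p)) (m/n*n≡m {{k ℕₚ.!* (p ℕ.∸ k) !≢0}} (k![n∸k]!∣n! k≤p))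
    p∣p! : ∀ n → .{{ℕ.NonZero n}} → n ∣ n !
    p∣p! (suc n) = ∣m⇒∣m*n (n !) ∣-refl
    p∣product : p ∣ (p C k) ℕ.* (k ! ℕ.* (p ℕ.∸ k) !)
    p∣product = ≡.subst (p ∣_) (≡.sym product≡p!) (p∣p! p)
  ... | inj₁ q = q
  ... | inj₂ q with euclidsLemma (k !) ((p ℕ.∸ k) !) p-prime q
  ...   | inj₁ r = ⊥-elim (p∤k! k k<p r)
  ...   | inj₂ r = ⊥-elim (p∤k! (p ℕ.∸ k) (ℕₚ.∸-monoʳ-< 0<k (ℕₚ.<⇒≤ k<p)) r)

  ^-·1 : ∀ e → (p ℕ.^ e) · 1# ≈ (p · 1#) ^ e
  ^-·1 zero    = ×-homo-1 1#
  ^-·1 (suc e) = trans (×1-homo-* p (p ℕ.^ e)) (*-congˡ (^-·1 e))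

  module _ (p·1≈0 : p · 1# ≈ 0#) where

    multiple·x≈0 : ∀ {n} x → p ∣ n → n · x ≈ 0#
    multiple·x≈0 x (divides c ≡.refl) = begin
      (c ℕ.* p) · x         ≈⟨ ×-congʳ (c ℕ.* p) (*-identityˡ x) ⟨
      (c ℕ.* p) · (1# * x)  ≈⟨ ×-assoc-* (c ℕ.* p) 1# x ⟨
      (c ℕ.* p) · 1# * x    ≈⟨ *-congʳ (×1-homo-* c p) ⟩
      c · 1# * (p · 1#) * x ≈⟨ *-congʳ (*-congˡ p·1≈0) ⟩
      c · 1# * 0# * x       ≈⟨ *-congʳ (zeroʳ _) ⟩
      0# * x                ≈⟨ zeroˡ x ⟩
      0#                    ∎

    ^p-+ : ∀ x y → (x + y) ^ p ≈ x ^ p + y ^ p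
    ^p-+ x y = expand p ≡.refl
      where
      -- The exponent is generalised to k so that matching on `suc k` can separate the first and the
      -- last binomial term.
      expand : ∀ k → k ≡ p → (x + y) ^ k ≈ x ^ k + y ^ k
      expand zero ≡.refl = ⊥-elim (ℕ.≢-nonZero⁻¹ 0 ≡.refl)
      expand (suc k) ≡.refl = begin
        (x + y) ^ suc k                                                     ≈⟨ theorem (suc k) x y ⟩
        term zero + sum (λ i → term (suc i))                                ≈⟨ +-congˡ (sum-init-last (λ i → term (suc i))) ⟩
        term zero + (sum (λ i → term (suc (inject₁ i))) + term (suc (fromℕ k)))
          ≈⟨ +-cong (trans (×-homo-1 _) (*-identityˡ _)) (+-cong (trans (sum-cong-≋ middle) (sum-replicate-zero k)) last) ⟩
        y ^ suc k + (0# + x ^ suc k)                                        ≈⟨ trans (+-congˡ (+-identityˡ _)) (+-comm _ _) ⟩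
        x ^ suc k + y ^ suc k                                               ∎
        where
        term = binomialTerm x y (suc k)
        middle : ∀ i → term (suc (inject₁ i)) ≈ 0#
        middle i = multiple·x≈0 _ (p∣pCk (suc (toℕ (inject₁ i))) (s≤s z≤n) (s≤s (≡.subst (ℕ._< k) (≡.sym (Finₚ.toℕ-inject₁ i)) (Finₚ.toℕ<n i))))
        last : term (suc (fromℕ k)) ≈ x ^ suc k
        last rewrite Finₚ.toℕ-fromℕ k | nCn≡1 (suc k) | ℕₚ.n∸n≡0 k = trans (×-homo-1 _) (*-identityʳ _)

    ^p^-+ : ∀ e x y → (x + y) ^ (p ℕ.^ e) ≈ x ^ (p ℕ.^ e) + y ^ (p ℕ.^ e)
    ^p^-+ zero    x y = trans (*-identityʳ _) (+-cong (sym (*-identityʳ x)) (sym (*-identityʳ y)))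
    ^p^-+ (suc e) x y = begin
      (x + y) ^ (p ℕ.* p ℕ.^ e)                        ≈⟨ ^-assocʳ (x + y) p (p ℕ.^ e) ⟨
      ((x + y) ^ p) ^ (p ℕ.^ e)                        ≈⟨ ^-congˡ (p ℕ.^ e) (^p-+ x y) ⟩
      (x ^ p + y ^ p) ^ (p ℕ.^ e)                      ≈⟨ ^p^-+ e (x ^ p) (y ^ p) ⟩
      (x ^ p) ^ (p ℕ.^ e) + (y ^ p) ^ (p ℕ.^ e)        ≈⟨ +-cong (^-assocʳ x p (p ℕ.^ e)) (^-assocʳ y p (p ℕ.^ e)) ⟩
      x ^ (p ℕ.* p ℕ.^ e) + y ^ (p ℕ.* p ℕ.^ e)        ∎

-- Polynomials under a homomorphism of coefficient rings.

module PolynomialMap {c ℓ c′ ℓ′} (R : CommutativeRing c ℓ) (S : CommutativeRing c′ ℓ′)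
  (ι : CommutativeRing.Carrier R → CommutativeRing.Carrier S)
  (ι-homomorphism : IsRingHomomorphism (CommutativeRing.rawRing R) (CommutativeRing.rawRing S) ι) where

  private
    module R = CommutativeRing R
    module P = PolynomialRing R
    module Q = PolynomialRing S
    module NR = SquareRootNorm R
    module NS = SquareRootNorm S
  open CommutativeRing S hiding (zero)
  open IsRingHomomorphism ι-homomorphism using (⟦⟧-cong; +-homo; *-homo; -‿homo; 0#-homo; 1#-homo) public
  open import Algebra.Properties.Semiring.Exp R.semiring using () renaming (_^_ to _^ᵣ_)
  open import Algebra.Properties.Semiring.Exp semiring using (_^_)
  open import Algebra.Properties.CommutativeMonoid.Sum *-commutativeMonoid using () renaming (sum to ∏)
  open import Relation.Binary.Reasoning.Setoid setoid

  ^-homo : ∀ x n → ι (x ^ᵣ n) ≈ ι x ^ n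
  ^-homo x zero    = 1#-homo
  ^-homo x (suc n) = trans (*-homo x (x ^ᵣ n)) (*-congˡ (^-homo x n))

  coeff-map : ∀ f i → Q.coeff (map ι f) i ≈ ι (P.coeff f i)
  coeff-map []      i       = sym 0#-homo
  coeff-map (b ∷ f) zero    = refl
  coeff-map (b ∷ f) (suc i) = coeff-map f i

  map-cong : ∀ {f g} → f P.≋ g → map ι f Q.≋ map ι g
  map-cong {f} {g} p = Q.mk λ i → trans (coeff-map f i) (trans (⟦⟧-cong (P.at p i)) (sym (coeff-map g i)))

  Leading-map : ∀ {D b} f → Degree.Leading R D b f → Degree.Leading S D (ι b) (map ι f)
  Leading-map {D} f (l , B) = trans (coeff-map f D) (⟦⟧-cong l) , λ i D<i → trans (coeff-map f i) (trans (⟦⟧-cong (B i D<i)) 0#-homo)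

  Monic-map : ∀ {D} f → P.MonicOfDegree D f → Q.MonicOfDegree D (map ι f)
  Monic-map f m = Degree.Leading-congˡ S (map ι f) 1#-homo (Leading-map f m)

  even-map : ∀ a f → NS.even (ι a) (map ι f) ≈ ι (NR.even a f)
  odd-map : ∀ a f → NS.odd (ι a) (map ι f) ≈ ι (NR.odd a f)
  even-map a []      = sym 0#-homo
  even-map a (b ∷ f) = sym (trans (+-homo b _) (+-congˡ (trans (*-homo a _) (*-congˡ (sym (odd-map a f))))))
  odd-map a []      = sym 0#-homo
  odd-map a (b ∷ f) = even-map a f

  norm-map : ∀ a f → NS.norm (ι a) (map ι f) ≈ ι (NR.norm a f)
  norm-map a f = sym (begin
    ι (NR.even a f R.* NR.even a f R.- a R.* (NR.odd a f R.* NR.odd a f))          ≈⟨ +-homo _ _ ⟩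
    ι (NR.even a f R.* NR.even a f) + ι (R.- (a R.* (NR.odd a f R.* NR.odd a f)))  ≈⟨ +-cong (*-homo _ _) (trans (-‿homo _) (-‿cong (trans (*-homo a _) (*-congˡ (*-homo _ _))))) ⟩
    ι (NR.even a f) * ι (NR.even a f) - ι a * (ι (NR.odd a f) * ι (NR.odd a f))
      ≈⟨ +-cong (*-cong (even-map a f) (even-map a f)) (-‿cong (*-congˡ (*-cong (odd-map a f) (odd-map a f)))) ⟨
    NS.norm (ι a) (map ι f)                                                         ∎)

  evalAt : P.Poly → Carrier → Carrier
  evalAt f x = Q.eval (map ι f) x

  evalAt-cong : ∀ {f g} x → f P.≋ g → evalAt f x ≈ evalAt g x
  evalAt-cong {f} {g} x p = Evaluation.eval-cong S (map ι f) (map ι g) x (map-cong p)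

  evalAt-congʳ : ∀ f {x y} → x ≈ y → evalAt f x ≈ evalAt f y
  evalAt-congʳ f = Evaluation.eval-congʳ S (map ι f)

  map-+ : ∀ f g → map ι (f P.+ₚ g) Q.≋ map ι f Q.+ₚ map ι g
  map-+ f g = Q.mk λ i → trans (coeff-map (f P.+ₚ g) i) (trans (⟦⟧-cong (P.coeff-+ f g i)) (trans (+-homo _ _)
    (sym (trans (Q.coeff-+ (map ι f) (map ι g) i) (+-cong (coeff-map f i) (coeff-map g i))))))

  map-scale : ∀ b f → map ι (P.scale b f) Q.≋ Q.scale (ι b) (map ι f)
  map-scale b f = Q.mk λ i → trans (coeff-map (P.scale b f) i) (trans (⟦⟧-cong (P.coeff-scale b f i)) (trans (*-homo _ _)
    (sym (trans (Q.coeff-scale (ι b) (map ι f) i) (*-congˡ (coeff-map f i))))))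

  map-* : ∀ f g → map ι (f P.*ₚ g) Q.≋ map ι f Q.*ₚ map ι g
  map-* []      g = Q.≋-refl
  map-* (b ∷ f) g = Q.≋-trans (map-+ (P.scale b g) (P.shift (f P.*ₚ g))) (Q.+ₚ-cong (map-scale b g) (Q.∷-cong 0#-homo (map-* f g)))

  evalAt-* : ∀ f g x → evalAt (f P.*ₚ g) x ≈ evalAt f x * evalAt g x
  evalAt-* f g x = trans (Evaluation.eval-cong S _ _ x (map-* f g)) (Evaluation.eval-* S (map ι f) (map ι g) x)

  evalAt-product : ∀ k (g : Fin k → P.Poly) x → evalAt (P.product g) x ≈ ∏ (λ i → evalAt (g i) x)
  evalAt-product zero    g x = trans (+-cong 1#-homo (zeroʳ x)) (+-identityʳ 1#)
  evalAt-product (suc k) g x = trans (evalAt-* (g zero) (P.product (λ i → g (suc i))) x) (*-congˡ (evalAt-product k (λ i → g (suc i)) x))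

  map-monomial : ∀ n → map ι (Evaluation.monomial R n) Q.≋ Evaluation.monomial S n
  map-monomial zero    = Q.∷-cong 1#-homo Q.≋-refl
  map-monomial (suc n) = Q.∷-cong 0#-homo (map-monomial n)

  module _ (a : R.Carrier) where
    private
      module RR = Reciprocal R a
      module RS = Reciprocal S (ι a)

    map-tail : ∀ f → map ι (RR.tail f) Q.≋ RS.tail (map ι f)
    map-tail []      = Q.≋-refl
    map-tail (b ∷ f) = Q.≋-refl

    map-reverse : ∀ N f → map ι (RR.reverse N f) Q.≋ RS.reverse N (map ι f)
    map-reverse zero    f = RS.const-cong (sym (coeff-map f 0))
    map-reverse (suc N) f = Q.≋-trans (map-+ (P.const (P.coeff f 0) P.*ₚ Evaluation.monomial R (suc N)) (P.const a P.*ₚ RR.reverse N (RR.tail f)))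
      (Q.+ₚ-cong
        (Q.≋-trans (map-* (P.const (P.coeff f 0)) (Evaluation.monomial R (suc N))) (Q.*ₚ-cong (RS.const-cong (sym (coeff-map f 0))) (map-monomial (suc N))))
        (Q.≋-trans (map-* (P.const a) (RR.reverse N (RR.tail f))) (Q.*ₚ-congʳ (Q.const (ι a)) (Q.≋-trans (map-reverse N (RR.tail f)) (RS.reverse-cong N (map-tail f))))))

    evalAt-reverse : ∀ N f x y → x * y ≈ ι a → Degree.Below R (suc N) f → evalAt (RR.reverse N f) x ≈ x ^ N * evalAt f y
    evalAt-reverse N f x y xy≈a B = trans (Evaluation.eval-cong S _ _ x (map-reverse N f))
      (RS.eval-reverse N (map ι f) x y xy≈a (λ i N<i → trans (coeff-map f i) (trans (⟦⟧-cong (B i N<i)) 0#-homo)))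

-- The finite field F[x]/(h).

module QuotientField {c ℓ} (F : CommutativeRing c ℓ) {q : ℕ} (finite : FiniteField.IsFiniteField F q)
  (h : PolynomialRing.Poly F) (N : ℕ) (h-monic : PolynomialRing.MonicOfDegree F N h) (h-irreducible : PolynomialRing.Irreducible F h) where

  open CommutativeRing F hiding (zero)
  open PolynomialRing F
  open FiniteField.IsFiniteField finite hiding (enumeration)
  open Degree F
  open Degree.Nontrivial F 1≉0
  open QuotientRing polynomialRing h public
  open IntegerCoefficients polynomialRing using () renaming (solve to solveₚ; _:=_ to _:=ₚ_; _:*_ to _:*ₚ_; _:-_ to _:-ₚ_; _:+_ to _:+ₚ_; :-_ to :-ₚ_)

  K : CommutativeRing _ _
  K = quotientRing
  private module K = CommutativeRing K

  const-homomorphism : IsRingHomomorphism rawRing K.rawRing const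
  const-homomorphism = record
    { isSemiringHomomorphism = record
      { isNearSemiringHomomorphism = record
        { +-isMonoidHomomorphism = record
          { isMagmaHomomorphism = record
            { isRelHomomorphism = record { cong = λ p → ≈⇒≡ₕ (∷-cong p ≋-refl) }
            ; homo = λ x y → K.refl
            }
          ; ε-homo = ≈⇒≡ₕ (shift-[] refl ≋-refl)
          }
        ; *-homo = λ x y → ≈⇒≡ₕ (≋-sym (const-*ₚ x (const y)))
        }
      ; 1#-homo = K.refl
      }
    ; -‿homo = λ x → K.refl
    }

  open PolynomialMap F K const const-homomorphism using (evalAt)

  -- The class of x plays the role of α: evaluating f there gives back the class of f. Hence α
  -- generates the quotient, and the polynomials vanishing at α are the multiples of h.
  evalAt-X : ∀ f → evalAt f X K.≈ f
  evalAt-X f = ≈⇒≡ₕ (go f)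
    where
    go : ∀ f → evalAt f X ≋ f
    go []      = ≋-refl
    go (b ∷ f) = ≋-trans (+ₚ-cong (≋-refl {const b}) (≋-trans (*ₚ-congʳ X (go f)) (X-*ₚ f))) (∷-cong (+-identityʳ b) ≋-refl)

  irreducible-positive : ∀ n → MonicOfDegree n h → 0 ℕ.< n
  irreducible-positive (suc n) m = s≤s z≤n
  irreducible-positive zero    m = ⊥-elim (Irreducible.p∤1 h-irreducible
    (const 1# , at (≋-trans (*ₚ-identityˡ h) (Leading-0⇒const h m))))

  ≡ₕ0⇒multiple : ∀ {f} → f ≡ₕ [] → ∃ λ u → f ≋ u *ₚ h
  ≡ₕ0⇒multiple (u by p) = u , p

  root⇒multiple : ∀ f → evalAt f X K.≈ K.0# → ∃ λ u → f ≋ u *ₚ h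
  root⇒multiple f eq = ≡ₕ0⇒multiple (K.trans (K.sym (evalAt-X f)) eq)

  h-root : evalAt h X K.≈ K.0#
  h-root = K.trans (evalAt-X h) (K.trans (≈⇒≡ₕ (≋-sym (*ₚ-identityˡ h))) (≡ₕ0 (const 1#)))

  h-positive : 0 ℕ.< N
  h-positive = irreducible-positive N h-monic

  -- The difference is a multiple of h of degree below N, hence zero; this is the uniqueness of
  -- remainders.
  ≡ₕ-Below : ∀ f g → Below N f → Below N g → f ≡ₕ g → f ≋ g
  ≡ₕ-Below f g B C (m by p) = ≋-trans p (≋-trans (+ₚ-cong (≋-refl {g}) ([]-*ₚ h m≋[])) (+ₚ-identityʳ g))
    where
    m≋[] : m ≋ []
    m≋[] = monic-multiple-Below m h h-monic (Below-cong (≋-trans (+ₚ-cong p (≋-refl { -ₚ g})) (solveₚ 3 (λ g m h → (g :+ₚ m :*ₚ h) :-ₚ g :=ₚ m :*ₚ h) ≋-refl g m h))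
      (Below-+ f (-ₚ g) B (Below-neg g C)))

  const-Below : ∀ b → Below N (const b)
  const-Below b (suc i) N≤i = refl
  const-Below b zero N≤0 = ⊥-elim (ℕₚ.<⇒≱ h-positive N≤0)

  const-injective : ∀ {b d} → const b K.≈ const d → b ≈ d
  const-injective {b} {d} p = at (≡ₕ-Below (const b) (const d) (const-Below b) (const-Below d) p) 0

  private
    -- Euclid's algorithm with h, by induction on the degree bound M: f is made monic and h is
    -- divided by it. A zero remainder makes f a divisor of the irreducible h; otherwise the
    -- remainder is invertible by induction, and so is f.
    small-0-or-unit : ∀ M → M ℕ.≤ N → ∀ f → Below M f → f ≋ [] ⊎ ∃ λ u → u *ₚ f ≡ₕ const 1#
    small-0-or-unit zero    M≤N f B = inj₁ (Below-0 B)
    small-0-or-unit (suc M) M<N f B with 0-or-unit (coeff f M)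
    ... | inj₁ c≈0 = small-0-or-unit M (ℕₚ.<⇒≤ M<N) f λ i M≤i → below i (ℕₚ.m≤n⇒m<n∨m≡n M≤i)
      where
      below : ∀ i → M ℕ.< i ⊎ M ≡ i → coeff f i ≈ 0#
      below i (inj₁ M<i)   = B i M<i
      below i (inj₂ ≡.refl) = c≈0
    ... | inj₂ (d , dc≈1) = normalised (divide g g-monic h)
      where
      g = scale d f
      g-monic : MonicOfDegree M g
      g-monic = Leading-congˡ g dc≈1 (Leading-scale d f (refl , B))
      unscale : ∀ u → u *ₚ g ≡ₕ const 1# → ∃ λ u → u *ₚ f ≡ₕ const 1#
      unscale u p = u *ₚ const d , K.trans (≈⇒≡ₕ (≋-trans (*ₚ-assoc u (const d) f) (*ₚ-congʳ u (const-*ₚ d f)))) p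
      normalised : ∃₂ (λ s r → h ≋ s *ₚ g +ₚ r × Below M r) → f ≋ [] ⊎ ∃ λ u → u *ₚ f ≡ₕ const 1#
      normalised (s , r , h≋ , C) with small-0-or-unit M (ℕₚ.<⇒≤ M<N) r C
      ... | inj₁ r≋[] = inj₂ (split (Irreducible.split-∣1 h-irreducible {s} {g} (at h≋sg)))
        where
        h≋sg : h ≋ s *ₚ g
        h≋sg = ≋-trans h≋ (≋-trans (+ₚ-cong (≋-refl {s *ₚ g}) r≋[]) (+ₚ-identityʳ (s *ₚ g)))
        split : _ → ∃ λ u → u *ₚ f ≡ₕ const 1#
        split (inj₂ (v , vg≈1)) = unscale v (≈⇒≡ₕ (mk vg≈1))
        -- Were the cofactor s a unit, h would divide g, whose degree M is below N.
        split (inj₁ (v , vs≈1)) = ⊥-elim (1≉0 (trans (sym (proj₁ g-monic)) (at g≋[] M)))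
          where
          vh≋g : v *ₚ h ≋ g
          vh≋g = ≋-trans (*ₚ-congʳ v h≋sg) (≋-trans (≋-sym (*ₚ-assoc v s g)) (≋-trans (*ₚ-congˡ {v *ₚ s} {const 1#} g (mk vs≈1)) (*ₚ-identityˡ g)))
          v≋[] : v ≋ []
          v≋[] = monic-multiple-Below v h h-monic (Below-cong (≋-sym vh≋g) (Below-mono {f = g} M<N (proj₂ g-monic)))
          g≋[] : g ≋ []
          g≋[] = ≋-trans (≋-sym vh≋g) ([]-*ₚ h v≋[])
      -- Modulo h the remainder r is -s g, so an inverse w of r yields the inverse -w s of g.
      ... | inj₂ (w , wr≡1) = inj₂ (unscale (-ₚ (w *ₚ s)) (K.trans ((-ₚ w) by
              ≋-trans (solveₚ 4 (λ w s g r → :-ₚ (w :*ₚ s) :*ₚ g :=ₚ w :*ₚ r :+ₚ :-ₚ w :*ₚ (s :*ₚ g :+ₚ r)) ≋-refl w s g r)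
                (+ₚ-cong (≋-refl {w *ₚ r}) (*ₚ-congʳ (-ₚ w) (≋-sym h≋)))) wr≡1))

  abstract
    reduce : ∀ f → ∃₂ λ s r → f ≋ s *ₚ h +ₚ r × Below N r
    reduce f = divide h h-monic f

  remainder : Poly → Poly
  remainder f = proj₁ (proj₂ (reduce f))

  remainder-Below : ∀ f → Below N (remainder f)
  remainder-Below f = proj₂ (proj₂ (proj₂ (reduce f)))

  remainder-≡ₕ : ∀ f → f ≡ₕ remainder f
  remainder-≡ₕ f = let (s , r , p , _) = reduce f in s by ≋-trans p (+ₚ-comm (s *ₚ h) r)

  0-or-unitₕ : ∀ f → f ≡ₕ [] ⊎ ∃ λ u → u *ₚ f ≡ₕ const 1#
  0-or-unitₕ f with small-0-or-unit N ℕₚ.≤-refl (remainder f) (remainder-Below f)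
  ... | inj₁ r≋[] = inj₁ (K.trans (remainder-≡ₕ f) (≈⇒≡ₕ r≋[]))
  ... | inj₂ (u , p) = inj₂ (u , K.trans (K.*-cong (K.refl {u}) (remainder-≡ₕ f)) p)

  funToFin-cong : ∀ {m n} {f g : Fin m → Fin n} → (∀ i → f i ≡ g i) → funToFin f ≡ funToFin g
  funToFin-cong {zero}  p = ≡.refl
  funToFin-cong {suc m} p = ≡.cong₂ Fin.combine (p zero) (funToFin-cong (λ i → p (suc i)))

  coeff-tabulate : ∀ {n} (g : Fin n → Carrier) i → coeff (tabulate g) (toℕ i) ≈ g i
  coeff-tabulate g zero    = refl
  coeff-tabulate g (suc i) = coeff-tabulate (λ i → g (suc i)) i

  tabulate-Below : ∀ {n} (g : Fin n → Carrier) → Below n (tabulate g)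
  tabulate-Below {zero}  g i       n≤i       = refl
  tabulate-Below {suc n} g (suc i) (s≤s n≤i) = tabulate-Below (λ i → g (suc i)) i n≤i

  Below-≋ : ∀ {n} f g → Below n f → Below n g → (∀ (i : Fin n) → coeff f (toℕ i) ≈ coeff g (toℕ i)) → f ≋ g
  Below-≋ {n} f g B C p = mk λ i → go i (ℕₚ.<-≤-connex i n)
    where
    go : ∀ i → i ℕ.< n ⊎ n ℕ.≤ i → coeff f i ≈ coeff g i
    go i (inj₁ i<n) = ≡.subst (λ i → coeff f i ≈ coeff g i) (Finₚ.toℕ-fromℕ< i<n) (p (Fin.fromℕ< i<n))
    go i (inj₂ n≤i) = trans (B i n≤i) (sym (C i n≤i))

  -- A residue class is coded by the N coefficients of its remainder, a function from `Fin N` to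
  -- `Fin q`; this gives the count q^N.
  code : Poly → Fin (q ℕ.^ N)
  code f = funToFin (λ (i : Fin N) → to (coeff (remainder f) (toℕ i)))

  decode : Fin (q ℕ.^ N) → Poly
  decode k = tabulate (λ (i : Fin N) → from (finToFun k i))

  remainder-unique : ∀ f g → Below N g → f ≡ₕ g → remainder f ≋ g
  remainder-unique f g B p = ≡ₕ-Below (remainder f) g (remainder-Below f) B (K.trans (K.sym (remainder-≡ₕ f)) p)

  code-cong : ∀ {f g} → f ≡ₕ g → code f ≡ code g
  code-cong {f} {g} p = funToFin-cong {N} λ i → to-cong (at (remainder-unique f (remainder g) (remainder-Below g) (K.trans p (remainder-≡ₕ g))) (toℕ i))

  code-decode : ∀ k → code (decode k) ≡ k
  code-decode k = ≡.trans (funToFin-cong {N} λ i → ≡.trans (to-cong (trans (at (remainder-unique (decode k) (decode k) (tabulate-Below _) K.refl) (toℕ i))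
      (coeff-tabulate (λ (i : Fin N) → from (finToFun k i)) i))) (strictlyInverseˡ _)) (Finₚ.funToFin-finToFin {N} {q} k)

  decode-code : ∀ f → decode (code f) ≡ₕ f
  decode-code f = K.trans (≈⇒≡ₕ (Below-≋ (decode (code f)) (remainder f) (tabulate-Below _) (remainder-Below f) λ i →
      trans (coeff-tabulate (λ (i : Fin N) → from (finToFun (code f) i)) i) (trans (reflexive (≡.cong from (Finₚ.finToFun-funToFin (λ (i : Fin N) → to (coeff (remainder f) (toℕ i))) i))) (strictlyInverseʳ _))))
    (K.sym (remainder-≡ₕ f))

  enumeration : Inverse K.setoid (≡ₚ.setoid (Fin (q ℕ.^ N)))
  enumeration = record
    { to = code ; from = decode ; to-cong = code-cong ; from-cong = λ { ≡.refl → K.refl }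
    ; inverse = (λ { {k} p → ≡.trans (code-cong p) (code-decode k) }) , (λ { {f} ≡.refl → decode-code f }) }

  finiteₕ : FiniteField.IsFiniteField K (q ℕ.^ N)
  finiteₕ = record
    { 1≉0 = λ p → 1≉0 (at (≡ₕ-Below (const 1#) [] (const-Below 1#) (λ i _ → refl) p) 0)
    ; enumeration = enumeration
    ; 0-or-unit = 0-or-unitₕ
    }

-- Frobenius conjugates of a root and their products.

module Conjugates {c ℓ c′ ℓ′} (F : CommutativeRing c ℓ) (K : CommutativeRing c′ ℓ′)
  (ι : CommutativeRing.Carrier F → CommutativeRing.Carrier K)
  (ι-homomorphism : IsRingHomomorphism (CommutativeRing.rawRing F) (CommutativeRing.rawRing K) ι)
  (ι-injective : ∀ {x y} → CommutativeRing._≈_ K (ι x) (ι y) → CommutativeRing._≈_ F x y)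
  (p e : ℕ) (p-prime : Prime p) (1<q : 1 ℕ.< p ℕ.^ e)
  (finiteF : FiniteField.IsFiniteField F (p ℕ.^ e))
  (N : ℕ) (0<N : 0 ℕ.< N) (finiteK : FiniteField.IsFiniteField K ((p ℕ.^ e) ℕ.^ N))
  (α : CommutativeRing.Carrier K)
  (generates : ∀ y → ∃ λ f → CommutativeRing._≈_ K (PolynomialMap.evalAt F K ι ι-homomorphism f α) y)
  (h : PolynomialRing.Poly F) (h-monic : PolynomialRing.MonicOfDegree F N h)
  (hα≈0 : CommutativeRing._≈_ K (PolynomialMap.evalAt F K ι ι-homomorphism h α) (CommutativeRing.0# K))
  where

  private
    q = p ℕ.^ e
    module F = CommutativeRing F
    module P = PolynomialRing F
    module Q = PolynomialRing K
    module Fr = Frobenius K p p-prime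
  open CommutativeRing K hiding (zero)
  open FiniteField.IsFiniteField finiteK
  open PolynomialMap F K ι ι-homomorphism
  open Evaluation K using (X-_; eval-X-)
  open IntegerCoefficients K using (solve; _:=_; con; _:+_; _:*_; _:-_; :-_)
  open import Algebra.Properties.Ring ring using (-0#≈0#; +-inverseʳ-unique) renaming (x∙y⁻¹≈ε⇒x≈y to x-y≈0⇒x≈y; x≈y⇒x∙y⁻¹≈ε to x≈y⇒x-y≈0)
  open import Algebra.Properties.CommutativeSemiring.Exp commutativeSemiring
  open import Algebra.Properties.Semiring.Exp F.semiring using () renaming (_^_ to _^ᶠ_)
  open import Algebra.Properties.CommutativeMonoid.Sum *-commutativeMonoid using () renaming (sum to ∏; sum-cong-≋ to ∏-cong)
  open import Algebra.Properties.Semiring.Mult semiring using (×-congˡ) renaming (_×_ to _·_)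
  open import Relation.Binary.Reasoning.Setoid setoid

  -- The field has p^(eN) elements, so (p · 1)^(eN) = 0, and no power of a nonzero element vanishes.
  p·1≈0 : p · 1# ≈ 0#
  p·1≈0 with p · 1# ≟ 0#
  ... | yes eq  = eq
  ... | no  neq = ⊥-elim (^-≉0 (e ℕ.* N) neq (begin
    (p · 1#) ^ (e ℕ.* N)      ≈⟨ Fr.^-·1 (e ℕ.* N) ⟨
    (p ℕ.^ (e ℕ.* N)) · 1#    ≈⟨ ×-congˡ {1#} (≡.sym (ℕₚ.^-*-assoc p e N)) ⟩
    (q ℕ.^ N) · 1#            ≈⟨ order·1≈0 ⟩
    0#                        ∎))

  φ : Carrier → Carrier
  φ y = y ^ q

  φ-+ : ∀ x y → φ (x + y) ≈ φ x + φ y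
  φ-+ = Fr.^p^-+ p·1≈0 e

  φ-ι : ∀ b → φ (ι b) ≈ ι b
  φ-ι b = trans (sym (^-homo b q)) (⟦⟧-cong (FiniteField.IsFiniteField.fermat finiteF b))

  frob : ℕ → Carrier → Carrier
  frob zero    y = y
  frob (suc i) y = φ (frob i y)

  frob-cong : ∀ i {x y} → x ≈ y → frob i x ≈ frob i y
  frob-cong zero    p = p
  frob-cong (suc i) p = ^-congˡ q (frob-cong i p)

  frob-+ : ∀ i x y → frob i (x + y) ≈ frob i x + frob i y
  frob-+ zero    x y = refl
  frob-+ (suc i) x y = trans (^-congˡ q (frob-+ i x y)) (φ-+ _ _)

  frob-* : ∀ i x y → frob i (x * y) ≈ frob i x * frob i y
  frob-* zero    x y = refl
  frob-* (suc i) x y = trans (^-congˡ q (frob-* i x y)) (^-distrib-* _ _ q)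

  frob-ι : ∀ i b → frob i (ι b) ≈ ι b
  frob-ι zero    b = refl
  frob-ι (suc i) b = trans (^-congˡ q (frob-ι i b)) (φ-ι b)

  frob-0# : ∀ i → frob i 0# ≈ 0#
  frob-0# i = trans (frob-cong i (sym 0#-homo)) (trans (frob-ι i F.0#) 0#-homo)

  frob-1# : ∀ i → frob i 1# ≈ 1#
  frob-1# i = trans (frob-cong i (sym 1#-homo)) (trans (frob-ι i F.1#) 1#-homo)

  frob-neg : ∀ i x → frob i (- x) ≈ - frob i x
  frob-neg i x = +-inverseʳ-unique (frob i x) (frob i (- x)) (trans (sym (frob-+ i x (- x))) (trans (frob-cong i (-‿inverseʳ x)) (frob-0# i)))

  frob-frob : ∀ i j x → frob i (frob j x) ≈ frob (i ℕ.+ j) x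
  frob-frob zero    j x = refl
  frob-frob (suc i) j x = ^-congˡ q (frob-frob i j x)

  frob-evalAt : ∀ i f x → frob i (evalAt f x) ≈ evalAt f (frob i x)
  frob-evalAt i []      x = frob-0# i
  frob-evalAt i (b ∷ f) x = trans (frob-+ i _ _) (+-cong (frob-ι i b) (trans (frob-* i _ _) (*-congˡ (frob-evalAt i f x))))

  frob-^ : ∀ i x → frob i x ≈ x ^ (q ℕ.^ i)
  frob-^ zero    x = sym (*-identityʳ x)
  frob-^ (suc i) x = trans (^-congˡ q (frob-^ i x)) (trans (^-assocʳ x (q ℕ.^ i) q) (^-congʳ x (ℕₚ.*-comm (q ℕ.^ i) q)))

  frob-N : ∀ x → frob N x ≈ x
  frob-N x = trans (frob-^ N x) (fermat x)

  frob-≉0 : ∀ i {x} → ¬ (x ≈ 0#) → ¬ (frob i x ≈ 0#)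
  frob-≉0 i {x} x≉0 eq = ^-≉0 (q ℕ.^ i) x≉0 (trans (sym (frob-^ i x)) eq)

  frob-injective : ∀ i x y → frob i x ≈ frob i y → x ≈ y
  frob-injective i x y eq with x - y ≟ 0#
  ... | yes z = x-y≈0⇒x≈y x y z
  ... | no  z = ⊥-elim (frob-≉0 i z (begin
    frob i (x - y)           ≈⟨ frob-+ i x (- y) ⟩
    frob i x + frob i (- y)  ≈⟨ +-congˡ (frob-neg i y) ⟩
    frob i x - frob i y      ≈⟨ x≈y⇒x-y≈0 eq ⟩
    0#                       ∎))

  1<q^ : ∀ i → 0 ℕ.< i → 1 ℕ.< q ℕ.^ i
  1<q^ (suc i) _ = ℕₚ.≤-trans 1<q (ℕₚ.m≤m*n q (q ℕ.^ i) {{ℕₚ.m^n≢0 q i {{ℕ.>-nonZero (ℕₚ.<-trans (s≤s z≤n) 1<q)}}}})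

  -- Otherwise frob i would fix all q^N elements, more than the roots of X^(q^i) - X.
  α-not-fixed : ∀ i → 0 ℕ.< i → i ℕ.< N → ¬ (frob i α ≈ α)
  α-not-fixed i 0<i i<N fixed = ℕₚ.<⇒≱ (ℕₚ.^-monoʳ-< q 1<q i<N)
    (Degree.Nontrivial.Domain.roots-≤-degree K 1≉0 integral (q ℕ.^ N) (Degree.fixedPolynomial K (q ℕ.^ i)) from
      (Degree.Leading-fixedPolynomial K (q ℕ.^ i) (1<q^ i 0<i)) from-injective
      λ k → trans (Degree.eval-fixedPolynomial K (q ℕ.^ i) (from k)) (x≈y⇒x-y≈0 (trans (sym (frob-^ i (from k))) (all-fixed (from k)))))
    where
    -- Every y is f(α) for some f over F, and `frob i` fixes the coefficients of f.
    all-fixed : ∀ y → frob i y ≈ y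
    all-fixed y = let (f , fα≈y) = generates y in begin
      frob i y             ≈⟨ frob-cong i fα≈y ⟨
      frob i (evalAt f α)  ≈⟨ frob-evalAt i f α ⟩
      evalAt f (frob i α)  ≈⟨ evalAt-congʳ f fixed ⟩
      evalAt f α           ≈⟨ fα≈y ⟩
      y                    ∎

  -- `frob i` is injective, so a coincidence would make α fixed by the shorter iterate
  -- `frob (j ℕ.∸ i)`.
  conjugates-<-distinct : ∀ i j → i ℕ.< j → j ℕ.< N → ¬ (frob i α ≈ frob j α)
  conjugates-<-distinct i j i<j j<N eq = α-not-fixed (j ℕ.∸ i) (ℕₚ.m<n⇒0<n∸m i<j) (ℕₚ.≤-<-trans (ℕₚ.m∸n≤m j i) j<N)
    (sym (frob-injective i α (frob (j ℕ.∸ i) α) (trans eq (trans (reflexive (≡.cong (λ k → frob k α) (≡.sym (ℕₚ.m+[n∸m]≡n (ℕₚ.<⇒≤ i<j))))) (sym (frob-frob i (j ℕ.∸ i) α))))))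

  conjugate : Fin N → Carrier
  conjugate i = frob (toℕ i) α

  conjugates-distinct : ∀ i j → i ≢ j → ¬ (conjugate i ≈ conjugate j)
  conjugates-distinct i j i≢j eq with ℕₚ.<-cmp (toℕ i) (toℕ j)
  ... | tri< i<j _ _ = conjugates-<-distinct (toℕ i) (toℕ j) i<j (Finₚ.toℕ<n j) eq
  ... | tri≈ _ i≡j _ = i≢j (Finₚ.toℕ-injective i≡j)
  ... | tri> _ _ j<i = conjugates-<-distinct (toℕ j) (toℕ i) j<i (Finₚ.toℕ<n i) (sym eq)

  -- Frobenius fixes the coefficients of h, so the N conjugates are roots, and being distinct they
  -- exhaust the degree.
  h-split : map ι h Q.≋ Q.product (λ i → X- conjugate i)
  h-split = Degree.Nontrivial.Domain.roots-split K 1≉0 integral N (map ι h) conjugate (Monic-map h h-monic) conjugates-distinct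
    λ i → trans (sym (frob-evalAt (toℕ i) h α)) (trans (frob-cong (toℕ i) hα≈0) (frob-0# (toℕ i)))

  -- T k u = u · φ u ⋯ φᵏ⁻¹ u; for k = N this is the norm of u from K to F.
  T : ℕ → Carrier → Carrier
  T zero    u = 1#
  T (suc k) u = u * φ (T k u)

  T-cong : ∀ k {u v} → u ≈ v → T k u ≈ T k v
  T-cong zero    p = refl
  T-cong (suc k) p = *-cong p (^-congˡ q (T-cong k p))

  T-* : ∀ k u v → T k (u * v) ≈ T k u * T k v
  T-* zero    u v = sym (*-identityˡ 1#)
  T-* (suc k) u v = trans (*-congˡ (trans (^-congˡ q (T-* k u v)) (^-distrib-* _ _ q)))
    (solve 4 (λ u v s t → u :* v :* (s :* t) := u :* s :* (v :* t)) refl u v _ _)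

  T-frob : ∀ i k u → T k (frob i u) ≈ frob i (T k u)
  T-frob i zero    u = sym (frob-1# i)
  T-frob i (suc k) u = trans (*-congˡ (trans (^-congˡ q (T-frob i k u)) (trans (frob-frob 1 i _) (trans (reflexive (≡.cong (λ j → frob j (T k u)) (ℕₚ.+-comm 1 i))) (sym (frob-frob i 1 _))))))
    (sym (frob-* i u (φ (T k u))))

  T-+ : ∀ m k u → T (m ℕ.+ k) u ≈ T m u * frob m (T k u)
  T-+ zero    k u = sym (*-identityˡ _)
  T-+ (suc m) k u = trans (*-congˡ (trans (^-congˡ q (T-+ m k u)) (^-distrib-* _ _ q))) (sym (*-assoc _ _ _))

  T-ι : ∀ k b → T k (ι b) ≈ ι b ^ k
  T-ι zero    b = refl
  T-ι (suc k) b = *-congˡ (trans (^-congˡ q (trans (T-ι k b) (sym (^-homo b k)))) (trans (φ-ι (b ^ᶠ k)) (^-homo b k)))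

  T-≉0 : ∀ k {u} → ¬ (u ≈ 0#) → ¬ (T k u ≈ 0#)
  T-≉0 zero    u≉0 = 1≉0
  T-≉0 (suc k) u≉0 = *-≉0 u≉0 (frob-≉0 1 (T-≉0 k u≉0))

  -- Pairs the factor φ^i u with φ^(i+m) u; used when α and a/α are conjugates at distance m.
  T-double : ∀ m u → T (m ℕ.+ m) u ≈ T m (u * frob m u)
  T-double m u = trans (T-+ m m u) (trans (*-congˡ (sym (T-frob m m u))) (sym (T-* m u (frob m u))))

  φ-∏ : ∀ k (g : Fin k → Carrier) → ∏ (λ i → φ (g i)) ≈ φ (∏ g)
  φ-∏ zero    g = sym (frob-1# 1)
  φ-∏ (suc k) g = trans (*-congˡ (φ-∏ k (λ i → g (suc i)))) (sym (^-distrib-* _ _ q))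

  ∏-frob : ∀ k u → ∏ (λ (i : Fin k) → frob (toℕ i) u) ≈ T k u
  ∏-frob zero    u = refl
  ∏-frob (suc k) u = *-congˡ (trans (φ-∏ k (λ i → frob (toℕ i) u)) (^-congˡ q (∏-frob k u)))

  eval-0# : ∀ f → Q.eval f 0# ≈ Q.coeff f 0
  eval-0# []      = refl
  eval-0# (b ∷ f) = trans (+-congˡ (zeroˡ _)) (+-identityʳ b)

  eval-h : ∀ x → evalAt h x ≈ ∏ (λ i → x - conjugate i)
  eval-h x = trans (Evaluation.eval-cong K (map ι h) (Q.product (λ i → X- conjugate i)) x h-split)
    (trans (Evaluation.eval-product K N (λ i → X- conjugate i) x) (∏-cong λ i → eval-X- (conjugate i) x))

  constant-term : ι (P.coeff h 0) ≈ T N (- α)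
  constant-term = begin
    ι (P.coeff h 0)                ≈⟨ coeff-map h 0 ⟨
    Q.coeff (map ι h) 0            ≈⟨ eval-0# (map ι h) ⟨
    evalAt h 0#                    ≈⟨ eval-h 0# ⟩
    ∏ (λ i → 0# - conjugate i)     ≈⟨ ∏-cong {N} (λ i → trans (+-identityˡ _) (sym (frob-neg (toℕ i) α))) ⟩
    ∏ (λ (i : Fin N) → frob (toℕ i) (- α))    ≈⟨ ∏-frob N (- α) ⟩
    T N (- α)                      ∎

  -- Each linear factor X - u of h has norm u² - a, and u runs over the conjugates of α.
  norm-T : ∀ a → ι (SquareRootNorm.norm F a h) ≈ T N (α * α - ι a)
  norm-T a = begin
    ι (SquareRootNorm.norm F a h)                      ≈⟨ norm-map a h ⟨
    Norm.norm (map ι h)                                ≈⟨ Norm.norm-cong (map ι h) (Q.product (λ i → X- conjugate i)) h-split ⟩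
    Norm.norm (Q.product (λ i → X- conjugate i))       ≈⟨ Norm.norm-product N (λ i → X- conjugate i) ⟩
    ∏ (λ i → Norm.norm (X- conjugate i))               ≈⟨ ∏-cong {N} (λ i → trans (Norm.norm-X- (conjugate i)) (sym (trans (frob-+ (toℕ i) _ _)
                                                            (+-cong (frob-* (toℕ i) α α) (trans (frob-neg (toℕ i) (ι a)) (-‿cong (frob-ι (toℕ i) a))))))) ⟩
    ∏ (λ (i : Fin N) → frob (toℕ i) (α * α - ι a))     ≈⟨ ∏-frob N (α * α - ι a) ⟩
    T N (α * α - ι a)                                  ∎
    where module Norm = SquareRootNorm K (ι a)

  -- The partner root a/α.

  module Partner (a : F.Carrier) (a≉0 : ¬ (a F.≈ F.0#)) (2≉0 : ¬ (1# + 1# ≈ 0#)) (h₀≉0 : ¬ (P.coeff h 0 F.≈ F.0#)) where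

    open Reciprocal F a using (reverse)

    α≉0 : ¬ (α ≈ 0#)
    α≉0 eq = h₀≉0 (ι-injective (begin
      ι (P.coeff h 0)         ≈⟨ coeff-map h 0 ⟨
      Q.coeff (map ι h) 0     ≈⟨ eval-0# (map ι h) ⟨
      evalAt h 0#             ≈⟨ evalAt-congʳ h eq ⟨
      evalAt h α              ≈⟨ hα≈0 ⟩
      0#                      ≈⟨ 0#-homo ⟨
      ι F.0#                  ∎))

    β : Carrier
    β = ι a * proj₁ (inverseʳ α α≉0)

    αβ≈a : α * β ≈ ι a
    αβ≈a = begin
      α * (ι a * α⁻¹)   ≈⟨ solve 3 (λ x y z → x :* (y :* z) := y :* (z :* x)) refl α (ι a) α⁻¹ ⟩
      ι a * (α⁻¹ * α)   ≈⟨ *-congˡ (proj₂ (inverseʳ α α≉0)) ⟩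
      ι a * 1#          ≈⟨ *-identityʳ (ι a) ⟩
      ι a               ∎
      where α⁻¹ = proj₁ (inverseʳ α α≉0)

    reverse-root : ∀ M f → Degree.Below F (suc M) f → evalAt f β ≈ 0# → evalAt (reverse M f) α ≈ 0#
    reverse-root M f B fβ≈0 = trans (evalAt-reverse a M f α β αβ≈a B) (trans (*-congˡ fβ≈0) (zeroʳ (α ^ M)))

    evalAt-const-* : ∀ b f x → evalAt (P.const b P.*ₚ f) x ≈ ι b * evalAt f x
    evalAt-const-* b f x = trans (evalAt-* (P.const b) f x) (*-congʳ (trans (+-congˡ (zeroʳ x)) (+-identityʳ (ι b))))

    partner-root : ∀ M f b → Degree.Below F (suc M) f → reverse M f P.≋ P.const b P.*ₚ f → evalAt f α ≈ 0# → evalAt f β ≈ 0#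
    partner-root M f b B rev fα≈0 = fromInj₂ (λ z → ⊥-elim (^-≉0 M α≉0 z)) (integral (α ^ M) (evalAt f β) (begin
      α ^ M * evalAt f β                  ≈⟨ evalAt-reverse a M f α β αβ≈a B ⟨
      evalAt (reverse M f) α              ≈⟨ evalAt-cong α rev ⟩
      evalAt (P.const b P.*ₚ f) α         ≈⟨ evalAt-const-* b f α ⟩
      ι b * evalAt f α                    ≈⟨ *-congˡ fα≈0 ⟩
      ι b * 0#                            ≈⟨ zeroʳ (ι b) ⟩
      0#                                  ∎))

    ιa≉0 : ¬ (ι a ≈ 0#)
    ιa≉0 eq = a≉0 (ι-injective (trans eq (sym 0#-homo)))

    -x≈x⇒x≈0 : ∀ {x} → - x ≈ x → x ≈ 0#
    -x≈x⇒x≈0 {x} eq = fromInj₂ (λ z → ⊥-elim (2≉0 z)) (integral (1# + 1#) x (begin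
      (1# + 1#) * x  ≈⟨ solve 1 (λ x → (con (+ 1) :+ con (+ 1)) :* x := x :- :- x) refl x ⟩
      x - (- x)      ≈⟨ +-congˡ (-‿cong eq) ⟩
      x - x          ≈⟨ -‿inverseʳ x ⟩
      0#             ∎))

    norm-≉0 : ¬ (α * α ≈ ι a) → ¬ (SquareRootNorm.norm F a h F.≈ F.0#)
    norm-≉0 α²≉a eq = T-≉0 N (λ z → α²≉a (x-y≈0⇒x≈y (α * α) (ι a) z)) (trans (sym (norm-T a)) (trans (⟦⟧-cong eq) 0#-homo))

    -- If a / α is again a root of h, it is the conjugate of α halfway round the
    -- Frobenius orbit, unless α = ±√a.
    halfway : evalAt h β ≈ 0# → ¬ (α * α ≈ ι a) → ∃ λ m → N ≡ m ℕ.+ m × α * frob m α ≈ ι a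
    halfway hβ≈0 α²≉a = let (k , βk) = ∏-≈0 (λ i → β - conjugate i) (trans (sym (eval-h β)) hβ≈0) in
      go (toℕ k) (Finₚ.toℕ<n k) (trans (*-congˡ (sym (x-y≈0⇒x≈y β (conjugate k) βk))) αβ≈a)
      where
      go : ∀ k → k ℕ.< N → α * frob k α ≈ ι a → ∃ λ m → N ≡ m ℕ.+ m × α * frob m α ≈ ι a
      go zero      k<N αα≈a = ⊥-elim (α²≉a αα≈a)
      go k@(suc _) k<N αγ≈a = compare (ℕₚ.<-cmp (k ℕ.+ k) N)
        where
        -- Applying `frob k` to the product `α * frob k α`, which equals a in F, and cancelling
        -- `frob k α` shows that the partner relation is symmetric.
        frob-2k : frob (k ℕ.+ k) α ≈ α
        frob-2k = *-cancelˡ (frob k α) (frob (k ℕ.+ k) α) α (frob-≉0 k α≉0) (begin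
          frob k α * frob (k ℕ.+ k) α      ≈⟨ *-congˡ (frob-frob k k α) ⟨
          frob k α * frob k (frob k α)     ≈⟨ frob-* k α (frob k α) ⟨
          frob k (α * frob k α)            ≈⟨ frob-cong k αγ≈a ⟩
          frob k (ι a)                     ≈⟨ frob-ι k a ⟩
          ι a                              ≈⟨ αγ≈a ⟨
          α * frob k α                     ≈⟨ *-comm α _ ⟩
          frob k α * α                     ∎)
        -- Since 0 < k < N, the orbit length N can divide 2k only as 2k = N; when 2k exceeds N, one
        -- full period is subtracted.
        compare : _ → ∃ λ m → N ≡ m ℕ.+ m × α * frob m α ≈ ι a
        compare (tri< 2k<N _ _) = ⊥-elim (α-not-fixed (k ℕ.+ k) (s≤s z≤n) 2k<N frob-2k)
        compare (tri≈ _ 2k≡N _) = k , ≡.sym 2k≡N , αγ≈a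
        compare (tri> _ _ N<2k) = ⊥-elim (α-not-fixed d (ℕₚ.m<n⇒0<n∸m N<2k) d<N (trans (sym (frob-N (frob d α))) (trans (frob-frob N d α)
            (trans (reflexive (≡.cong (λ j → frob j α) (ℕₚ.m+[n∸m]≡n (ℕₚ.<⇒≤ N<2k)))) frob-2k))))
          where
          d = (k ℕ.+ k) ℕ.∸ N
          d<N : d ℕ.< N
          d<N = ℕₚ.+-cancelˡ-< N d N (≡.subst (ℕ._< N ℕ.+ N) (≡.sym (ℕₚ.m+[n∸m]≡n (ℕₚ.<⇒≤ N<2k))) (ℕₚ.+-mono-< k<N k<N))

    module Halfway (m : ℕ) (N≡2m : N ≡ m ℕ.+ m) (αγ≈a : α * frob m α ≈ ι a) where

      T-N : ∀ u → T N u ≈ T m (u * frob m u)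
      T-N u = trans (reflexive (≡.cong (λ k → T k u) N≡2m)) (T-double m u)

      -- The N roots form m pairs with product a, and the signs cancel within each pair.
      halfway-constant-term : P.coeff h 0 F.≈ a ^ᶠ m
      halfway-constant-term = ι-injective (begin
        ι (P.coeff h 0)                  ≈⟨ constant-term ⟩
        T N (- α)                        ≈⟨ T-N (- α) ⟩
        T m (- α * frob m (- α))         ≈⟨ T-cong m (trans (*-congˡ (frob-neg m α)) (trans (solve 2 (λ x y → :- x :* :- y := x :* y) refl α (frob m α)) αγ≈a)) ⟩
        T m (ι a)                        ≈⟨ T-ι m a ⟩
        ι a ^ m                          ≈⟨ ^-homo a m ⟨
        ι (a ^ᶠ m)                       ∎)

      frob-2m : ∀ x → frob m (frob m x) ≈ x
      frob-2m x = trans (frob-frob m m x) (trans (reflexive (≡.cong (λ k → frob k x) (≡.sym N≡2m))) (frob-N x))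

      δ Δ : Carrier
      δ = α - frob m α
      Δ = ι (F.- a) ^ m * T m δ

      -- `frob m` exchanges α and a/α.
      frob-δ : frob m δ ≈ - δ
      frob-δ = begin
        frob m (α - frob m α)             ≈⟨ frob-+ m α (- frob m α) ⟩
        frob m α + frob m (- frob m α)    ≈⟨ +-congˡ (trans (frob-neg m (frob m α)) (-‿cong (frob-2m α))) ⟩
        frob m α - α                      ≈⟨ solve 2 (λ x y → y :- x := :- (x :- y)) refl α (frob m α) ⟩
        - δ                               ∎

      0<m : ∀ k → N ≡ k ℕ.+ k → 0 ℕ.< k
      0<m zero    eq = ≡.subst (0 ℕ.<_) eq 0<N
      0<m (suc k) eq = s≤s z≤n

      δ≉0 : ¬ (δ ≈ 0#)
      δ≉0 eq = α-not-fixed m (0<m m N≡2m) (≡.subst (m ℕ.<_) (≡.sym N≡2m) (ℕₚ.m<m+n m (0<m m N≡2m))) (sym (x-y≈0⇒x≈y α (frob m α) eq))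

      -- `T (suc m) δ` can be split at either end: as `δ * φ (T m δ)`, or as `T m δ * frob m δ`,
      -- where `frob m δ` is -δ.
      φ-T-δ : φ (T m δ) ≈ - T m δ
      φ-T-δ = *-cancelˡ δ (φ (T m δ)) (- T m δ) δ≉0 (begin
        T (suc m) δ                   ≈⟨ reflexive (≡.cong (λ k → T k δ) (ℕₚ.+-comm 1 m)) ⟩
        T (m ℕ.+ 1) δ                 ≈⟨ T-+ m 1 δ ⟩
        T m δ * frob m (δ * φ 1#)     ≈⟨ *-congˡ (frob-cong m (trans (*-congˡ (frob-1# 1)) (*-identityʳ δ))) ⟩
        T m δ * frob m δ              ≈⟨ *-congˡ frob-δ ⟩
        T m δ * - δ                   ≈⟨ solve 2 (λ t d → t :* :- d := d :* :- t) refl (T m δ) δ ⟩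
        δ * - T m δ                   ∎)

      φ-Δ : φ Δ ≈ - Δ
      φ-Δ = begin
        φ (ι (F.- a) ^ m * T m δ)          ≈⟨ ^-distrib-* _ _ q ⟩
        φ (ι (F.- a) ^ m) * φ (T m δ)      ≈⟨ *-cong (trans (^-congˡ q (sym (^-homo (F.- a) m))) (trans (φ-ι ((F.- a) ^ᶠ m)) (^-homo (F.- a) m))) φ-T-δ ⟩
        ι (F.- a) ^ m * - T m δ            ≈⟨ solve 2 (λ x y → x :* :- y := :- (x :* y)) refl _ _ ⟩
        - Δ                                ∎

      Δ≉0 : ¬ (Δ ≈ 0#)
      Δ≉0 = *-≉0 (^-≉0 m (λ eq → ιa≉0 (trans (solve 1 (λ x → x := :- :- x) refl (ι a)) (trans (-‿cong (trans (sym (-‿homo a)) eq)) -0#≈0#)))) (T-≉0 m δ≉0)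

      -- Each pair of conjugates contributes a conjugate of -a δ² to the norm, so the norm carries
      -- one factor (-a)^m, and the twist supplies the second one that completes the square.
      Δ² : ι ((F.- a) ^ᶠ m F.* SquareRootNorm.norm F a h) ≈ Δ * Δ
      Δ² = begin
        ι ((F.- a) ^ᶠ m F.* SquareRootNorm.norm F a h)       ≈⟨ *-homo _ _ ⟩
        ι ((F.- a) ^ᶠ m) * ι (SquareRootNorm.norm F a h)     ≈⟨ *-cong (^-homo (F.- a) m) (trans (norm-T a) (T-N (α * α - ι a))) ⟩
        A * T m ((α * α - ι a) * frob m (α * α - ι a))       ≈⟨ *-congˡ (T-cong m (trans (*-congˡ (trans (frob-+ m _ _) (+-cong (frob-* m α α) (trans (frob-neg m (ι a)) (-‿cong (frob-ι m a)))))) pairing)) ⟩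
        A * T m (ι (F.- a) * (δ * δ))                        ≈⟨ *-congˡ (trans (T-* m _ _) (*-cong (T-ι m (F.- a)) (T-* m δ δ))) ⟩
        A * (A * (T m δ * T m δ))                            ≈⟨ solve 2 (λ x t → x :* (x :* (t :* t)) := x :* t :* (x :* t)) refl A (T m δ) ⟩
        Δ * Δ                                                ∎
        where
        A = ι (F.- a) ^ m
        γ = frob m α
        -- With a = α γ the two factors are α (α - γ) and γ (γ - α).
        pairing : (α * α - ι a) * (γ * γ - ι a) ≈ ι (F.- a) * (δ * δ)
        pairing = begin
          (α * α - ι a) * (γ * γ - ι a)            ≈⟨ *-cong (+-congˡ (-‿cong (sym αγ≈a))) (+-congˡ (-‿cong (sym αγ≈a))) ⟩
          (α * α - α * γ) * (γ * γ - α * γ)        ≈⟨ solve 2 (λ x y → (x :* x :- x :* y) :* (y :* y :- x :* y) := :- (x :* y) :* ((x :- y) :* (x :- y))) refl α γ ⟩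
          - (α * γ) * (δ * δ)                      ≈⟨ *-congʳ (trans (-‿cong αγ≈a) (sym (-‿homo a))) ⟩
          ι (F.- a) * (δ * δ)                      ∎

      -- Δ is a square root of this element whose conjugate is -Δ.
      norm-nonresidue : ∀ t → q ≡ suc (2 ℕ.* t) → ((F.- a) ^ᶠ m F.* SquareRootNorm.norm F a h) ^ᶠ t F.≈ F.- F.1#
      norm-nonresidue t q≡ = ι-injective (begin
        ι (((F.- a) ^ᶠ m F.* SquareRootNorm.norm F a h) ^ᶠ t)   ≈⟨ ^-homo _ t ⟩
        ι ((F.- a) ^ᶠ m F.* SquareRootNorm.norm F a h) ^ t      ≈⟨ ^-congˡ t Δ² ⟩
        (Δ * Δ) ^ t                                             ≈⟨ *-cancelˡ Δ ((Δ * Δ) ^ t) (- 1#) Δ≉0 Δ-power ⟩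
        - 1#                                                    ≈⟨ -‿cong (sym 1#-homo) ⟩
        - ι F.1#                                                ≈⟨ -‿homo F.1# ⟨
        ι (F.- F.1#)                                            ∎)
        where
        Δ-power : Δ * (Δ * Δ) ^ t ≈ Δ * - 1#
        Δ-power = begin
          Δ * (Δ * Δ) ^ t            ≈⟨ *-congˡ (^-congˡ t (*-congˡ (sym (*-identityʳ Δ)))) ⟩
          Δ * (Δ ^ 2) ^ t            ≈⟨ *-congˡ (^-assocʳ Δ 2 t) ⟩
          Δ ^ suc (2 ℕ.* t)          ≈⟨ ^-congʳ Δ (≡.sym q≡) ⟩
          φ Δ                        ≈⟨ φ-Δ ⟩
          - Δ                        ≈⟨ solve 1 (λ x → :- x := x :* :- con (+ 1)) refl Δ ⟩
          Δ * - 1#                   ∎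

    -- The remaining possibilities are h = x - √a and h = x² - a.
    √a-constant-term : α * α ≈ ι a → ι (P.coeff h 0) ≈ - (α ^ N)
    √a-constant-term α²≈a = trans constant-term (go N ≡.refl)
      where
      -- φ fixes α² = a, so it can only change the sign of α.
      φα : φ α ≈ α ⊎ φ α ≈ - α
      φα = [ (λ eq → inj₁ (x-y≈0⇒x≈y (φ α) α eq))
           , (λ eq → inj₂ (trans (solve 2 (λ x y → y := y :+ x :- x) refl α (φ α)) (trans (+-congʳ eq) (+-identityˡ (- α))))) ]′ (integral (φ α - α) (φ α + α) (begin
        (φ α - α) * (φ α + α)     ≈⟨ solve 2 (λ x y → (y :- x) :* (y :+ x) := y :* y :- x :* x) refl α (φ α) ⟩
        φ α * φ α - α * α         ≈⟨ x≈y⇒x-y≈0 (trans (sym (frob-* 1 α α)) (trans (frob-cong 1 α²≈a) (trans (φ-ι a) (sym α²≈a)))) ⟩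
        0#                        ∎))
      go : ∀ k → N ≡ k → T k (- α) ≈ - (α ^ k)
      not-fixed : 1 ℕ.< N → φ α ≈ - α
      not-fixed 1<N = fromInj₂ (λ fixed → ⊥-elim (α-not-fixed 1 (s≤s z≤n) 1<N fixed)) φα
      go zero                ≡.refl = ⊥-elim (ℕₚ.n≮0 0<N)
      go (suc zero)          ≡.refl = trans (*-congˡ (frob-1# 1)) (solve 1 (λ x → :- x :* con (+ 1) := :- (x :* con (+ 1))) refl α)
      go (suc (suc zero))    ≡.refl = begin
        - α * φ (- α * φ 1#)    ≈⟨ *-congˡ (frob-cong 1 (trans (*-congˡ (frob-1# 1)) (*-identityʳ (- α)))) ⟩
        - α * φ (- α)           ≈⟨ *-congˡ (trans (frob-neg 1 α) (-‿cong (not-fixed (s≤s (s≤s z≤n))))) ⟩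
        - α * - - α             ≈⟨ solve 1 (λ x → :- x :* :- :- x := :- (x :* (x :* con (+ 1)))) refl α ⟩
        - (α ^ 2)               ∎
      -- Two sign changes cancel, so the orbit of α has at most two elements.
      go (suc (suc (suc k))) ≡.refl = ⊥-elim (α-not-fixed 2 (s≤s z≤n) (s≤s (s≤s (s≤s z≤n))) (begin
        φ (φ α)   ≈⟨ frob-cong 1 (not-fixed (s≤s (s≤s z≤n))) ⟩
        φ (- α)   ≈⟨ frob-neg 1 α ⟩
        - φ α     ≈⟨ -‿cong (not-fixed (s≤s (s≤s z≤n))) ⟩
        - - α     ≈⟨ solve 1 (λ x → :- :- x := x) refl α ⟩
        α         ∎))

    -- So h cannot divide a self-reversed f only once: the cofactor f′ would satisfy
    -- f′(√a) = - f′(√a).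
    √a-repeated-root : ∀ n D f′ → α * α ≈ ι a → N ℕ.+ D ≡ n ℕ.+ n → Degree.Below F (suc D) f′ →
      P.const (P.coeff h 0) P.*ₚ reverse D f′ P.≋ P.const (a ^ᶠ n) P.*ₚ f′ → evalAt f′ α ≈ 0#
    -- At the fixed point α of x ↦ a/x, reversing f′ only multiplies its value by α^D. As h(0) =
    -- -α^N, the equation `rev` then equates α^(2n) f′(α) with its negative.
    √a-repeated-root n D f′ α²≈a N+D≡2n B rev = fromInj₂ (λ z → ⊥-elim (^-≉0 (n ℕ.+ n) α≉0 z)) (integral (α ^ (n ℕ.+ n)) (evalAt f′ α) (-x≈x⇒x≈0 (begin
      - (α ^ (n ℕ.+ n) * evalAt f′ α)                 ≈⟨ -‿cong (*-congʳ (trans (^-congʳ α (≡.sym N+D≡2n)) (^-homo-* α N D))) ⟩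
      - (α ^ N * α ^ D * evalAt f′ α)                 ≈⟨ solve 3 (λ x y z → :- (x :* y :* z) := :- x :* (y :* z)) refl (α ^ N) (α ^ D) (evalAt f′ α) ⟩
      - (α ^ N) * (α ^ D * evalAt f′ α)               ≈⟨ *-cong (√a-constant-term α²≈a) (evalAt-reverse a D f′ α α α²≈a B) ⟨
      ι (P.coeff h 0) * evalAt (reverse D f′) α       ≈⟨ evalAt-const-* (P.coeff h 0) (reverse D f′) α ⟨
      evalAt (P.const (P.coeff h 0) P.*ₚ reverse D f′) α   ≈⟨ evalAt-cong α rev ⟩
      evalAt (P.const (a ^ᶠ n) P.*ₚ f′) α             ≈⟨ evalAt-const-* (a ^ᶠ n) f′ α ⟩
      ι (a ^ᶠ n) * evalAt f′ α                        ≈⟨ *-congʳ (trans (^-homo a n) (trans (^-congˡ n (sym α²≈a)) (trans (^-distrib-* α α n) (sym (^-homo-* α n n))))) ⟩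
      α ^ (n ℕ.+ n) * evalAt f′ α                     ∎)))

-- The number of factors modulo 2 from the twisted norm.

module Parity {c ℓ} (F : CommutativeRing c ℓ) (p e : ℕ) (p-prime : Prime p) (1<q : 1 ℕ.< p ℕ.^ e)
  (finite : FiniteField.IsFiniteField F (p ℕ.^ e)) (t : ℕ) (q≡1+2t : p ℕ.^ e ≡ ℕ.suc (2 ℕ.* t))
  (a : CommutativeRing.Carrier F) (a≉0 : ¬ (CommutativeRing._≈_ F a (CommutativeRing.0# F))) where

  private q = p ℕ.^ e
  open CommutativeRing F hiding (zero)
  open PolynomialRing F
  open Degree F
  open SquareRootNorm F a using (norm; norm-cong; norm-*; norm-scale; norm-1)
  open Reciprocal F a
  open FiniteField.IsFiniteField finite
  open Degree.Nontrivial F 1≉0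
  open IntegerCoefficients F using (solve; _:=_; con; _:*_; _:-_; :-_)
  open IntegerCoefficients polynomialRing using () renaming (solve to solveₚ; _:=_ to _:=ₚ_; _:*_ to _:*ₚ_)
  open import Algebra.Properties.CommutativeSemiring.Exp commutativeSemiring
  open import Algebra.Properties.Semiring.Mult semiring using (×1-homo-*; ×-congˡ) renaming (_×_ to _·_)
  open import Algebra.Properties.CommutativeMonoid.Sum (CommutativeRing.*-commutativeMonoid polynomialRing) using () renaming (sum-remove to product-remove)
  open import Relation.Binary.Reasoning.Setoid setoid

  -- q · 1 vanishes, but for odd q it would be 1 if 1 + 1 were 0.
  2≉0 : ¬ (1# + 1# ≈ 0#)
  2≉0 eq = 1≉0 (begin
    1#                              ≈⟨ +-identityʳ 1# ⟨
    1# + 0#                         ≈⟨ +-congˡ (trans (*-congʳ (trans (+-congˡ (+-identityʳ 1#)) eq)) (zeroˡ (t · 1#))) ⟨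
    1# + (2 · 1#) * (t · 1#)        ≈⟨ +-congˡ (×1-homo-* 2 t) ⟨
    suc (2 ℕ.* t) · 1#              ≈⟨ ×-congˡ {1#} (≡.sym q≡1+2t) ⟩
    q · 1#                          ≈⟨ order·1≈0 ⟩
    0#                              ∎)

  const-inverse : ∀ {b} d f → d * b ≈ 1# → const d *ₚ (const b *ₚ f) ≋ f
  const-inverse {b} d f db≈1 = ≋-trans (≋-sym (*ₚ-assoc (const d) (const b) f))
    (≋-trans (*ₚ-congˡ {const d *ₚ const b} {const 1#} f (≋-trans (≋-sym (const-* d b)) (const-cong db≈1))) (*ₚ-identityˡ f))

  const-cancel : ∀ b f g → ¬ (b ≈ 0#) → const b *ₚ f ≋ const b *ₚ g → f ≋ g
  const-cancel b f g b≉0 eq = let (d , db≈1) = inverseʳ b b≉0 in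
    ≋-trans (≋-sym (const-inverse d f db≈1)) (≋-trans (*ₚ-congʳ (const d) eq) (const-inverse d g db≈1))

  Leading-unit : ∀ {N b} f v → Leading N b f → ¬ (b ≈ 0#) → v *ₚ f ≋ const 1# → N ≡ 0
  Leading-unit {N} {b} f v L b≉0 vf≋1 = let (d , db≈1) = inverseʳ b b≉0 in
    Monic-unit (const d *ₚ f) (v *ₚ const b) (Leading-congˡ (const d *ₚ f) db≈1 (Leading-const-* d f L))
      (≋-trans (solveₚ 4 (λ v b d f → v :*ₚ b :*ₚ (d :*ₚ f) :=ₚ v :*ₚ (d :*ₚ (b :*ₚ f))) ≋-refl v (const b) (const d) f)
        (≋-trans (*ₚ-congʳ v (const-inverse d f db≈1)) vf≋1))

  *-≉0ˡ : ∀ {x y} → ¬ (x * y ≈ 0#) → ¬ (x ≈ 0#)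
  *-≉0ˡ {x} {y} xy≉0 x≈0 = xy≉0 (trans (*-congʳ x≈0) (zeroˡ y))

  *-≉0ʳ : ∀ {x y} → ¬ (x * y ≈ 0#) → ¬ (y ≈ 0#)
  *-≉0ʳ {x} {y} xy≉0 y≈0 = xy≉0 (trans (*-congˡ y≈0) (zeroʳ x))

  irreducible-split : ∀ {g} s y → Irreducible g → g ≋ s *ₚ y → (∃ λ w → w *ₚ s ≋ const 1#) ⊎ (∃ λ w → w *ₚ y ≋ const 1#)
  irreducible-split s y g-irr eq = [ (λ { (w , ws≈1) → inj₁ (w , mk ws≈1) }) , (λ { (w , wy≈1) → inj₂ (w , mk wy≈1) }) ]′
    (Irreducible.split-∣1 g-irr {s} {y} (at eq))

  reverse-factor : ∀ {M N E} b g v h → MonicOfDegree M g → Irreducible g → MonicOfDegree N h → 0 ℕ.< N → MonicOfDegree E v → E ℕ.+ N ≡ M →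
    reverse M g ≋ const b *ₚ (v *ₚ h) → E ≡ 0
  reverse-factor {M} {N} {E} b g v h g-monic g-irr h-monic 0<N v-monic ≡.refl eq = [ left , right ]′ (irreducible-split s (reverse N h) g-irr g≋)
    where
    -- The reversal of g has constant term a^M, which is nonzero, so v and h have nonzero constant
    -- terms and their reversals keep the full degrees E and N.
    constants : ¬ (coeff v 0 * coeff h 0 ≈ 0#)
    constants = *-≉0ʳ {b} λ z → ^-≉0 M a≉0 (begin
      a ^ M                                ≈⟨ *-identityˡ _ ⟨
      1# * a ^ M                           ≈⟨ *-congʳ (proj₁ g-monic) ⟨
      coeff g M * a ^ M                    ≈⟨ coeff-reverse-0 M g ⟨
      coeff (reverse M g) 0                ≈⟨ at eq 0 ⟩
      coeff (const b *ₚ (v *ₚ h)) 0        ≈⟨ coeff-const-* b (v *ₚ h) 0 ⟩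
      b * coeff (v *ₚ h) 0                 ≈⟨ *-congˡ (coeff-*-0 v h) ⟩
      b * (coeff v 0 * coeff h 0)          ≈⟨ z ⟩
      0#                                   ∎)
    d = proj₁ (inverseʳ (a ^ M) (^-≉0 M a≉0))
    s : Poly
    s = const d *ₚ (const b *ₚ reverse E v)
    g≋ : g ≋ s *ₚ reverse N h
    g≋ = ≋R.begin
      g                                                               ≋R.≈⟨ const-inverse d g (proj₂ (inverseʳ (a ^ M) (^-≉0 M a≉0))) ⟨
      const d *ₚ (const (a ^ M) *ₚ g)                                 ≋R.≈⟨ *ₚ-congʳ (const d) (reverse-involutive M g (proj₂ g-monic)) ⟨
      const d *ₚ reverse M (reverse M g)                              ≋R.≈⟨ *ₚ-congʳ (const d) (≋-trans (reverse-cong M eq) (reverse-const-* M b (v *ₚ h))) ⟩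
      const d *ₚ (const b *ₚ reverse M (v *ₚ h))                      ≋R.≈⟨ *ₚ-congʳ (const d) (*ₚ-congʳ (const b) (reverse-* E N v h (proj₂ v-monic) (proj₂ h-monic))) ⟩
      const d *ₚ (const b *ₚ (reverse E v *ₚ reverse N h))
        ≋R.≈⟨ solveₚ 4 (λ b g v h → b :*ₚ (g :*ₚ (v :*ₚ h)) :=ₚ b :*ₚ (g :*ₚ v) :*ₚ h) ≋-refl (const d) (const b) (reverse E v) (reverse N h) ⟩
      s *ₚ reverse N h                                                ≋R.∎
      where
      module ≋R = ≋-Reasoning
    left : (∃ λ w → w *ₚ s ≋ const 1#) → E ≡ 0
    left (w , ws≋1) = Leading-unit (reverse E v) (w *ₚ (const d *ₚ const b)) (Leading-reverse E v) (*-≉0ˡ constants)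
      (≋-trans (solveₚ 4 (λ w b g v → w :*ₚ (b :*ₚ g) :*ₚ v :=ₚ w :*ₚ (b :*ₚ (g :*ₚ v))) ≋-refl w (const d) (const b) (reverse E v)) ws≋1)
    right : (∃ λ w → w *ₚ reverse N h ≋ const 1#) → E ≡ 0
    right (w , wR≋1) = ⊥-elim (ℕₚ.<⇒≢ 0<N (≡.sym (Leading-unit (reverse N h) w (Leading-reverse N h) (*-≉0ʳ constants) wR≋1)))

  -- Reversing reverse M g = u h once more factors g, so one of the factors is a unit.
  reverse-irreducible : ∀ {M N} g h u → MonicOfDegree M g → Irreducible g → MonicOfDegree N h → 0 ℕ.< N → ¬ (coeff g 0 ≈ 0#) →
    reverse M g ≋ u *ₚ h → M ≡ N × reverse M g ≋ const (coeff g 0) *ₚ h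
  reverse-irreducible {M} {N} g h u g-monic g-irr h-monic 0<N g₀≉0 eq =
    conclude (inverseʳ (coeff g 0) g₀≉0)
    where
    g₀ = coeff g 0
    conclude : (∃ λ d → d * g₀ ≈ 1#) → M ≡ N × reverse M g ≋ const g₀ *ₚ h
    conclude (d , dg₀≈1) = finish (monic-quotient v h h-monic (Leading-cong dR≋vh
        (Leading-congˡ (const d *ₚ reverse M g) dg₀≈1 (Leading-const-* d (reverse M g) (Leading-reverse M g)))))
      where
      v : Poly
      v = const d *ₚ u
      dR≋vh : const d *ₚ reverse M g ≋ v *ₚ h
      dR≋vh = ≋-trans (*ₚ-congʳ (const d) eq) (≋-sym (*ₚ-assoc (const d) u h))
      R≋ : reverse M g ≋ const g₀ *ₚ (v *ₚ h)
      R≋ = ≋-trans (≋-sym (const-inverse g₀ (reverse M g) (trans (*-comm g₀ d) dg₀≈1))) (*ₚ-congʳ (const g₀) dR≋vh)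
      finish : (∃ λ E → E ℕ.+ N ≡ M × MonicOfDegree E v) → M ≡ N × reverse M g ≋ const g₀ *ₚ h
      finish (E , E+N≡M , v-monic) with reverse-factor g₀ g v h g-monic g-irr h-monic 0<N v-monic E+N≡M R≋
      ... | ≡.refl = ≡.sym E+N≡M , ≋-trans R≋ (*ₚ-congʳ (const g₀) (≋-trans (*ₚ-congˡ h (Leading-0⇒const v v-monic)) (*ₚ-identityˡ h)))

  -- The nontrivial a-self reciprocal polynomials of degree 2n.
  SelfReversed : ℕ → Poly → Set ℓ
  SelfReversed n f = MonicOfDegree (n ℕ.+ n) f × reverse (n ℕ.+ n) f ≋ const (a ^ n) *ₚ f

  -- Comparing leading coefficients in the reversal equation shows that its constant a^n already
  -- encodes nontriviality.
  selfReversed-constant : ∀ n f → SelfReversed n f → coeff f 0 ≈ a ^ n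
  selfReversed-constant n f (m , r) = begin
    coeff f 0                                  ≈⟨ proj₁ (Leading-reverse (n ℕ.+ n) f) ⟨
    coeff (reverse (n ℕ.+ n) f) (n ℕ.+ n)      ≈⟨ at r (n ℕ.+ n) ⟩
    coeff (const (a ^ n) *ₚ f) (n ℕ.+ n)       ≈⟨ coeff-const-* (a ^ n) f (n ℕ.+ n) ⟩
    a ^ n * coeff f (n ℕ.+ n)                  ≈⟨ *-congˡ (proj₁ m) ⟩
    a ^ n * 1#                                 ≈⟨ *-identityʳ _ ⟩
    a ^ n                                      ∎

  -- A cofactor of even-degree polynomials has even degree, as nontriviality presupposes.
  double-injective : ∀ m n D → m ℕ.+ m ℕ.+ D ≡ n ℕ.+ n → ∃ λ k → n ≡ m ℕ.+ k × D ≡ k ℕ.+ k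
  double-injective zero    n       D eq = n , ≡.refl , eq
  double-injective (suc m) (suc n) D eq with double-injective m n D
    (ℕₚ.suc-injective (ℕₚ.suc-injective (≡.trans (≡.cong (λ x → suc (x ℕ.+ D)) (≡.sym (ℕₚ.+-suc m m))) (≡.trans eq (≡.cong suc (ℕₚ.+-suc n n))))))
  ... | k , n≡ , D≡ = k , ≡.cong suc n≡ , D≡

  -- Reversal is multiplicative, so P and the constant a^m can be cancelled from the equation for f;
  -- exactly a^k is left for the cofactor.
  selfReversed-quotient : ∀ n m {D} f P f′ → SelfReversed n f → SelfReversed m P → MonicOfDegree D f′ → f ≋ P *ₚ f′ →
    ∃ λ k → n ≡ m ℕ.+ k × SelfReversed k f′
  selfReversed-quotient n m {D} f P f′ (f-monic , f-rev) (P-monic , P-rev) f′-monic eq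
    with double-injective m n D (degree-unique {f = P *ₚ f′} (Monic-* P f′ P-monic f′-monic) (Leading-cong eq f-monic))
  ... | k , ≡.refl , ≡.refl = k , ≡.refl , f′-monic ,
    const-cancel (a ^ m) _ _ (^-≉0 m a≉0) (monic-cancel P (const (a ^ m) *ₚ reverse (k ℕ.+ k) f′) (const (a ^ m) *ₚ (const (a ^ k) *ₚ f′)) P-monic (≋R.begin
      P *ₚ (const (a ^ m) *ₚ reverse (k ℕ.+ k) f′)             ≋R.≈⟨ solveₚ 3 (λ p b r → p :*ₚ (b :*ₚ r) :=ₚ (b :*ₚ p) :*ₚ r) ≋-refl P (const (a ^ m)) (reverse (k ℕ.+ k) f′) ⟩
      const (a ^ m) *ₚ P *ₚ reverse (k ℕ.+ k) f′               ≋R.≈⟨ *ₚ-congˡ (reverse (k ℕ.+ k) f′) P-rev ⟨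
      reverse (m ℕ.+ m) P *ₚ reverse (k ℕ.+ k) f′              ≋R.≈⟨ reverse-* (m ℕ.+ m) (k ℕ.+ k) P f′ (proj₂ P-monic) (proj₂ f′-monic) ⟨
      reverse (m ℕ.+ m ℕ.+ (k ℕ.+ k)) (P *ₚ f′)                ≋R.≈⟨ reverse-cong (m ℕ.+ m ℕ.+ (k ℕ.+ k)) eq ⟨
      reverse (m ℕ.+ m ℕ.+ (k ℕ.+ k)) f                        ≋R.≈⟨ ≡.subst (λ j → reverse j f ≋ const (a ^ (m ℕ.+ k)) *ₚ f) (degrees m k) f-rev ⟩
      const (a ^ (m ℕ.+ k)) *ₚ f                               ≋R.≈⟨ *ₚ-cong (≋-trans (const-cong (^-homo-* a m k)) (const-* (a ^ m) (a ^ k))) eq ⟩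
      const (a ^ m) *ₚ const (a ^ k) *ₚ (P *ₚ f′)              ≋R.≈⟨ solveₚ 4 (λ p b d f → b :*ₚ d :*ₚ (p :*ₚ f) :=ₚ p :*ₚ (b :*ₚ (d :*ₚ f))) ≋-refl P (const (a ^ m)) (const (a ^ k)) f′ ⟩
      P *ₚ (const (a ^ m) *ₚ (const (a ^ k) *ₚ f′))            ≋R.∎))
    where
    module ≋R = ≋-Reasoning
    degrees : ∀ m k → m ℕ.+ k ℕ.+ (m ℕ.+ k) ≡ m ℕ.+ m ℕ.+ (k ℕ.+ k)
    degrees m k = ℕ-interchange
      where
      open import Algebra.Properties.CommutativeSemigroup ℕₚ.+-commutativeSemigroup using (interchange)
      ℕ-interchange = interchange m k m k

  -- (-a)ⁿ f(√a) f(-√a)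
  twistedNorm : ℕ → Poly → Carrier
  twistedNorm n f = (- a) ^ n * norm f

  twistedNorm-* : ∀ m k f P f′ → f ≋ P *ₚ f′ → twistedNorm (m ℕ.+ k) f ≈ twistedNorm m P * twistedNorm k f′
  twistedNorm-* m k f P f′ eq = begin
    (- a) ^ (m ℕ.+ k) * norm f                          ≈⟨ *-cong (^-homo-* (- a) m k) (trans (norm-cong f (P *ₚ f′) eq) (norm-* P f′)) ⟩
    ((- a) ^ m * (- a) ^ k) * (norm P * norm f′)        ≈⟨ solve 4 (λ x y u v → (x :* y) :* (u :* v) := (x :* u) :* (y :* v)) refl _ _ _ _ ⟩
    twistedNorm m P * twistedNorm k f′                  ∎

  -- y (y²)^t = y^q = y by Fermat.
  square-power : ∀ y → ¬ (y ≈ 0#) → (y * y) ^ t ≈ 1#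
  square-power y y≉0 = *-cancelˡ y ((y * y) ^ t) 1# y≉0 (begin
    y * (y * y) ^ t        ≈⟨ *-congˡ (^-congˡ t (*-congˡ (sym (*-identityʳ y)))) ⟩
    y * (y ^ 2) ^ t        ≈⟨ *-congˡ (^-assocʳ y 2 t) ⟩
    y ^ suc (2 ℕ.* t)      ≈⟨ ^-congʳ y (≡.sym q≡1+2t) ⟩
    y ^ q                  ≈⟨ fermat y ⟩
    y                      ≈⟨ *-identityʳ y ⟨
    y * 1#                 ∎)

  Irreducible-Monic-∣ : ∀ {M N} g h u → MonicOfDegree M g → Irreducible g → MonicOfDegree N h → 0 ℕ.< N → g ≋ u *ₚ h → g ≋ h
  Irreducible-Monic-∣ g h u g-monic g-irr h-monic 0<N eq = [ left , right ]′ (irreducible-split u h g-irr eq)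
    where
    right : (∃ λ w → w *ₚ h ≋ const 1#) → g ≋ h
    right (w , wh≋1) = ⊥-elim (ℕₚ.<⇒≢ 0<N (≡.sym (Monic-unit h w h-monic wh≋1)))
    left : (∃ λ w → w *ₚ u ≋ const 1#) → g ≋ h
    left (w , wu≋1) = let (E , _ , u-monic) = monic-quotient u h h-monic (Leading-cong eq g-monic) in
      ≋-trans eq (≋-trans (*ₚ-congˡ h (Leading-0⇒const u (≡.subst (λ k → MonicOfDegree k u) (Monic-unit u w u-monic wu≋1) u-monic))) (*ₚ-identityˡ h))

  product-constant-≉0 : ∀ k (g : Fin k → Poly) → ¬ (coeff (product g) 0 ≈ 0#) → ∀ i → ¬ (coeff (g i) 0 ≈ 0#)
  product-constant-≉0 (suc k) g nz zero    = *-≉0ˡ (λ z → nz (trans (coeff-*-0 (g zero) (product (λ i → g (suc i)))) z))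
  product-constant-≉0 (suc k) g nz (suc i) = product-constant-≉0 k (λ i → g (suc i)) (*-≉0ʳ (λ z → nz (trans (coeff-*-0 (g zero) (product (λ i → g (suc i)))) z))) i

  -- With b = g(0), (-a)^N N(g) is the norm of the reversal b h of g, that is b² N(h); hence the
  -- twisted norm of h g is the square of b N(h).
  mutual-reciprocals : ∀ {N} h g → MonicOfDegree N h → MonicOfDegree N g → reverse N g ≋ const (coeff g 0) *ₚ h →
    ¬ (coeff g 0 ≈ 0#) → ¬ (norm h ≈ 0#) → SelfReversed N (h *ₚ g) × twistedNorm N (h *ₚ g) ^ t ≈ 1#
  mutual-reciprocals {N} h g h-monic g-monic g-reversed g₀≉0 norm≉0 =
    (Monic-* h g h-monic g-monic , reversed) , trans (^-congˡ t twistedNorm≈) (square-power (b * norm h) (*-≉0 g₀≉0 norm≉0))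
    where
    module ≋R = ≋-Reasoning
    b = coeff g 0
    reversed : reverse (N ℕ.+ N) (h *ₚ g) ≋ const (a ^ N) *ₚ (h *ₚ g)
    reversed = ≋R.begin
      reverse (N ℕ.+ N) (h *ₚ g)              ≋R.≈⟨ reverse-* N N h g (proj₂ h-monic) (proj₂ g-monic) ⟩
      reverse N h *ₚ reverse N g              ≋R.≈⟨ *ₚ-congʳ (reverse N h) g-reversed ⟩
      reverse N h *ₚ (const b *ₚ h)           ≋R.≈⟨ solveₚ 3 (λ r b h → r :*ₚ (b :*ₚ h) :=ₚ (b :*ₚ r) :*ₚ h) ≋-refl (reverse N h) (const b) h ⟩
      const b *ₚ reverse N h *ₚ h             ≋R.≈⟨ *ₚ-congˡ h (reverse-const-* N b h) ⟨
      reverse N (const b *ₚ h) *ₚ h           ≋R.≈⟨ *ₚ-congˡ h (reverse-cong N g-reversed) ⟨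
      reverse N (reverse N g) *ₚ h            ≋R.≈⟨ *ₚ-congˡ h (reverse-involutive N g (proj₂ g-monic)) ⟩
      const (a ^ N) *ₚ g *ₚ h                 ≋R.≈⟨ solveₚ 3 (λ c g h → c :*ₚ g :*ₚ h :=ₚ c :*ₚ (h :*ₚ g)) ≋-refl (const (a ^ N)) g h ⟩
      const (a ^ N) *ₚ (h *ₚ g)               ≋R.∎
    norm-const-* : norm (const b *ₚ h) ≈ b * b * norm h
    norm-const-* = trans (norm-cong (const b *ₚ h) (scale b h) (const-*ₚ b h)) (norm-scale b h)
    twistedNorm≈ : twistedNorm N (h *ₚ g) ≈ b * norm h * (b * norm h)
    twistedNorm≈ = begin
      (- a) ^ N * norm (h *ₚ g)               ≈⟨ *-congˡ (norm-* h g) ⟩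
      (- a) ^ N * (norm h * norm g)           ≈⟨ solve 3 (λ x y z → x :* (y :* z) := y :* (x :* z)) refl _ _ _ ⟩
      norm h * ((- a) ^ N * norm g)           ≈⟨ *-congˡ (norm-reverse N g (proj₂ g-monic)) ⟨
      norm h * norm (reverse N g)             ≈⟨ *-congˡ (trans (norm-cong (reverse N g) (const b *ₚ h) g-reversed) norm-const-*) ⟩
      norm h * (b * b * norm h)               ≈⟨ solve 2 (λ x b → x :* (b :* b :* x) := b :* x :* (b :* x)) refl (norm h) b ⟩
      b * norm h * (b * norm h)               ∎

  -- The contribution of one irreducible factor h.

  module Factor {c′ ℓ′} (K : CommutativeRing c′ ℓ′) (ι : Carrier → CommutativeRing.Carrier K)
    (ι-homomorphism : IsRingHomomorphism rawRing (CommutativeRing.rawRing K) ι)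
    (ι-injective : ∀ {x y} → CommutativeRing._≈_ K (ι x) (ι y) → x ≈ y)
    (N : ℕ) (0<N : 0 ℕ.< N) (finiteK : FiniteField.IsFiniteField K (q ℕ.^ N)) (α : CommutativeRing.Carrier K)
    (generates : ∀ y → ∃ λ f → CommutativeRing._≈_ K (PolynomialMap.evalAt F K ι ι-homomorphism f α) y)
    (h : Poly) (h-monic : MonicOfDegree N h) (h-irr : Irreducible h) (h₀≉0 : ¬ (coeff h 0 ≈ 0#))
    (h-root : CommutativeRing._≈_ K (PolynomialMap.evalAt F K ι ι-homomorphism h α) (CommutativeRing.0# K))
    (root⇒multiple : ∀ f → CommutativeRing._≈_ K (PolynomialMap.evalAt F K ι ι-homomorphism f α) (CommutativeRing.0# K) → ∃ λ u → f ≋ u *ₚ h)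
    where

    private
      module K = CommutativeRing K
      module KF = FiniteField.IsFiniteField finiteK
    open PolynomialMap F K ι ι-homomorphism using (evalAt; evalAt-cong; evalAt-congʳ; evalAt-*; evalAt-product; +-homo; 0#-homo; 1#-homo)

    2≉0ₖ : ¬ (K.1# K.+ K.1# K.≈ K.0#)
    2≉0ₖ eq = 2≉0 (ι-injective (K.trans (+-homo 1# 1#) (K.trans (K.+-cong 1#-homo 1#-homo) (K.trans eq (K.sym 0#-homo)))))

    open Conjugates F K ι ι-homomorphism ι-injective p e p-prime 1<q finite N 0<N finiteK α generates h h-monic h-root
    open Partner a a≉0 2≉0ₖ h₀≉0

    IsRoot√a : Set _
    IsRoot√a = α K.* α K.≈ ι a

    -- If a/α is a root of g, then α is a root of its reversal, which h therefore divides.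
    partner-reverse : ∀ {M} g → MonicOfDegree M g → Irreducible g → ¬ (coeff g 0 ≈ 0#) → evalAt g β K.≈ K.0# →
      M ≡ N × reverse M g ≋ const (coeff g 0) *ₚ h
    partner-reverse {M} g g-monic g-irr g₀≉0 eq = let (u , R≋) = root⇒multiple (reverse M g) (reverse-root M g (proj₂ g-monic) eq) in
      reverse-irreducible g h u g-monic g-irr h-monic 0<N g₀≉0 R≋

    selfReversed-root : ∀ n f f′ → SelfReversed n f → f ≋ h *ₚ f′ → evalAt f β K.≈ K.0#
    selfReversed-root n f f′ (f-monic , f-rev) f≋ = partner-root (n ℕ.+ n) f (a ^ n) (proj₂ f-monic) f-rev
      (K.trans (evalAt-cong α f≋) (K.trans (evalAt-* h f′ α) (K.trans (K.*-congʳ {evalAt f′ α} h-root) (K.zeroˡ (evalAt f′ α)))))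

    -- When α = a/α, h is its own reciprocal up to a constant, so the cofactor satisfies the
    -- equation of `√a-repeated-root` and vanishes at α; then h would occur among the remaining
    -- factors.
    √a-excluded : ∀ n {D r} f (g : Fin r → Poly) → SelfReversed n f → MonicOfDegree D (product g) → f ≋ h *ₚ product g →
      (∀ i → Monic (g i)) → (∀ i → Irreducible (g i)) → (∀ i → ¬ (g i ≋ h)) → ¬ IsRoot√a
    √a-excluded n {D} f g (f-monic , f-rev) f′-monic f≋ g-monic g-irr g≉h α²≈a =
      let (i , gᵢα≈0) = KF.∏-≈0 (λ i → evalAt (g i) α) (K.trans (K.sym (evalAt-product _ g α)) f′α≈0)
          (u , gᵢ≋) = root⇒multiple (g i) gᵢα≈0
      in g≉h i (Irreducible-Monic-∣ (g i) h u (proj₂ (g-monic i)) (g-irr i) h-monic 0<N gᵢ≋)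
      where
      module ≋R = ≋-Reasoning
      f′ : Poly
      f′ = product g
      β≈α : β K.≈ α
      β≈α = KF.*-cancelˡ α β α α≉0 (K.trans αβ≈a (K.sym α²≈a))
      h-reversed : reverse N h ≋ const (coeff h 0) *ₚ h
      h-reversed = proj₂ (partner-reverse h h-monic h-irr h₀≉0 (K.trans (evalAt-congʳ h β≈α) h-root))
      N+D≡2n : N ℕ.+ D ≡ n ℕ.+ n
      N+D≡2n = degree-unique {f = h *ₚ f′} (Monic-* h f′ h-monic f′-monic) (Leading-cong f≋ f-monic)
      f′-reversed : const (coeff h 0) *ₚ reverse D f′ ≋ const (a ^ n) *ₚ f′
      f′-reversed = monic-cancel h (const (coeff h 0) *ₚ reverse D f′) (const (a ^ n) *ₚ f′) h-monic (≋R.begin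
        h *ₚ (const (coeff h 0) *ₚ reverse D f′)       ≋R.≈⟨ solveₚ 3 (λ h b r → h :*ₚ (b :*ₚ r) :=ₚ (b :*ₚ h) :*ₚ r) ≋-refl h (const (coeff h 0)) (reverse D f′) ⟩
        const (coeff h 0) *ₚ h *ₚ reverse D f′         ≋R.≈⟨ *ₚ-congˡ (reverse D f′) h-reversed ⟨
        reverse N h *ₚ reverse D f′                    ≋R.≈⟨ reverse-* N D h f′ (proj₂ h-monic) (proj₂ f′-monic) ⟨
        reverse (N ℕ.+ D) (h *ₚ f′)                    ≋R.≈⟨ reverse-cong (N ℕ.+ D) f≋ ⟨
        reverse (N ℕ.+ D) f                            ≋R.≈⟨ ≡.subst (λ k → reverse k f ≋ const (a ^ n) *ₚ f) (≡.sym N+D≡2n) f-rev ⟩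
        const (a ^ n) *ₚ f                             ≋R.≈⟨ *ₚ-congʳ (const (a ^ n)) f≋ ⟩
        const (a ^ n) *ₚ (h *ₚ f′)                     ≋R.≈⟨ solveₚ 3 (λ h b f → b :*ₚ (h :*ₚ f) :=ₚ h :*ₚ (b :*ₚ f)) ≋-refl h (const (a ^ n)) f′ ⟩
        h *ₚ (const (a ^ n) *ₚ f′)                     ≋R.∎)
      f′α≈0 : evalAt f′ α K.≈ K.0#
      f′α≈0 = √a-repeated-root n D f′ α²≈a N+D≡2n (proj₂ f′-monic) f′-reversed

    own-partner : ¬ IsRoot√a → evalAt h β K.≈ K.0# → ∃ λ m → SelfReversed m h × twistedNorm m h ^ t ≈ - 1#
    own-partner α²≉a hβ≈0 = let (m , N≡2m , αγ≈a) = halfway hβ≈0 α²≉a in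
      m , ( ≡.subst (λ k → MonicOfDegree k h) N≡2m h-monic
          , ≋-trans (≡.subst (λ k → reverse k h ≋ const (coeff h 0) *ₚ h) N≡2m (proj₂ (partner-reverse h h-monic h-irr h₀≉0 hβ≈0)))
              (*ₚ-congˡ h (const-cong (Halfway.halfway-constant-term m N≡2m αγ≈a))))
        , Halfway.norm-nonresidue m N≡2m αγ≈a t q≡1+2t

    other-partner : ∀ {M} g → ¬ IsRoot√a → MonicOfDegree M g → Irreducible g → ¬ (coeff g 0 ≈ 0#) → evalAt g β K.≈ K.0# →
      SelfReversed N (h *ₚ g) × twistedNorm N (h *ₚ g) ^ t ≈ 1#
    other-partner {M} g α²≉a g-monic g-irr g₀≉0 gβ≈0 = let (M≡N , g-reversed) = partner-reverse g g-monic g-irr g₀≉0 gβ≈0 in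
      mutual-reciprocals h g h-monic (≡.subst (λ k → MonicOfDegree k g) M≡N g-monic) (≡.subst (λ k → reverse k g ≋ const (coeff g 0) *ₚ h) M≡N g-reversed) g₀≉0 (norm-≉0 α²≉a)

    partner : ∀ n {r} f (g : Fin r → Poly) → SelfReversed n f → f ≋ h *ₚ product g → (∀ i → Monic (g i)) → (∀ i → Irreducible (g i)) →
      (∀ i → ¬ (coeff (g i) 0 ≈ 0#)) → (∀ i → ¬ (g i ≋ h)) →
      (∃ λ m → SelfReversed m h × twistedNorm m h ^ t ≈ - 1#) ⊎ (∃ λ i → SelfReversed N (h *ₚ g i) × twistedNorm N (h *ₚ g i) ^ t ≈ 1#)
    partner n {r} f g f-rev f≋ g-monic g-irr g₀≉0 g≉h =
      [ (λ hβ≈0 → inj₁ (own-partner α²≉a hβ≈0)) , (λ gβ≈0 → inj₂ (another (KF.∏-≈0 (λ i → evalAt (g i) β) (K.trans (K.sym (evalAt-product r g β)) gβ≈0)))) ]′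
        (KF.integral (evalAt h β) (evalAt (product g) β)
          (K.trans (K.sym (evalAt-* h (product g) β)) (K.trans (K.sym (evalAt-cong β f≋)) (selfReversed-root n f (product g) f-rev f≋))))
      where
      α²≉a : ¬ IsRoot√a
      α²≉a = √a-excluded n f g f-rev (proj₂ (Monic-product r g g-monic)) f≋ g-monic g-irr g≉h
      another : (∃ λ i → evalAt (g i) β K.≈ K.0#) → ∃ λ i → SelfReversed N (h *ₚ g i) × twistedNorm N (h *ₚ g i) ^ t ≈ 1#
      another (i , gᵢβ≈0) = i , other-partner (g i) α²≉a (proj₂ (g-monic i)) (g-irr i) (g₀≉0 i) gᵢβ≈0

  -- The field is now F[x]/(h), and α is the class of x.
  quotient-partner : ∀ h N → MonicOfDegree N h → Irreducible h → ¬ (coeff h 0 ≈ 0#) →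
    ∀ n {r} f (g : Fin r → Poly) → SelfReversed n f → f ≋ h *ₚ product g → (∀ i → Monic (g i)) → (∀ i → Irreducible (g i)) →
    (∀ i → ¬ (coeff (g i) 0 ≈ 0#)) → (∀ i → ¬ (g i ≋ h)) →
    (∃ λ m → SelfReversed m h × twistedNorm m h ^ t ≈ - 1#) ⊎ (∃ λ i → SelfReversed N (h *ₚ g i) × twistedNorm N (h *ₚ g i) ^ t ≈ 1#)
  quotient-partner h N h-monic h-irr h₀≉0 = Factor.partner Q.K const Q.const-homomorphism Q.const-injective N Q.h-positive Q.finiteₕ X
    (λ f → f , Q.evalAt-X f) h h-monic h-irr h₀≉0 Q.h-root Q.root⇒multiple
    where module Q = QuotientField F finite h N h-monic h-irr

  -- Induction on the number of factors.

  FactorsOf : ∀ {r} → (Fin r → Poly) → Set _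
  FactorsOf g = (∀ i → Monic (g i)) × (∀ i → Irreducible (g i)) × (∀ i j → i ≢ j → ¬ (g i ≋ g j))

  -- The half degree k of the cofactor is only found inside the proof, so the value y is required
  -- for every admissible k.
  peel : ∀ n m {r x y} f P (g : Fin r → Poly) → SelfReversed n f → SelfReversed m P → (∀ i → Monic (g i)) → f ≋ P *ₚ product g →
    twistedNorm m P ^ t ≈ x → (∀ k → SelfReversed k (product g) → twistedNorm k (product g) ^ t ≈ y) → twistedNorm n f ^ t ≈ x * y
  peel n m {r} {x} {y} f P g f-rev P-rev g-monic f≋ Px gy =
    conclude (selfReversed-quotient n m f P (product g) f-rev P-rev (proj₂ (Monic-product r g g-monic)) f≋)
    where
    conclude : (∃ λ k → n ≡ m ℕ.+ k × SelfReversed k (product g)) → twistedNorm n f ^ t ≈ x * y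
    conclude (k , ≡.refl , g-rev) = begin
      twistedNorm (m ℕ.+ k) f ^ t                               ≈⟨ ^-congˡ t (twistedNorm-* m k f P (product g) f≋) ⟩
      (twistedNorm m P * twistedNorm k (product g)) ^ t         ≈⟨ ^-distrib-* _ _ t ⟩
      twistedNorm m P ^ t * twistedNorm k (product g) ^ t       ≈⟨ *-cong Px (gy k g-rev) ⟩
      x * y                                                     ∎

  -- By induction on r: the reciprocal of the first factor h is either h itself,
  -- contributing -1, or another factor, and then the pair contributes 1.
  parity : ∀ r (g : Fin r → Poly) → FactorsOf g → ∀ n f → SelfReversed n f → f ≋ product g → twistedNorm n f ^ t ≈ (- 1#) ^ r
  parity-pair : ∀ r h N (g : Fin r → Poly) → FactorsOf g → ∀ n f → SelfReversed n f → f ≋ h *ₚ product g →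
    (∃ λ i → SelfReversed N (h *ₚ g i) × twistedNorm N (h *ₚ g i) ^ t ≈ 1#) → twistedNorm n f ^ t ≈ (- 1#) ^ suc r

  parity zero g _ n f (f-monic , _) f≋ = empty n (degree-unique {f = const 1#} (Leading-cong f≋ f-monic) Leading-1#)
    where
    empty : ∀ n → n ℕ.+ n ≡ 0 → twistedNorm n f ^ t ≈ 1#
    empty zero _ = begin
      (1# * norm f) ^ t    ≈⟨ ^-congˡ t (trans (*-identityˡ _) (trans (norm-cong f (const 1#) f≋) norm-1)) ⟩
      1# ^ t               ≈⟨ ^-congˡ t (*-identityˡ 1#) ⟨
      (1# * 1#) ^ t        ≈⟨ square-power 1# 1≉0 ⟩
      1#                   ∎
  parity (suc r) g (g-monic , g-irr , g-distinct) n f f-rev f≋ =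
    [ (λ { (m , h-rev , χ) → peel n m f h g′ f-rev h-rev (λ i → g-monic (suc i)) f≋ χ (λ k g-rev → parity r g′ g′-factors k (product g′) g-rev ≋-refl) })
    , parity-pair r h N g′ g′-factors n f f-rev f≋ ]′
      (quotient-partner h N (proj₂ (g-monic zero)) (g-irr zero) (constants zero) n f g′ f-rev f≋
        (λ i → g-monic (suc i)) (λ i → g-irr (suc i)) (λ i → constants (suc i)) (λ i → g-distinct (suc i) zero (λ ())))
    where
    h = g zero
    N = proj₁ (g-monic zero)
    g′ : Fin r → Poly
    g′ i = g (suc i)
    g′-factors : FactorsOf g′
    g′-factors = (λ i → g-monic (suc i)) , (λ i → g-irr (suc i)) , λ i j i≢j → g-distinct (suc i) (suc j) (λ eq → i≢j (Finₚ.suc-injective eq))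
    constants : ∀ i → ¬ (coeff (g i) 0 ≈ 0#)
    constants = product-constant-≉0 (suc r) g λ eq → ^-≉0 n a≉0 (trans (sym (selfReversed-constant n f f-rev)) (trans (at f≋ 0) eq))

  parity-pair (suc r) h N g (g-monic , g-irr , g-distinct) n f f-rev f≋ (i , P-rev , χ) = begin
    twistedNorm n f ^ t            ≈⟨ peel n N f (h *ₚ g i) g′ f-rev P-rev (λ l → g-monic (punchIn i l)) f≋P χ
                                        (λ k g-rev → parity r g′ g′-factors k (product g′) g-rev ≋-refl) ⟩
    -- The pair accounts for two factors, and (-1)² = 1.
    1# * (- 1#) ^ r                ≈⟨ solve 1 (λ x → con (+ 1) :* x := :- con (+ 1) :* (:- con (+ 1) :* x)) refl _ ⟩
    (- 1#) ^ suc (suc r)           ∎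
    where
    g′ : Fin r → Poly
    g′ l = g (punchIn i l)
    g′-factors : FactorsOf g′
    g′-factors = (λ l → g-monic (punchIn i l)) , (λ l → g-irr (punchIn i l)) ,
      λ l l′ l≢l′ → g-distinct (punchIn i l) (punchIn i l′) (λ eq → l≢l′ (Finₚ.punchIn-injective i l l′ eq))
    f≋P : f ≋ h *ₚ g i *ₚ product g′
    f≋P = ≋-trans f≋ (≋-trans (*ₚ-congʳ h (product-remove {r} {i} g)) (≋-sym (*ₚ-assoc h (g i) (product g′))))

-- Arithmetic of the odd prime power q.

even-or-odd : ∀ n → ∃ λ t → n ≡.≡ 2 ℕ.* t ⊎ n ≡.≡ suc (2 ℕ.* t)
even-or-odd zero = 0 , inj₁ ≡.refl
even-or-odd (suc n) with even-or-odd n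
... | t , inj₁ ≡.refl = t , inj₂ ≡.refl
... | t , inj₂ ≡.refl = suc t , inj₁ (≡.cong suc (≡.sym (ℕₚ.+-suc t (t ℕ.+ 0))))

prime-power>1 : ∀ {p e} → Prime p → 1 ℕ.≤ e → 1 ℕ.< p ℕ.^ e
prime-power>1 {p} {suc e} p-prime _ = ℕₚ.≤-trans (ℕ.nonTrivial⇒n>1 p) (ℕₚ.m≤m*n p (p ℕ.^ e) {{ℕₚ.m^n≢0 p e}})
  where instance
    _ = Primality.prime⇒nonTrivial p-prime
    _ = Primality.prime⇒nonZero p-prime

-- From parity to squares in a finite field.

module FiniteHeytingField {c ℓ₁ ℓ₂} (F : HeytingField c ℓ₁ ℓ₂) where
  open HeytingField F hiding (zero)
  open Field F
  open HeytingProperties heytingCommutativeRing using (1#0)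
  open Exp (CommutativeRing.commutativeSemiring commutativeRing) using (^-congˡ; ^-congʳ; ^-distrib-*; ^-assocʳ)
  open SetoidReasoning setoid
  open IntegerCoefficients commutativeRing using (solve; _:=_; con; _:*_; _:-_; :-_)

  #⇒≉0 : ∀ {x} → x # 0# → ¬ (x ≈ 0#)
  #⇒≉0 x#0 x≈0 = #-irrefl x≈0 x#0

  -- In a finite field invertibility is decidable, so tightness yields a true alternative.
  isFiniteField : ∀ {q} → HasOrder q → FiniteField.IsFiniteField commutativeRing q
  isFiniteField {q} order = record { 1≉0 = #⇒≉0 1#0 ; enumeration = order ; 0-or-unit = 0-or-unit }
    where
    open Bundles.Inverse order using (to; from; strictlyInverseʳ)
    0-or-unit : ∀ x → x ≈ 0# ⊎ ∃ λ y → y * x ≈ 1#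
    0-or-unit x with Finₚ.any? (λ i → FiniteField.decide-≈ commutativeRing order (from i * x) 1#)
    ... | yes (i , eq) = inj₂ (from i , eq)
    ... | no none = inj₁ (proj₁ (tight x 0#) λ x#0 → none
      (to (inverse x x#0) , trans (*-congʳ (strictlyInverseʳ (inverse x x#0))) (inverse-* x x#0)))

  1^ : ∀ k → 1# ^ k ≈ 1#
  1^ zero    = refl
  1^ (suc k) = trans (*-identityˡ _) (1^ k)

  [-1]^even : ∀ t → (- 1#) ^ (2 ℕ.* t) ≈ 1#
  [-1]^even t = trans (sym (^-assocʳ (- 1#) 2 t)) (trans (^-congˡ t (solve 0 (:- con (+ 1) :* (:- con (+ 1) :* con (+ 1)) := con (+ 1)) refl)) (1^ t))

  -- a^(n(n-2)) and aⁿ differ by a square, since n(n-2) ≡ n modulo 2.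
  module _ (t : ℕ) (a : Carrier) (a#0 : a # 0#) (aᵗaᵗ≈1 : a ^ t * a ^ t ≈ 1#) where

    private
      A = a ^ t

    ^-swap : ∀ k → (a ^ k) ^ t ≈ A ^ k
    ^-swap k = trans (^-assocʳ a k t) (trans (^-congʳ a (ℕₚ.*-comm k t)) (sym (^-assocʳ a t k)))

    A^2+ : ∀ k → A ^ suc (suc k) ≈ A ^ k
    A^2+ k = trans (sym (*-assoc A A (A ^ k))) (trans (*-congʳ aᵗaᵗ≈1) (*-identityˡ _))

    A^k≈1-or-A : ∀ k → A ^ k ≈ 1# ⊎ A ^ k ≈ A
    A^k≈1-or-A zero          = inj₁ refl
    A^k≈1-or-A (suc zero)    = inj₂ (*-identityʳ A)
    A^k≈1-or-A (suc (suc k)) with A^k≈1-or-A k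
    ... | inj₁ eq = inj₁ (trans (A^2+ k) eq)
    ... | inj₂ eq = inj₂ (trans (A^2+ k) eq)

    -- As A² = 1, A^k is 1 or A. If it is 1, so is its power; if it is A, the power is A^(k+2) =
    -- A^k.
    A^[2+k]k : ∀ k → A ^ (suc (suc k) ℕ.* k) ≈ A ^ k
    A^[2+k]k k = trans (^-congʳ A (ℕₚ.*-comm (suc (suc k)) k)) (trans (sym (^-assocʳ A k (suc (suc k)))) (cases (A^k≈1-or-A k)))
      where
      cases : A ^ k ≈ 1# ⊎ A ^ k ≈ A → (A ^ k) ^ suc (suc k) ≈ A ^ k
      cases (inj₁ eq) = trans (^-congˡ (suc (suc k)) eq) (trans (1^ (suc (suc k))) (sym eq))
      cases (inj₂ eq) = trans (^-congˡ (suc (suc k)) eq) (A^2+ k)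

    zpow-power : ∀ n → 1 ℕ.≤ n → zpow a a#0 (+ n ℤ.* (+ n ℤ.- + 2)) ^ t ≈ (a ^ n) ^ t
    -- For n = 1 the exponent n (n - 2) is -1; the inverse of a has the same t-th power as a because
    -- A² = 1.
    zpow-power (suc zero) _ = begin
      (b * 1#) ^ t          ≈⟨ ^-congˡ t (*-identityʳ b) ⟩
      b ^ t                 ≈⟨ *-identityʳ _ ⟨
      b ^ t * 1#            ≈⟨ *-congˡ aᵗaᵗ≈1 ⟨
      b ^ t * (A * A)       ≈⟨ *-assoc _ _ _ ⟨
      b ^ t * A * A         ≈⟨ *-congʳ (trans (sym (^-distrib-* b a t)) (trans (^-congˡ t (inverse-* a a#0)) (1^ t))) ⟩
      1# * A                ≈⟨ *-identityˡ A ⟩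
      A                     ≈⟨ ^-congˡ t (*-identityʳ a) ⟨
      (a * 1#) ^ t          ∎
      where b = inverse a a#0
    -- For n = k + 2 the exponent is the natural number (k + 2) k.
    zpow-power (suc (suc k)) _ = begin
      zpow a a#0 (+ n ℤ.* + k) ^ t     ≡⟨ ≡.cong (λ i → zpow a a#0 i ^ t) (+◃n≡+n (n ℕ.* k)) ⟩
      (a ^ (n ℕ.* k)) ^ t              ≈⟨ ^-swap (n ℕ.* k) ⟩
      A ^ (n ℕ.* k)                    ≈⟨ A^[2+k]k k ⟩
      A ^ k                            ≈⟨ A^2+ k ⟨
      A ^ n                            ≈⟨ ^-swap n ⟨
      (a ^ n) ^ t                      ∎
      where n = suc (suc k)

  module SquareCriterion (p e : ℕ) (p-prime : Prime p) (1<q : 1 ℕ.< p ℕ.^ e) (order : HasOrder (p ℕ.^ e)) (t : ℕ) (q≡1+2t : p ℕ.^ e ≡.≡ suc (2 ℕ.* t))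
    (a : Carrier) (a#0 : a # 0#) where

    open PolynomialRing commutativeRing using (_≋_; mk; at; const; ≋-sym; ≋-trans; *ₚ-congˡ)
    open FiniteField.IsFiniteField (isFiniteField order) using (euler-criterion; 1≉0; ^-≉0)
    open Parity commutativeRing p e p-prime 1<q (isFiniteField order) t q≡1+2t a (#⇒≉0 a#0)
    open Reciprocal commutativeRing a using (reverse; applyDownFrom-reverse; const-cong)
    open SquareRootNorm commutativeRing a using (norm)

    -- Multiplying the reciprocal equation by f(0) = a^n clears the inverse.
    selfReversed : ∀ n f → NontrivialSelfReciprocal a n f → SelfReversed n f
    selfReversed n f nsr = ≡.subst (λ N → MonicOfDegree N f × reverse N f ≋ const (a ^ n) *ₚ f) (≡.cong (n ℕ.+_) (ℕₚ.+-identityʳ n)) (monic , reversed)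
      where
      open NontrivialSelfReciprocal nsr
      open SelfReciprocal selfReciprocal
      reversed : reverse (2 ℕ.* n) f ≋ const (a ^ n) *ₚ f
      reversed = ≋-trans (≋-sym (const-inverse (coeff f 0) (reverse (2 ℕ.* n) f) (trans (*-comm _ _) (inverse-* (coeff f 0) b₀#0))))
        (≋-trans (PolynomialRing.*ₚ-congʳ commutativeRing (const (coeff f 0)) (≋-trans (≋-sym (applyDownFrom-reverse (2 ℕ.* n) (inverse (coeff f 0) b₀#0) f)) (mk reciprocal≈f)))
          (*ₚ-congˡ f (const-cong b₀≈aᵐ)))

    -- The quantity of the theorem, with the norm form in place of f(√a) f(-√a).
    discriminant : ℕ → Poly → Carrier
    discriminant n f = (- 1#) ^ n * zpow a a#0 (+ n ℤ.* (+ n ℤ.- + 2)) * norm f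

    discriminant-power : ∀ n → 1 ℕ.≤ n → ∀ f → discriminant n f ^ t ≈ twistedNorm n f ^ t
    discriminant-power n 1≤n f = begin
      ((- 1#) ^ n * z * norm f) ^ t                   ≈⟨ trans (^-distrib-* _ _ t) (*-congʳ (^-distrib-* _ _ t)) ⟩
      ((- 1#) ^ n) ^ t * z ^ t * norm f ^ t           ≈⟨ *-congʳ (*-congˡ (zpow-power t a a#0 (trans (sym (^-distrib-* a a t)) (square-power a (#⇒≉0 a#0))) n 1≤n)) ⟩
      ((- 1#) ^ n) ^ t * (a ^ n) ^ t * norm f ^ t     ≈⟨ trans (^-distrib-* _ _ t) (*-congʳ (^-distrib-* _ _ t)) ⟨
      ((- 1#) ^ n * a ^ n * norm f) ^ t               ≈⟨ ^-congˡ t (*-congʳ (trans (sym (^-distrib-* (- 1#) a n)) (^-congˡ n (solve 1 (λ a → :- con (+ 1) :* a := :- a) refl a)))) ⟩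
      twistedNorm n f ^ t                             ∎
      where z = zpow a a#0 (+ n ℤ.* (+ n ℤ.- + 2))

    -- This depends on t > 0, since 0^0 = 1; q > 1 supplies it.
    ^t≉0⇒≉0 : ∀ x → ¬ (x ^ t ≈ 0#) → ¬ (x ≈ 0#)
    ^t≉0⇒≉0 x xᵗ≉0 x≈0 = go t q≡1+2t xᵗ≉0
      where
      go : ∀ t → p ℕ.^ e ≡.≡ suc (2 ℕ.* t) → ¬ ¬ (x ^ t ≈ 0#)
      go zero    q≡1 _ = ℕₚ.<⇒≢ 1<q (≡.sym q≡1)
      go (suc t) _   n = n (trans (*-congʳ x≈0) (zeroˡ _))

    -- The equation D^t = (-1)^r settles both directions: for even r it gives 1, and Euler's
    -- criterion applies; a nonzero square has t-th power 1, which differs from -1 in odd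
    -- characteristic.
    even⇔square : ∀ n → 1 ℕ.≤ n → ∀ f → NontrivialSelfReciprocal a n f → ∀ r (g : Fin r → Poly) → FactorsOf g → f ≋ product g →
      2 ∣ r ⇔ IsSquare (discriminant n f)
    even⇔square n 1≤n f nsr r g factors f≋ = mk⇔ forward backward
      where
      D = discriminant n f
      Dᵗ : D ^ t ≈ (- 1#) ^ r
      Dᵗ = trans (discriminant-power n 1≤n f) (parity r g factors n f (selfReversed n f nsr) f≋)
      -1≉0 : ¬ (- 1# ≈ 0#)
      -1≉0 eq = 1≉0 (trans (solve 0 (con (+ 1) := :- con (+ 1) :* :- con (+ 1)) refl) (trans (*-congʳ eq) (zeroˡ _)))
      -- Zero is a square too, so the converse has to know that D is nonzero; its t-th power is a
      -- power of -1.
      D≉0 : ¬ (D ≈ 0#)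
      D≉0 = ^t≉0⇒≉0 D λ z → ^-≉0 r -1≉0 (trans (sym Dᵗ) z)
      forward : 2 ∣ r → IsSquare D
      forward (Divisibility.divides j ≡.refl) = euler-criterion 1<q t q≡1+2t D (trans Dᵗ (trans (^-congʳ (- 1#) (ℕₚ.*-comm j 2)) ([-1]^even j)))
      backward : IsSquare D → 2 ∣ r
      backward (w , ww≈D) with even-or-odd r
      ... | j , inj₁ r≡2j = Divisibility.divides j (≡.trans r≡2j (ℕₚ.*-comm 2 j))
      ... | j , inj₂ r≡1+2j = ⊥-elim (2≉0 (begin
        1# + 1#               ≈⟨ +-congˡ (trans (sym (square-power w w≉0)) (trans (^-congˡ t ww≈D) (trans Dᵗ (^-congʳ (- 1#) r≡1+2j)))) ⟩
        1# + (- 1#) ^ suc (2 ℕ.* j)  ≈⟨ +-congˡ (trans (*-congˡ ([-1]^even j)) (*-identityʳ _)) ⟩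
        1# - 1#               ≈⟨ -‿inverseʳ 1# ⟩
        0#                    ∎))
        where
        w≉0 : ¬ (w ≈ 0#)
        w≉0 w≈0 = D≉0 (trans (sym ww≈D) (trans (*-congʳ w≈0) (zeroˡ w)))

    module _ {c′ ℓ₁′ ℓ₂′} (L : HeytingField c′ ℓ₁′ ℓ₂′) (ι : Carrier → HeytingField.Carrier L)
      (mono : IsRingMonomorphism rawRing (Field.rawRing L) ι) (√a : HeytingField.Carrier L) (√a² : HeytingField._≈_ L (HeytingField._*_ L √a √a) (ι a)) where

      private
        module L = HeytingField L
        module L′ = Field L
        module M = IsRingMonomorphism mono
        module Map = PolynomialMap commutativeRing L′.commutativeRing ι M.isRingHomomorphism

      ι-discriminant : ∀ n f → ι (discriminant n f) L.≈ ι ((- 1#) ^ n * zpow a a#0 (+ n ℤ.* (+ n ℤ.- + 2))) L.* (L′.eval (map ι f) √a L.* L′.eval (map ι f) (L.- √a))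
      ι-discriminant n f = L.trans (M.*-homo _ _) (L.*-congˡ (L.sym (L.trans (SquareRootNorm.norm-eval L′.commutativeRing (ι a) (map ι f) √a √a²) (Map.norm-map a f))))

-- The criterion with √a in an arbitrary extension field.

theorem5 : ∀ {c ℓ₁ ℓ₂ c′ ℓ₁′ ℓ₂′}
    (F : HeytingField c ℓ₁ ℓ₂) →
    let open HeytingField F
        open Field F
    in
    ∀ (p e : ℕ) → Prime p → 1 ℕ.≤ e → ¬ (2 ∣ p ℕ.^ e) → HasOrder (p ℕ.^ e) →
    ∀ (a : Carrier) (a#0 : a # 0#) (n : ℕ) → 1 ℕ.≤ n →
    ∀ (f : Poly) → NontrivialSelfReciprocal a n f →
    ∀ (r : ℕ) (g : Fin r → Poly) →
      (∀ i → Monic (g i)) →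
      (∀ i → Irreducible (g i)) →
      (∀ i j → i ≢ j → g i ≉ₚ g j) →
      f ≈ₚ product g →
    ∀ (L : HeytingField c′ ℓ₁′ ℓ₂′) →
    let module L  = HeytingField L
        module L′ = Field L
    in
    ∀ (ι : Carrier → L.Carrier) → IsRingMonomorphism rawRing L′.rawRing ι →
    ∀ (√a : L.Carrier) → √a L.* √a L.≈ ι a →
      2 ∣ r ⇔
        (∃ λ x →
          (ι x L.≈ ι ((- 1#) ^ n * zpow a a#0 (+ n ℤ.* (+ n ℤ.- + 2)))
                   L.* (L′.eval (map ι f) √a L.* L′.eval (map ι f) (L.- √a)))
          × IsSquare x)
theorem5 F p e p-prime 1≤e 2∤q order a a#0 n 1≤n f nsr r g g-monic g-irr g-distinct f≈ L ι mono √a √a² with even-or-odd (p ℕ.^ e)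
... | t , inj₁ q≡2t = ⊥-elim (2∤q (Divisibility.divides t (≡.trans q≡2t (ℕₚ.*-comm 2 t))))
... | t , inj₂ q≡1+2t = mk⇔
  (λ 2∣r → discriminant n f , ι-discriminant L ι mono √a √a² n f , Bundles.Equivalence.to equivalence 2∣r)
  -- `ι` is injective, so an x in F with the prescribed image is the discriminant itself.
  (λ { (x , ιx≈ , y , yy≈x) → Bundles.Equivalence.from equivalence
    (y , HeytingField.trans F yy≈x (M.injective (HeytingField.trans L ιx≈ (HeytingField.sym L (ι-discriminant L ι mono √a √a² n f))))) })
  where
  module M = IsRingMonomorphism mono
  open FiniteHeytingField.SquareCriterion F p e p-prime (prime-power>1 p-prime 1≤e) order t q≡1+2t a a#0
  equivalence = even⇔square n 1≤n f nsr r g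
    (g-monic , g-irr , λ i j i≢j eq → g-distinct i j i≢j (PolynomialRing.at eq)) (PolynomialRing.mk f≈)
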